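{- Let $G$ be a connected cubic graph on $n$ vertices. If $G$ is not the Petersen Graph, then $\gamma_{pr}(G)\leq 4n/7$.
   Context: All graphs are finite, simple and undirected. A cubic graph is a graph in which every vertex has degree 3. A paired dominating set of $G$ is a set $S\subseteq V(G)$ such that every vertex of $V(G)\setminus S$ has a neighbor in $S$ and the induced subgraph $G[S]$ has a perfect matching. The paired domination number $\gamma_{pr}(G)$ is the minimum size of a paired dominating set of $G$. The Petersen Graph is the cubic graph on 10 vertices whose vertices are the 2-element subsets of a 5-element set, two vertices adjacent iff the subsets are disjoint. -}

module Defs where

open import Data.Nat using (ℕ; zero; suc; _*_; _≤_)
open import Data.Bool using (Bool; true; false; _∧_; not)
open import Data.Bool.Properties using (∧-comm)
open import Data.Fin using (Fin; zero; suc; _≟_)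
open import Relation.Nullary using (yes; no)
open import Data.Empty using (⊥-elim)
open import Data.Fin.Subset using (Subset; _∈_; _∉_; ∣_∣)
open import Data.List using (List; length; filterᵇ; allFin)
open import Data.Product using (Σ; ∃; _×_; _,_)
open import Function.Bundles using (_⤖_; Bijection)
open import Relation.Nullary.Decidable using (⌊_⌋)
open import Relation.Binary.PropositionalEquality using (_≡_; refl; cong₂; sym)

record Graph (n : ℕ) : Set where
  field
    Adj    : Fin n → Fin n → Bool
    symm   : ∀ u v → Adj u v ≡ Adj v u
    irrefl : ∀ v → Adj v v ≡ false
open Graph public

degree : ∀ {n} → Graph n → Fin n → ℕ
degree {n} G v = length (filterᵇ (Adj G v) (allFin n))

Cubic : ∀ {n} → Graph n → Set
Cubic G = ∀ v → degree G v ≡ 3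

data Reachable {n} (G : Graph n) : Fin n → Fin n → Set where
  here : ∀ {u} → Reachable G u u
  step : ∀ {u w v} → Adj G u w ≡ true → Reachable G w v → Reachable G u v

Connected : ∀ {n} → Graph n → Set
Connected {n} G = ∀ (u v : Fin n) → Reachable G u v

-- Petersen graph: vertices = 2-subsets {a,b} (a<b) of Fin 5, adjacent iff disjoint.
p0 p1 p2 p3 p4 : Fin 5
p0 = zero
p1 = suc zero
p2 = suc (suc zero)
p3 = suc (suc (suc zero))
p4 = suc (suc (suc (suc zero)))

pairOf : Fin 10 → Fin 5 × Fin 5
pairOf zero = p0 , p1
pairOf (suc zero) = p0 , p2
pairOf (suc (suc zero)) = p0 , p3
pairOf (suc (suc (suc zero))) = p0 , p4
pairOf (suc (suc (suc (suc zero)))) = p1 , p2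
pairOf (suc (suc (suc (suc (suc zero))))) = p1 , p3
pairOf (suc (suc (suc (suc (suc (suc zero)))))) = p1 , p4
pairOf (suc (suc (suc (suc (suc (suc (suc zero))))))) = p2 , p3
pairOf (suc (suc (suc (suc (suc (suc (suc (suc zero)))))))) = p2 , p4
pairOf (suc (suc (suc (suc (suc (suc (suc (suc (suc zero))))))))) = p3 , p4

_=ᵇ_ : Fin 5 → Fin 5 → Bool
a =ᵇ b = ⌊ a ≟ b ⌋

disjoint : Fin 5 × Fin 5 → Fin 5 × Fin 5 → Bool
disjoint (a , b) (c , d) =
  not (a =ᵇ c) ∧ not (a =ᵇ d) ∧ not (b =ᵇ c) ∧ not (b =ᵇ d)

private
  =ᵇ-sym : ∀ a b → (a =ᵇ b) ≡ (b =ᵇ a)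
  =ᵇ-sym a b with a ≟ b | b ≟ a
  ... | yes _ | yes _ = refl
  ... | no _ | no _ = refl
  ... | yes p | no q = ⊥-elim (q (sym p))
  ... | no q | yes p = ⊥-elim (q (sym p))

  disjoint-sym : ∀ p q → disjoint p q ≡ disjoint q p
  disjoint-sym (a , b) (c , d)
    rewrite =ᵇ-sym a c | =ᵇ-sym a d | =ᵇ-sym b c | =ᵇ-sym b d
    = lemma (c =ᵇ a) (d =ᵇ a) (c =ᵇ b) (d =ᵇ b)
    where
      lemma : ∀ w x y z → (not w ∧ not x ∧ not y ∧ not z) ≡ (not w ∧ not y ∧ not x ∧ not z)
      lemma true _ _ _ = refl
      lemma false true true _ = refl
      lemma false true false _ = refl
      lemma false false true _ = refl
      lemma false false false _ = refl

  disjoint-irr : ∀ i → disjoint (pairOf i) (pairOf i) ≡ false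
  disjoint-irr zero = refl
  disjoint-irr (suc zero) = refl
  disjoint-irr (suc (suc zero)) = refl
  disjoint-irr (suc (suc (suc zero))) = refl
  disjoint-irr (suc (suc (suc (suc zero)))) = refl
  disjoint-irr (suc (suc (suc (suc (suc zero))))) = refl
  disjoint-irr (suc (suc (suc (suc (suc (suc zero)))))) = refl
  disjoint-irr (suc (suc (suc (suc (suc (suc (suc zero))))))) = refl
  disjoint-irr (suc (suc (suc (suc (suc (suc (suc (suc zero)))))))) = refl
  disjoint-irr (suc (suc (suc (suc (suc (suc (suc (suc (suc zero))))))))) = refl

Petersen : Graph 10
Petersen = record
  { Adj    = λ i j → disjoint (pairOf i) (pairOf j)
  ; symm   = λ i j → disjoint-sym (pairOf i) (pairOf j)
  ; irrefl = disjoint-irr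
  }

Isomorphic : ∀ {n m} → Graph n → Graph m → Set
Isomorphic {n} {m} G H =
  Σ (Fin n ⤖ Fin m) λ f →
    ∀ u v → Adj G u v ≡ Adj H (Bijection.to f u) (Bijection.to f v)

Dominating : ∀ {n} → Graph n → Subset n → Set
Dominating {n} G S = ∀ (v : Fin n) → v ∉ S → ∃ λ u → u ∈ S × Adj G v u ≡ true

-- G[S] has a perfect matching, encoded as the partner map M
-- (an involution on S sending each vertex of S to an adjacent vertex of S;
--  irreflexivity of Adj ensures M has no fixed points on S)
HasPerfectMatching : ∀ {n} → Graph n → Subset n → Set
HasPerfectMatching {n} G S =
  Σ (Fin n → Fin n) λ M →
    ∀ v → v ∈ S → (M v ∈ S) × (Adj G v (M v) ≡ true) × (M (M v) ≡ v)

PairedDominating : ∀ {n} → Graph n → Subset n → Set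
PairedDominating G S = Dominating G S × HasPerfectMatching G S

-- γ_pr(G) ≤ k  (min over paired dominating sets) unfolds to: some PDS has size ≤ k.
-- Here "γ_pr(G) ≤ 4n/7" is stated as: some PDS S has 7·|S| ≤ 4·n.
γpr≤4n/7 : ∀ {n} → Graph n → Set
γpr≤4n/7 {n} G = ∃ λ (S : Subset n) → PairedDominating G S × 7 * ∣ S ∣ ≤ 4 * n

{-# OPTIONS --safe #-}
module Submission where

-- A set of k edges whose ends dominate G can be turned into a paired dominating set of size at most 2k, so it suffices to
-- dominate G by 2n/7 edges. Let W be the set of vertices that are not yet dominated, and give a vertex with 3, 2, 1 or 0
-- neighbours in W the weight 10, 13, 19 or 35. If W ≠ V then W can be dominated at a cost of 35 per edge by its weight, plus 5
-- for every component of G[W] that is a 5-cycle or a 5-cycle with a doubled vertex: as G is connected, some vertex has at most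
-- two neighbours in W, and around it there are always edges that dominate a set X whose removal lowers the weight by at least
-- 35 per edge. Which edges to take is decided by exploring the neighbourhood of the vertex; the finitely many cases are
-- recorded in exploration trees, which are verified by evaluating a checker that is proved sound. Since V weighs 10n, the same
-- method applied to W = V gives the bound; there the exploration gets stuck only when it has uncovered the Petersen graph.

-- The weight falls short only on the two special components: a 5-cycle weighs 5 · 13 = 65 and the
-- other one weighs 66, but two edges cost 70. A reduction therefore also has to pay 5 for every
-- special component that it creates, and a local picture does not show how many there are. It does
-- show the vertices next to X. Every new special component contains some of them, and if each
-- contains at least m, then there are at most as many components as such vertices divided by m. To
-- make m large, configurations are settled in a fixed order: once an occurrence of one is known to
-- yield the bound, all later explorations may assume that it is absent. For W ≠ V the order starts
-- with special components that hang on the rest at one or two vertices only. The same device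
-- removes vertices of degree 1, then pairs of close vertices of degree 2, and at last all vertices
-- of degree 2. For W = V every vertex has the smallest weight, so the slack is least there. The
-- Petersen graph weighs 100, but no two of its edges dominate it and three cost 105.

open import Defs hiding (here; step; degree)
import Defs
open import Algebra.Properties.CommutativeSemigroup using (interchange)
open import Data.Bool using (Bool; true; false; _∧_; _∨_; not; T; T?; if_then_else_) renaming (_≟_ to _≟ᵇ_)
open import Data.Bool.ListAction using (all; any)
open import Data.Bool.Properties using (T-≡; ∧-identityʳ)
open import Data.Char using () renaming (toℕ to code)
open import Data.Empty using (⊥; ⊥-elim)
open import Data.Fin using (Fin; zero; suc; _≟_; toℕ; fromℕ<)
open import Data.Fin.Properties using (any?; all?; toℕ<n; toℕ-injective; toℕ-fromℕ<)
open import Data.Fin.Subset using (Subset; inside; outside; ∣_∣; _∪_; ⁅_⁆) renaming (_∈_ to _∈ₛ_; _∉_ to _∉ₛ_; ⊥ to ∅)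
open import Data.Fin.Subset.Properties using (x∈p∪q⁺; x∈p∪q⁻; x∈⁅x⁆; x∈⁅y⁆⇒x≡y; ∣⊥∣≡0; ∉⊥; ∣⁅x⁆∣≡1) renaming (_∈?_ to _∈ₛ?_)
open import Data.List using (List; []; _∷_; _++_; map; length; foldr; filterᵇ; upTo; applyUpTo; allFin; concatMap)
open import Data.List.Membership.DecPropositional using (_∈?_)
open import Data.List.Membership.Propositional using (_∈_; _∉_; find; lose)
open import Data.List.Membership.Propositional.Properties using (∈-allFin; ∈-filter⁺; ∈-filter⁻; ∈-map⁺; ∈-map⁻; ∈-upTo⁺; ∈-upTo⁻; ∈-++⁺ˡ; ∈-++⁺ʳ; ∈-++⁻; ∈-concatMap⁺; ∈-concatMap⁻; ∈-length)
open import Data.List.Membership.Propositional.Properties.WithK using (unique∧set⇒bag)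
open import Data.List.Properties using (length-map; length-upTo; length-++; length-tabulate; map-∘; map-upTo; ++-assoc)
open import Data.List.Relation.Binary.BagAndSetEquality using (∼bag⇒↭)
open import Data.List.Relation.Binary.Permutation.Propositional using (_↭_)
open import Data.List.Relation.Binary.Permutation.Propositional.Properties using (↭-length; map⁺)
open import Data.List.Relation.Unary.All using (All; []; _∷_)
import Data.List.Relation.Unary.All as All
open import Data.List.Relation.Unary.All.Properties using (¬All⇒Any¬)
open import Data.List.Relation.Unary.Any using (here; there)
import Data.List.Relation.Unary.Any as Any
open import Data.List.Relation.Unary.Unique.Propositional using (Unique; []; _∷_)
import Data.List.Relation.Unary.Unique.Propositional.Properties as Unique
open import Data.Maybe using (Maybe; just; nothing)
open import Data.Nat using (ℕ; zero; suc; _+_; _*_; _∸_; _⊔_; _/_; _≤_; _<_; z≤n; s≤s; _≡ᵇ_; _<ᵇ_; _≤ᵇ_)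
import Data.Nat as ℕ
open import Data.Nat.DivMod using (/-monoˡ-≤; m*n/n≡m)
open import Data.Nat.ListAction using (sum)
open import Data.Nat.ListAction.Properties using (sum-↭)
open import Data.Nat.Properties hiding (_≟_)
open import Data.Nat.Tactic.RingSolver using (solve-∀)
open import Data.Product using (_×_; _,_; proj₁; proj₂; ∃)
open import Data.String using (String; toList)
open import Data.Sum using (_⊎_; inj₁; inj₂; [_,_]′)
open import Data.Vec using ([]; _∷_)
open import Function using (_∘_; id; Equivalence; mk⇔)
open import Function.Bundles using (mk⤖)
open import Relation.Binary.PropositionalEquality
open import Relation.Nullary using (Dec; yes; no; does; ¬_)
open import Relation.Nullary.Decidable using (_×-dec_; ¬?; toWitness)

-- Patterns, exploration trees and their checker

-- A vertex (d , N) of a pattern has the known neighbours N; d is its degree inside W, or 0 as long as that is unknown.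
Vertex : Set
Vertex = ℕ × List ℕ

Pattern : Set
Pattern = List Vertex

vertex : Pattern → ℕ → Vertex
vertex []      _       = 0 , []
vertex (x ∷ _) zero    = x
vertex (_ ∷ P) (suc i) = vertex P i

known : Pattern → ℕ → ℕ
known P i = proj₁ (vertex P i)

nbrs : Pattern → ℕ → List ℕ
nbrs P i = proj₂ (vertex P i)

infix 4 _∈ᵇ_
_∈ᵇ_ : ℕ → List ℕ → Bool
i ∈ᵇ []       = false
i ∈ᵇ (j ∷ js) = (i ≡ᵇ j) ∨ (i ∈ᵇ js)

distinct : List ℕ → Bool
distinct []       = true
distinct (i ∷ is) = not (i ∈ᵇ is) ∧ distinct is

-- Distinctness of the listed neighbours is tested where it is needed instead of being an invariant
-- of patterns. A vertex with a repeated entry does no harm; it merely never counts as closed.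
good : Pattern → ℕ → Bool
good P i = distinct (nbrs P i)

closed : Pattern → ℕ → Bool
closed P i = (0 <ᵇ known P i) ∧ (length (nbrs P i) ≡ᵇ known P i) ∧ good P i

-- Three times the weights 35, 19, 13, 10, so that an edge costs 105.
weight : ℕ → ℕ
weight 0 = 105
weight 1 = 57
weight 2 = 39
weight _ = 30

update : Pattern → ℕ → (Vertex → Vertex) → Pattern
update []      _       f = []
update (x ∷ P) zero    f = f x ∷ P
update (x ∷ P) (suc i) f = x ∷ update P i f

setDegree : ℕ → Vertex → Vertex
setDegree d (_ , N) = d , N

addNbr : ℕ → Vertex → Vertex
addNbr j (d , N) = d , j ∷ N

newNbr : Pattern → ℕ → Pattern
newNbr P i = update P i (addNbr (length P)) ++ (0 , i ∷ []) ∷ []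

oldNbr : Pattern → ℕ → ℕ → Pattern
oldNbr P i j = update (update P i (addNbr j)) j (addNbr i)

-- A closed vertex has all its neighbours listed, so it can be the next neighbour of `i` only if it
-- lists `i` already.
joinable : Pattern → ℕ → ℕ → Bool
joinable P i j = not (j ≡ᵇ i) ∧ not (j ∈ᵇ nbrs P i) ∧ not (closed P j ∧ not (i ∈ᵇ nbrs P j))

nbrChildren : Pattern → ℕ → List Pattern
nbrChildren P i = map (oldNbr P i) (filterᵇ (joinable P i) (upTo (length P))) ++ newNbr P i ∷ []

isEdge : Pattern → ℕ × ℕ → Bool
isEdge P (a , b) = (a <ᵇ length P) ∧ (b ∈ᵇ nbrs P a)

covers : Pattern → ℕ → ℕ × ℕ → Bool
covers P i (a , b) = (i ≡ᵇ a) ∨ (i ≡ᵇ b) ∨ (i ∈ᵇ nbrs P a) ∨ (i ∈ᵇ nbrs P b)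

-- Only closed vertices are removed: the change of weight around a vertex can be computed only if
-- all its neighbours in W are known. Keeping a dominated vertex may pay, since its removal makes
-- its neighbours heavier.
removed : Pattern → List (ℕ × ℕ) → List ℕ → List ℕ
removed P F keep = filterᵇ (λ i → any (covers P i) F ∧ closed P i ∧ not (i ∈ᵇ keep)) (upTo (length P))

lost : Pattern → List ℕ → ℕ → ℕ
lost P X v = length (filterᵇ (λ x → v ∈ᵇ nbrs P x) X)

gain : Pattern → List ℕ → ℕ → ℕ
gain P X v = if v ∈ᵇ X then weight (known P v) else 0

increase : ℕ → ℕ → ℕ
increase l d = weight (d ∸ l) ∸ weight d

-- excluded: pairs of degrees that adjacent vertices cannot have any more.
-- attach-1: a special component of W ∖ X has more than this many vertices with a neighbour in X,
-- and all its degrees are in allowed, unless an earlier pattern occurs in W.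
record Mode : Set where
  constructor mode
  field
    excluded : List (ℕ × ℕ)
    attach-1 : ℕ
    allowed  : List ℕ

module _ (M : Mode) where
  open Mode M

  matches : ℕ → ℕ → ℕ × ℕ → Bool
  matches d e (x , y) = ((d ≡ᵇ x) ∧ (e ≡ᵇ y)) ∨ ((d ≡ᵇ y) ∧ (e ≡ᵇ x))

  compatible : ℕ → ℕ → Bool
  compatible d e = not (any (matches d e) excluded)

  atLeast : Pattern → ℕ → ℕ → Bool
  atLeast P i d = (length (nbrs P i) ≤ᵇ d) ∨ not (good P i)

  fits : Pattern → ℕ → ℕ → Bool
  fits P d t =
    if known P t ≡ᵇ 0 then any (λ e → atLeast P t e ∧ compatible d e) (1 ∷ 2 ∷ 3 ∷ [])
                      else compatible d (known P t)

  -- Degree 0 is missing because isolated vertices are disposed of without a pattern.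
  degrees : Pattern → ℕ → List ℕ
  degrees P i =
    if known P i ≡ᵇ 0 then filterᵇ (λ d → atLeast P i d ∧ all (fits P d) (nbrs P i)) (1 ∷ 2 ∷ 3 ∷ [])
                      else known P i ∷ []

  degreeChildren : Pattern → ℕ → List Pattern
  degreeChildren P i = map (λ d → update P i (setDegree d)) (degrees P i)

  module _ (P : Pattern) (X : List ℕ) where

    -- The degree of `v` may still be open; then the worst possibility counts.
    cost : ℕ → ℕ
    cost v = if v ∈ᵇ X then 0 else
             if lost P X v ≡ᵇ 0 then 0 else foldr _⊔_ 0 (map (increase (lost P X v)) (degrees P v))

    -- No vertex v with safe k v is in a special component: some vertex at most k steps away has a degree that is not allowed.
    safe : ℕ → ℕ → Bool
    safe zero    v = not (any (λ d → (d ∸ lost P X v) ∈ᵇ allowed) (degrees P v))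
    safe (suc k) v = safe zero v ∨ any (λ t → not (t ∈ᵇ X) ∧ safe k t) (nbrs P v)

    -- These are the vertices through which a special component of W ∖ X can be attached to X. The
    -- depth 2 is the diameter of both special graphs.
    exposed : List ℕ
    exposed = filterᵇ (λ v → not (v ∈ᵇ X) ∧ not (lost P X v ≡ᵇ 0) ∧ not (safe 2 v)) (upTo (length P))

    affordable : ℕ → Bool
    affordable k = 105 * k + sum (map cost (upTo (length P))) + 15 * (length exposed / suc attach-1)
                   ≤ᵇ sum (map (gain P X) (upTo (length P)))

  leafOK : Pattern → List (ℕ × ℕ) → List ℕ → Bool
  leafOK P F X = (0 <ᵇ length F) ∧ all (isEdge P) F ∧ affordable P X (length F)

-- Occurrences of one pattern in another

bounded : Pattern → Bool
bounded R = all (λ v → all (_<ᵇ length R) (proj₂ v)) R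

nth : List ℕ → ℕ → ℕ
nth []       _       = 0
nth (x ∷ _)  zero    = x
nth (_ ∷ xs) (suc i) = nth xs i

firstJust : ∀ {A B : Set} → (A → Maybe B) → List A → Maybe B
firstJust f []       = nothing
firstJust f (x ∷ xs) with f x
... | just y  = just y
... | nothing = firstJust f xs

module _ (P : Pattern) where

  candidates : ℕ → List ℕ → List ℕ → List ℕ
  candidates k []       mp = upTo (length P)
  candidates k (b ∷ bs) mp = if b <ᵇ k then nbrs P (nth mp b) else candidates k bs mp

  admissible : ℕ → Vertex → List ℕ → ℕ → Bool
  admissible k (d , N) mp c =
    not (c ∈ᵇ mp) ∧ ((d ≡ᵇ 0) ∨ (known P c ≡ᵇ d)) ∧
    all (λ b → not (b <ᵇ k) ∨ (c ∈ᵇ nbrs P (nth mp b))) N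

  -- A backtracking search about which nothing is proved: `contains` verifies its result by
  -- `bounded`, `distinct` and `mapOK`.
  findMap : ℕ → Pattern → List ℕ → Maybe (List ℕ)
  findMap k []      mp = just mp
  findMap k (v ∷ R) mp =
    firstJust (λ c → if admissible k v mp c then findMap (suc k) R (mp ++ c ∷ []) else nothing)
              (candidates k (proj₂ v) mp)

  mapOK : List ℕ → Pattern → List ℕ → Bool
  mapOK mp []            []       = true
  mapOK mp ((d , N) ∷ R) (c ∷ cs) =
    ((d ≡ᵇ 0) ∨ (known P c ≡ᵇ d)) ∧ all (λ s → nth mp s ∈ᵇ nbrs P c) N ∧ (c <ᵇ length P) ∧ mapOK mp R cs
  mapOK mp _ _ = false

  contains : Pattern → Bool
  contains R with findMap 0 R []
  ... | nothing = false
  ... | just mp = bounded R ∧ distinct mp ∧ mapOK mp R mp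

-- Exploration trees as lists of tokens

takeEdges : ℕ → List ℕ → List (ℕ × ℕ) × List ℕ
takeEdges zero    ts           = [] , ts
takeEdges (suc k) (a ∷ b ∷ ts) with takeEdges k ts
... | F , ts′ = (a , b) ∷ F , ts′
takeEdges _       ts           = [] , ts

takeList : ℕ → List ℕ → List ℕ × List ℕ
takeList zero    ts       = [] , ts
takeList (suc k) []       = [] , []
takeList (suc k) (t ∷ ts) with takeList k ts
... | xs , ts′ = t ∷ xs , ts′

pick : List Pattern → ℕ → List Pattern
pick []       _       = []
pick (R ∷ _)  zero    = R ∷ []
pick (_ ∷ Rs) (suc i) = pick Rs i

guard : Bool → List ℕ → Maybe (List ℕ)
guard true  ts = just ts
guard false ts = nothing

-- A tree is a list of tokens in depth-first order. A token t < 25 branches on vertex t: on its degree if that is unknown,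
-- otherwise on its next neighbour. The token 25 + k announces a reduction: k edges, then the number and the list of those
-- dominated vertices that are not removed. The token 31 + i refers to an occurrence of the i-th pattern of the library.
module _ (M : Mode) (lib : List Pattern) where

  leafWith : Pattern → List (ℕ × ℕ) → List ℕ → Maybe (List ℕ)
  leafWith P F []       = nothing
  leafWith P F (r ∷ ts) = guard (leafOK M P F (removed P F (proj₁ (takeList r ts)))) (proj₂ (takeList r ts))

  leaf : Pattern → ℕ → List ℕ → Maybe (List ℕ)
  leaf P k ts = leafWith P (proj₁ (takeEdges k ts)) (proj₂ (takeEdges k ts))

  mutual
    check : ℕ → Pattern → List ℕ → Maybe (List ℕ)
    check zero    P ts       = nothing
    check (suc f) P []       = nothing
    check (suc f) P (t ∷ ts) =
      if t <ᵇ 25 then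
        (if t <ᵇ length P then
          (if known P t ≡ᵇ 0 then checkAll f (degreeChildren M P t) ts
           else if (length (nbrs P t) <ᵇ known P t) ∧ good P t then checkAll f (nbrChildren P t) ts
           else nothing)
         else nothing)
      else if t <ᵇ 31 then leaf P (t ∸ 25) ts
      else guard (any (contains P) (pick lib (t ∸ 31))) ts

    checkAll : ℕ → List Pattern → List ℕ → Maybe (List ℕ)
    checkAll f []       ts = just ts
    checkAll f (P ∷ Ps) ts with check f P ts
    ... | nothing  = nothing
    ... | just ts′ = checkAll f Ps ts′

-- Characters count from 48, skipping the backslash 92.
decode : String → List ℕ
decode s = map (λ c → if code c <ᵇ 92 then code c ∸ 48 else code c ∸ 49) (toList s)

-- The two kinds of components that cost 210 but weigh only 195 and 198: the 5-cycle, and the 5-cycle 0-1-3-5-2 with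
-- a twin 4 of the vertex 2.
C5 D6 : Pattern
C5 = (2 , 1 ∷ 4 ∷ []) ∷ (2 , 0 ∷ 2 ∷ []) ∷ (2 , 1 ∷ 3 ∷ []) ∷ (2 , 2 ∷ 4 ∷ []) ∷ (2 , 0 ∷ 3 ∷ []) ∷ []
D6 = (3 , 1 ∷ 2 ∷ 4 ∷ []) ∷ (2 , 0 ∷ 3 ∷ []) ∷ (3 , 0 ∷ 4 ∷ 5 ∷ []) ∷ (2 , 1 ∷ 5 ∷ []) ∷
     (3 , 0 ∷ 2 ∷ 5 ∷ []) ∷ (3 , 2 ∷ 3 ∷ 4 ∷ []) ∷ []

-- The possible shapes of a component Q of W ∖ X inside W: vertices of degree 2 may have had a neighbour in X (k of them do).
extend : Vertex → ℕ × Pattern → List (ℕ × Pattern)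
extend (d , N) (k , R) = (k , (d , N) ∷ R) ∷ (if d ≡ᵇ 2 then (suc k , (3 , N) ∷ R) ∷ [] else [])

variants : Pattern → List (ℕ × Pattern)
variants []      = (0 , []) ∷ []
variants (v ∷ Q) = concatMap (extend v) (variants Q)

record Stage : Set where
  constructor stage
  field
    root : Pattern
    how  : Mode
    cert : List String

resolved : List Pattern → Pattern → Bool
resolved lib P = any (contains P) lib

pairsOK : List Pattern → Mode → Bool
pairsOK lib M = all (λ (d , e) → resolved lib ((d , 1 ∷ []) ∷ (e , 0 ∷ []) ∷ [])) (Mode.excluded M)

module _ (lib : List Pattern) (M : Mode) where
  open Mode M

  tame : Pattern → ℕ × Pattern → Bool
  tame Q (k , R) = ((attach-1 <ᵇ k) ∧ all (λ v → proj₁ v ∈ᵇ allowed) Q) ∨ resolved lib R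

  specialOK : Pattern → Bool
  specialOK Q = all (tame Q) (variants Q)

module _ (lib : List Pattern) (S : Stage) where
  open Stage S

  certified : Bool
  -- The fuel 64 bounds the depth of the tree, not its size; the answer `just []` means that no
  -- token is left over.
  certified with check how lib 64 root (concatMap decode cert)
  ... | just [] = true
  ... | _       = false

  stageOK : Bool
  stageOK = pairsOK lib how ∧ specialOK lib how C5 ∧ specialOK lib how D6 ∧ certified

runStages : List Pattern → List Stage → Bool
runStages lib []       = true
runStages lib (S ∷ Ss) = stageOK lib S ∧ runStages (lib ++ Stage.root S ∷ []) Ss

-- The exploration trees

-- The vertices are numbered as in `pairOf`, so that `no-petersen` can compare the two adjacency
-- relations entry by entry.
petersen : Pattern
petersen =
  (3 , 7 ∷ 8 ∷ 9 ∷ []) ∷ (3 , 5 ∷ 6 ∷ 9 ∷ []) ∷ (3 , 4 ∷ 6 ∷ 8 ∷ []) ∷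
  (3 , 4 ∷ 5 ∷ 7 ∷ []) ∷ (3 , 2 ∷ 3 ∷ 9 ∷ []) ∷ (3 , 1 ∷ 3 ∷ 8 ∷ []) ∷
  (3 , 1 ∷ 2 ∷ 7 ∷ []) ∷ (3 , 0 ∷ 3 ∷ 6 ∷ []) ∷ (3 , 0 ∷ 2 ∷ 5 ∷ []) ∷
  (3 , 0 ∷ 1 ∷ 4 ∷ []) ∷ []

-- The roots are the diamond, the triangle, the 4-cycle, two 5-cycles with a common path of two
-- edges, three 5-cycles around a vertex, two 5-cycles with a common edge, the 5-cycle, and a single
-- vertex. In V all degrees are 3, so each of the five vertices of a 5-cycle component of V ∖ X has
-- a neighbour in X, whence `attach-1` is 4. In D6 only two vertices have one, but D6 contains a
-- diamond and so matters in the first stage only.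
cubicStages : List Stage
cubicStages =
  stage ((3 , 1 ∷ 2 ∷ 3 ∷ []) ∷ (0 , 0 ∷ 2 ∷ []) ∷ (3 , 0 ∷ 1 ∷ 3 ∷ []) ∷ (0 , 0 ∷ 2 ∷ []) ∷ [])
    (mode ((1 , 1) ∷ (1 , 2) ∷ (1 , 3) ∷ (2 , 2) ∷ (2 , 3) ∷ []) 1 (2 ∷ 3 ∷ []))
    ("113J0103434J010544J0104J010J010" ∷ []) ∷
  stage ((3 , 1 ∷ 2 ∷ []) ∷ (0 , 0 ∷ 2 ∷ []) ∷ (0 , 0 ∷ 1 ∷ []) ∷ [])
    (mode ((1 , 1) ∷ (1 , 2) ∷ (1 , 3) ∷ (2 , 2) ∷ (2 , 3) ∷ []) 4 (2 ∷ []))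
    ("011R22RR345334J030J0104J010J010J01034J030J0105J020J020J020634J010J010J0105J020J020J0207445J140J1"
      ∷ "20J1205J120J140J1205J120J120J120J12045J140J120J12065J3607K03360J360R855K03370J3705K033707J36089J"
      ∷ "250J360J0205J3707J36089J250J360J020J0208557K03360J3608K14460J460977J030J0307J030J0307J030J030J03"
      ∷ "07J0306K03360J140J0306J360J030589J360J1409J250J120J0308J1406K14460J030J1406J460J140579J360J0309J"
      ∷ "250J020J1409577J030J0307J030J0307J030J030J0306J0307J140J030J0307J030J250J030J12067J030J030J030J1"
      ∷ "408J140J250J140J020J02045J120J140J12065J3607K03360J360R855K03370J3705K033707J36089J250J360J0205J"
      ∷ "3707J36089J250J360J020J020856J0307K03370J140J0307J370J030589J360J1409J250J120J03056K03370J3708K1"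
      ∷ "4470J470966J030J0306J030J0306J030J030J03087K14470J030J140J1407J470J140569J360J0309J250J020J14095"
      ∷ "6J0307J140J030J0307J030J250J030J12066J030J0306J030J0306J030J030J03076J030J030J030J1408J140J250J1"
      ∷ "40J020J020845J120J120J120J120557K03360J3608K14460J460977J030J0307J030J0307J030J030J0307J0306K033"
      ∷ "60J140J0306J360J030589J360J1409J250J120J0308J1406K14460J030J1406J460J140579J360J0309J250J020J140"
      ∷ "9577J030J0307J030J0307J030J030J0306J0307J140J030J0307J030J250J030J12067J030J030J030J1408J140J250"
      ∷ "J140J020J02056J0307K03370J140J0307J370J030589J360J1409J250J120J03056K03370J3708K14470J470966J030"
      ∷ "J0306J030J0306J030J030J03087K14470J030J140J1407J470J140569J360J0309J250J020J140956J0307J140J030J"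
      ∷ "0307J030J250J030J12066J030J0306J030J0306J030J030J03076J030J030J030J1408J140J250J140J020J0209556R"
      ∷ "7J3608J140J360J01078J140J370J360J010J01067J030J030J030J2508J250J140J250J01067J030J030J0309J250J1"
      ∷ "40J250J250J010J01056R7J3608J140J360J01078J140J370J360J010J01076J030J030J030J2508J250J140J250J010"
      ∷ "76J030J030J0309J250J140J250J250J010J010567J030J030J030J2508J250J140J250J01076J030J030J030J2508J2"
      ∷ "50J140J250J010867J030J030J480J01076J030J030J480J010RJ010J010567J030J030J0309J250J140J250J250J010"
      ∷ "76J030J030J0309J250J140J250J250J010867J030J030J480J01076J030J030J480J010RJ010J010J010" ∷ []) ∷
  stage ((3 , 1 ∷ 2 ∷ []) ∷ (0 , 0 ∷ 3 ∷ []) ∷ (0 , 0 ∷ 3 ∷ []) ∷ (0 , 1 ∷ 2 ∷ []) ∷ [])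
    (mode ((1 , 1) ∷ (1 , 2) ∷ (1 , 3) ∷ (2 , 2) ∷ (2 , 3) ∷ []) 4 (2 ∷ []))
    ("03R112RS23452S34J010J010R5J010J010J01034J010J010J010SS67445SJ010J0105J010SJ0105J010J010SJ01045SJ"
      ∷ "010J0106J020SJ0206J020J020SJ02045J010SJ0106J020SJ020875J130J130J1306J230J230J230S955J130J010J010"
      ∷ "5J130J010J0105J010J010J0105J010J010J010J010845J010J010SJ0106J020J020SJ02075J130J130J1306J230J230"
      ∷ "J230S955J130J010J0105J130J010J0105J010J010J0105J010J010J010J010985J010J010J010J0106J020J020J020J"
      ∷ "02085J010SJ010J0106J020SJ020J020SJ010SJ010" ∷ []) ∷
  -- This exploration meets the Petersen graph, as the token `Q`, which stands for 31 + 2.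
  stage ((3 , 1 ∷ 4 ∷ 6 ∷ []) ∷ (0 , 0 ∷ 2 ∷ []) ∷ (3 , 1 ∷ 3 ∷ 5 ∷ []) ∷ (0 , 2 ∷ 4 ∷ []) ∷ (0 , 0 ∷ 3 ∷ []) ∷ (0 , 2 ∷ 6 ∷ []) ∷ (0 , 0 ∷ 5 ∷ []) ∷ [])
    (mode ((1 , 1) ∷ (1 , 2) ∷ (1 , 3) ∷ (2 , 2) ∷ (2 , 3) ∷ []) 4 (2 ∷ []))
    ("113S4S5S6S335S6TT445T6STS567895TT6T87QK01230T9K04230K04230K04230S:97K01250K01250K01250TT;778S:TK"
      ∷ "01560K04230;SK01490K01490K0125078S:TK01560K04230;K01490SK01490K012507;SK01490K01490;K01490SK0149"
      ∷ "0K012507K01250K01250K01250K01250:6T87K01230K01230K01230TT;779S:TK017:0K01340;SK01680K01680K01230"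
      ∷ "79S:TK017:0K01340;K01680SK01380K012307;SK01680K01680;K01680SK01380K012307K01230K01230K01230K0123"
      ∷ "0TS;88T:S7TK018:0K01230TK23560;S7TK06380K01230TK062307K01230K01230K01230SK01230T8:S7TK018:0K0123"
      ∷ "0TK23560T:7K018:0TK012509K045:0TK04250SK23560:K23560K23560TSK235608;S7TK06380K01230TK06230T:7K01"
      ∷ "8:0TK012509K045:0TK04250SK23560;K06230K06230TSK06230<87K01230K01230K01230SK01230T:K23560K23560TS"
      ∷ "K23560;K06230K06230TSK06230=;;7SK236;0K06120K06120K06120T7K06120K06120SK06120K061207K06120K06120"
      ∷ "K06120SK061207K06120K06120K06120K06120SK06120;7SK236;0K06120K06120K06120T9K04560K04560SK04560K04"
      ∷ "5609K04560K04560K04560SK045609K04560K04560K04560K04560SK04560T;7K06120K06120SK06120K061209K04560"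
      ∷ "K04560SK04560K04560TT<K06380K06380K06380SSK06380;7K06120K06120K06120SK061209K04560K04560K04560SK"
      ∷ "04560TT=K06380K06380K06380SSK06380>;7K06120K06120K06120K06120SK061209K04560K04560K04560K04560SK0"
      ∷ "4560T<K06380K06380K06380SSK06380=K06380K06380K06380SSK06380?<<K06380K06380SK06380K06380@@S@S7TTT"
      ∷ "K018<0K018<0K018<0T7TK018<0TTK018<0K018<07TK018<0TK018<0TK018<0K06380@S7TTTK018<0K018<0K018<0T7K"
      ∷ "018<0TTT:K018<0K018<0SJ170K06380K018<07K018<0TT:K018<0K018<0J170SK06380TK018<0K06380T@S7TK018<0T"
      ∷ "TK018<0K018<07K018<0TTT:K018<0K018<0SJ170K06380K018<0TTK06380@S7TK018<0TK018<0TK018<07K018<0TT:K"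
      ∷ "018<0K018<0J170SK06380TK018<0TTK063807K06380K06380TK06380K06380STB@K018<0K018<0TK018<0K018<0T9K0"
      ∷ "18<09K018<0K018<0K018<0K018=0K06340K018=0K018<0K018<0K018<0K06380K06380K06380K018<09K06340K06340"
      ∷ "TK06340K06340<K06380K06380SK06380K06380S@AA7K018<0K06340K018<0K018<0K06340K018<0:K04560K04560K04"
      ∷ "560K04560K04560K04560T>K06340K06340K06340SK06340K06380?K06340K06340K06340SK06340K06380TAK06380K0"
      ∷ "6380TK06380K06380T7K018<07K018<0K018<0K018<0K018<0K018<0K018<0K018<0K018<0K018<0K06380K06380K063"
      ∷ "80K06380:K23560K23560TK23560K23560<K06380K06380SK06380K06380S@AA7K23560K23560K23560K23560K06380K"
      ∷ "063809K04560K04560K04560K04560K04560K04560T>K23560K23560K23560SK06380K06380?K23560K23560K23560SK"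
      ∷ "06380K06380T7K56380K56380K56380K56380K06380K06380K06380K06380S<K06380K06380K06380ST>K236;0K236;0"
      ∷ "K236;0TSS@A@7K236;0K236;0K236;0K236;0K06380K063809K06340K06340K06340K06340K06340K06340:K23560K23"
      ∷ "560K23560K23560K06380K06380T?J6;0J6;0K236;0J6;0TJ6;0T7K386;0K386;0K386;0K386;0K06380K06380K06380"
      ∷ "K06380<K06380K06380K06380ST?K236;0K236;0K236;0TSS@A@7K236;0K236;0K236;0K236;0K06380K063809K06340"
      ∷ "K06340K06340K06340K06340K06340:K23560K23560K23560K23560K06380K06380T>J6;0J6;0K236;0J6;0TJ6;0T7K3"
      ∷ "86;0K386;0K386;0K386;0K06380K06380K06380K06380@<@S@S7TTTK018<0K018<0K018<0T7TK018<0TTK018<0K018<"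
      ∷ "07TK018<0TK018<0TK018<0K06380@S7TTTK018<0K018<0K018<0T7K018<0TTT:K018<0K018<0SJ170K06380K018<07K"
      ∷ "018<0TT:K018<0K018<0J170SK06380TK018<0K06380T@S7TK018<0TTK018<0K018<07K018<0TTT:K018<0K018<0SJ17"
      ∷ "0K06380K018<0TTK06380@S7TK018<0TK018<0TK018<07K018<0TT:K018<0K018<0J170SK06380TK018<0TTK063807K0"
      ∷ "6380K06380TK06380K06380STB@K018<0K018<0TK018<0K018<0T9K018<09K018<0K018<0K018<0K018=0K06340K018="
      ∷ "0K018<0K018<0K018<0K06380K06380K06380K018<09K06340K06340TK06340K06340SA@7K018<0K06340K018<0K018<"
      ∷ "0K06340K018<0:K04560K04560K04560K04560K04560K04560T>K06340K06340K06340SK06340K06380?K06340K06340"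
      ∷ "K06340SK06340K06380T@K06380K06380TK06380K06380T7K018<07K018<0K018<0K018<0K018<0K018<0K018<0K018<"
      ∷ "0K018<0K018<0K06380K06380K06380K06380:K23560K23560TK23560K23560SA@7K23560K23560K23560K23560K0638"
      ∷ "0K063809K04560K04560K04560K04560K04560K04560T>K23560K23560K23560SK06380K06380?K23560K23560K23560"
      ∷ "SK06380K06380T7K56380K56380K56380K56380K06380K06380K06380K06380S>K236;0K236;0K236;0TSSA@7K236;0K"
      ∷ "236;0K236;0K236;0K06380K063809K06340K06340K06340K06340K06340K06340:K23560K23560K23560K23560K0638"
      ∷ "0K06380T?J6;0J6;0K236;0J6;0TJ6;0T7K386;0K386;0K386;0K386;0K06380K06380K06380K06380?K236;0K236;0K"
      ∷ "236;0TSSA@7K236;0K236;0K236;0K236;0K06380K063809K06340K06340K06340K06340K06340K06340:K23560K2356"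
      ∷ "0K23560K23560K06380K06380T>J6;0J6;0K236;0J6;0TJ6;0T7K386;0K386;0K386;0K386;0K06380K06380K06380K0"
      ∷ "6380K06380" ∷ []) ∷
  stage ((3 , 1 ∷ 2 ∷ 3 ∷ []) ∷ (3 , 0 ∷ 4 ∷ 9 ∷ []) ∷ (3 , 0 ∷ 5 ∷ 6 ∷ []) ∷ (3 , 0 ∷ 7 ∷ 8 ∷ []) ∷ (0 , 1 ∷ 5 ∷ []) ∷ (0 , 2 ∷ 4 ∷ []) ∷ (0 , 2 ∷ 7 ∷ []) ∷ (0 , 3 ∷ 6 ∷ []) ∷ (0 , 3 ∷ 9 ∷ []) ∷ (0 , 1 ∷ 8 ∷ []) ∷ [])
    (mode ((1 , 1) ∷ (1 , 2) ∷ (1 , 3) ∷ (2 , 2) ∷ (2 , 3) ∷ []) 4 (2 ∷ []))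
    ("446T7U8T9S556S7T8U9TS668T9UUT789:;<7ST:TTTTK024:0US=8U;STK03250K03250K03250UT>9TU<K01260K01260TT"
      ∷ "K01260US?:T:TK03140K03140K03140K14670:TK03140K14670K37450K03140:TK03140K14670UK03140:TK03140K374"
      ∷ "50UK03140:TK14670K03140K03140K03140@A<;UK03140K03140K03140K03140K03250T<K01260TK01260K01260K0126"
      ∷ "0K01260<K03140TK01260K01260K01260K01260<K01260TK01260K01260TK01260<K01260TK01260K01260TK01260<K0"
      ∷ "1260TK01260K01260K01260K01260K14670" ∷ []) ∷
  stage ((3 , 1 ∷ 2 ∷ 5 ∷ []) ∷ (3 , 0 ∷ 3 ∷ 6 ∷ []) ∷ (0 , 0 ∷ 4 ∷ []) ∷ (0 , 1 ∷ 4 ∷ []) ∷ (0 , 2 ∷ 3 ∷ []) ∷ (0 , 0 ∷ 7 ∷ []) ∷ (0 , 1 ∷ 7 ∷ []) ∷ (0 , 5 ∷ 6 ∷ []) ∷ [])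
    (mode ((1 , 1) ∷ (1 , 2) ∷ (1 , 3) ∷ (2 , 2) ∷ (2 , 3) ∷ []) 4 (2 ∷ []))
    ("223S5S6T7T335T6S7TT445T6T7USS556STUU66UTUT789:;<7UU:TTTTK014:0SS=8UTV8UTV<VK02160USK02160<VK0216"
      ∷ "0UTSK021608UTU<VK02160USK02160=K24670K01:=0TTSK24670>8UTV<VK02160UTSK02160=K24670K01:=0TTSK24670"
      ∷ "?<V:TK24670K24670K24670K24670<UUTK02160K02160SK24670UT<VK02160UTT>K16280K01:>0K026<0K01=>0SS@AA9"
      ∷ "TK02160K02160K02160K02160K138>0:TK02160K02160UK02160K026<0;K02160K02160TK02160K02160K026<0=K0216"
      ∷ "0K02160TK02160UK026<0TT9TK026<0K026<0K026<0K026<0K16280K16280K16280<VK02160UTT?K16280K01:?0K026<"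
      ∷ "0K01=?0SS@AA9TK02160K02160K02160K02160K138?0:TK02160K02160UK02160K026<0;K02160K02160TK02160K0216"
      ∷ "0K026<0=K02160K02160TK02160UK026<0TT9TK026<0K026<0K026<0K026<0K16280K16280K16280@<V:TK026<0K01:="
      ∷ "0K01:>0K01:?0SK24670UT>K16280K01:>0K026<0K01=>0SSAA9TK02160K02160K02160K02160K138>0:TK02160K0216"
      ∷ "0UK02160K026<0;K02160K02160TK02160K02160K026<0=K02160K02160TK02160UK026<0TT9TK026<0K026<0K026<0K"
      ∷ "026<0K16280K16280K16280?K16280K01:?0K026<0K01=?0SSAA9TK02160K02160K02160K02160K138?0:TK02160K021"
      ∷ "60UK02160K026<0;K02160K02160TK02160K02160K026<0=K02160K02160TK02160UK026<0TT9TK026<0K026<0K026<0"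
      ∷ "K026<0K16280K16280K16280K02160" ∷ []) ∷
  stage ((3 , 1 ∷ 2 ∷ []) ∷ (0 , 0 ∷ 3 ∷ []) ∷ (0 , 0 ∷ 4 ∷ []) ∷ (0 , 1 ∷ 4 ∷ []) ∷ (0 , 2 ∷ 3 ∷ []) ∷ [])
    (mode ((1 , 1) ∷ (1 , 2) ∷ (1 , 3) ∷ (2 , 2) ∷ (2 , 3) ∷ []) 4 (2 ∷ []))
    ("03S4S551S2S3T4T51S2S3T4T112S4STT223STTT663U4USWW63U4USWW773U4UWWTT73U4UWWTT3489:;<=3ST4TSSW:TUST"
      ∷ "<UTUSK05340<UTK05340SWJ050:TUS<WK053:0TSK053:0T=UTK05340SWJ050>:TUS<WK053:0TSWJ050=WK053:0TSWJ05"
      ∷ "0T>UTJ050J050J050W>UTJ050J050J050WK053404TSWS;TUST<UTUSK05340<UTK05340SWJ050;TUS<WK053;0TSK053;0"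
      ∷ "T=UTK05340SWJ050>;TUS<WK053;0TSWJ050=WK053;0TSWJ050T>UTJ050J050J050W>UTJ050J050J050WK053404TS:UT"
      ∷ "ST<TUUSK05340<TUK05340SWJ050;UTST<TUUSK05340<TUK05340SWJ050SW><TU:WK053<0STWJ050;WK053<0STWJ050S"
      ∷ "T>UTJ050J050J050W>UTJ050J050J050WK053404TS:UTS<K054:0WTSK054:0T=TUK05340SWJ050;UTS<K054;0WTSK054"
      ∷ ";0T=TUK05340SWJ050WS>=TU:WK053=0STWJ050;WK053=0STWJ050ST>UTJ050J050J050W>UTJ050J050J050WK05340>4"
      ∷ "TS:UTS<K054:0WTSWJ050=K054:0WTSWJ050T>TUJ050J050J050W>TUJ050J050J050WK05340;UTS<K054;0WTSWJ050=K"
      ∷ "054;0WTSWJ050T>TUJ050J050J050W>TUJ050J050J050WK05340<UT:K054<0WSTWJ050;K054<0WSTWJ050ST>TUJ050J0"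
      ∷ "50J050W>TUJ050J050J050WK05340=UT:K054=0WSTWJ050;K054=0WSTWJ050ST>TUJ050J050J050W>TUJ050J050J050W"
      ∷ "K05340S?8U8UT:<TUSWJ050J050SSUWJ050J050:=TUSWJ050J050SUSWJ050J050TUJ0508UT;<TUSWJ050J050SSUWJ050"
      ∷ "J050;=TUSWJ050J050SUSWJ050J050TUJ0508U:<TUSWJ050J050SSUWJ050J050;<TUSWJ050J050SSUWJ050J050TTUJ05"
      ∷ "08U:=TUSWJ050J050SUSWJ050J050;=TUSWJ050J050SUSWJ050J050TTUJ050TU8UJ050J050J050J050TU>UJ050J050J0"
      ∷ "50J050TWW>UJ050J050J050J050TWW@A:9T:SSUWJ050J050J050J050J050:SUSWJ050J050J050J050J050TJ050J050J0"
      ∷ "50J050J050S:9TSUTJ050J050J050J050J050STJ050J050J050J050J050J050:9TUSTJ050J050J050J050J050STJ050J"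
      ∷ "050J050J050J050J050J050J050J050J050J050J050" ∷ []) ∷
  stage ((3 , []) ∷ [])
    -- By now both special graphs contain a settled pattern, so no special component arises and
    -- `attach-1` is arbitrary; 98 makes the surcharge vanish.
    (mode ((1 , 1) ∷ (1 , 2) ∷ (1 , 3) ∷ (2 , 2) ∷ (2 , 3) ∷ []) 98 (2 ∷ []))
    ("00011SS1SS22STT2STT33TTTT3TTTT44SXXXX4SXXXX55XXXXTT5XXXXTTJ010" ∷ []) ∷ []

-- The first five roots are 5-cycles and copies of D6 in which at most two vertices can have further
-- neighbours. After them every special component of W ∖ X is a 5-cycle with at least three vertices
-- next to X, so `attach-1` is 2. The next roots dispose of vertices of degree 1, ending with such a
-- vertex next to one of degree 3. From then on only the degrees 2 and 3 remain, and the roots are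
-- vertices of degree 2 on short cycles or close to each other, until a single vertex of degree 2 is
-- enough.
deficientStages : List Stage
deficientStages =
  stage ((0 , 1 ∷ 4 ∷ []) ∷ (2 , 0 ∷ 2 ∷ []) ∷ (2 , 1 ∷ 3 ∷ []) ∷ (2 , 2 ∷ 4 ∷ []) ∷ (2 , 0 ∷ 3 ∷ []) ∷ [])
    (mode ([]) 0 (2 ∷ 3 ∷ []))
    ("0OJ230" ∷ []) ∷
  stage ((3 , 1 ∷ 2 ∷ 4 ∷ []) ∷ (0 , 0 ∷ 3 ∷ []) ∷ (3 , 0 ∷ 4 ∷ 5 ∷ []) ∷ (2 , 1 ∷ 5 ∷ []) ∷ (3 , 0 ∷ 2 ∷ 5 ∷ []) ∷ (3 , 2 ∷ 3 ∷ 4 ∷ []) ∷ [])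
    (mode ([]) 0 (2 ∷ 3 ∷ []))
    ("1PJ250" ∷ []) ∷
  stage ((0 , 1 ∷ 4 ∷ []) ∷ (0 , 0 ∷ 2 ∷ []) ∷ (2 , 1 ∷ 3 ∷ []) ∷ (2 , 2 ∷ 4 ∷ []) ∷ (2 , 0 ∷ 3 ∷ []) ∷ [])
    (mode ([]) 1 (2 ∷ 3 ∷ []))
    ("0Q1Q05J0401J0106J0105J0107J0506K041608J160J010J010J0411J230J340" ∷ []) ∷
  stage ((0 , 1 ∷ 4 ∷ []) ∷ (2 , 0 ∷ 2 ∷ []) ∷ (0 , 1 ∷ 3 ∷ []) ∷ (2 , 2 ∷ 4 ∷ []) ∷ (2 , 0 ∷ 3 ∷ []) ∷ [])
    (mode ([]) 1 (2 ∷ 3 ∷ []))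
    ("0Q2Q0J0205J0405J010J040J040" ∷ []) ∷
  stage ((3 , 1 ∷ 2 ∷ 4 ∷ []) ∷ (0 , 0 ∷ 3 ∷ []) ∷ (3 , 0 ∷ 4 ∷ 5 ∷ []) ∷ (0 , 1 ∷ 5 ∷ []) ∷ (3 , 0 ∷ 2 ∷ 5 ∷ []) ∷ (3 , 2 ∷ 3 ∷ 4 ∷ []) ∷ [])
    (mode ([]) 1 (2 ∷ 3 ∷ []))
    ("1R3R16J010J020J020" ∷ []) ∷
  stage ((1 , 1 ∷ []) ∷ (1 , 0 ∷ []) ∷ [])
    (mode ([]) 2 (2 ∷ []))
    ("J010" ∷ []) ∷
  stage ((1 , 1 ∷ []) ∷ (2 , 0 ∷ []) ∷ [])
    (mode ([]) 2 (2 ∷ []))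
    ("12J01023J120J010J010223J1204J1203J1204J120J1203J120J1204J1204J120J120J010" ∷ []) ∷
  stage ((1 , 1 ∷ []) ∷ (3 , 0 ∷ 2 ∷ 3 ∷ []) ∷ (1 , 1 ∷ []) ∷ (0 , 1 ∷ []) ∷ [])
    (mode ((1 , 1) ∷ (1 , 2) ∷ []) 2 (2 ∷ []))
    ("3J010J010J010" ∷ []) ∷
  stage ((1 , 1 ∷ []) ∷ (3 , 0 ∷ 2 ∷ 3 ∷ []) ∷ (0 , 1 ∷ 3 ∷ []) ∷ (0 , 1 ∷ 2 ∷ []) ∷ [])
    (mode ((1 , 1) ∷ (1 , 2) ∷ []) 2 (2 ∷ []))
    ("23J0103J01023J0104J1204J120J1203J0105J130J010J010" ∷ []) ∷
  stage ((1 , 1 ∷ []) ∷ (3 , 0 ∷ 2 ∷ 3 ∷ []) ∷ (0 , 1 ∷ 4 ∷ []) ∷ (0 , 1 ∷ 4 ∷ []) ∷ (0 , 2 ∷ 3 ∷ []) ∷ [])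
    (mode ((1 , 1) ∷ (1 , 2) ∷ []) 2 (2 ∷ []))
    ("234J120J0104J120J01023Y34J120J011245J120J120J1205J1205J120J120J12034J1205J120J1206J1306J130J130J"
      ∷ "1304J120J1207J120J120J120" ∷ []) ∷
  stage ((1 , 1 ∷ []) ∷ (3 , 0 ∷ 2 ∷ 3 ∷ []) ∷ (2 , 1 ∷ []) ∷ (0 , 1 ∷ []) ∷ [])
    (mode ((1 , 1) ∷ (1 , 2) ∷ []) 2 (2 ∷ []))
    ("2Y3X3ZJ0103Z3Z44J1213J1213J1213J0113" ∷ []) ∷
  stage ((1 , 1 ∷ []) ∷ (3 , 0 ∷ 2 ∷ 3 ∷ []) ∷ (0 , 1 ∷ 4 ∷ []) ∷ (0 , 1 ∷ []) ∷ (1 , 2 ∷ []) ∷ [])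
    (mode ((1 , 1) ∷ (1 , 2) ∷ []) 2 (2 ∷ []))
    ("3X[J120" ∷ []) ∷
  stage ((1 , 1 ∷ []) ∷ (3 , 0 ∷ 2 ∷ 3 ∷ []) ∷ (0 , 1 ∷ 4 ∷ []) ∷ (0 , 1 ∷ []) ∷ (0 , 2 ∷ 5 ∷ []) ∷ (1 , 4 ∷ []) ∷ [])
    (mode ((1 , 1) ∷ (1 , 2) ∷ []) 2 (2 ∷ []))
    ("3X[2[2Y34ZZ34ZZ46]6YJ1213J1213J12137]8[7[J130J130J1307[J130J130J1308]8[J130J130J1304YJ1214J12149"
      ∷ "X[9ZJ1214J12149ZJ1214J1214:]:J1214J1214J1214;J490J490;[J490J490;];J1214J1214J1214J490J4906J2411J"
      ∷ "2411J1214J12146J24216J24216J12246J12246<J12246=[J1214J1214J12246" ∷ []) ∷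
  stage ((1 , 1 ∷ []) ∷ (3 , 0 ∷ 2 ∷ 3 ∷ []) ∷ (3 , 1 ∷ 4 ∷ 5 ∷ []) ∷ (0 , 1 ∷ []) ∷ (0 , 2 ∷ 5 ∷ []) ∷ (0 , 2 ∷ 4 ∷ []) ∷ [])
    (mode ((1 , 1) ∷ (1 , 2) ∷ []) 2 (2 ∷ []))
    ("3X[34Z5Z34Z5Z45J120J12135J12136]7[6J130J130J130J1306J130J130J130J1307]7J130J130J130J1304J120J120"
      ∷ "8YJ120J120" ∷ []) ∷
  stage ((1 , 1 ∷ []) ∷ (3 , 0 ∷ 2 ∷ 3 ∷ []) ∷ (0 , 1 ∷ 4 ∷ []) ∷ (0 , 1 ∷ 5 ∷ []) ∷ (0 , 2 ∷ 5 ∷ []) ∷ (0 , 3 ∷ 4 ∷ []) ∷ [])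
    (mode ((1 , 1) ∷ (1 , 2) ∷ []) 2 (2 ∷ []))
    ("2[3[2Y5Z34ZZ46[J1213J12136]6_5J1213J1213J121357[J130J1307]7J130_J130J1304_J1208^J120J120" ∷ []) ∷
  stage ((1 , 1 ∷ []) ∷ (3 , 0 ∷ 2 ∷ 3 ∷ []) ∷ (0 , 1 ∷ 4 ∷ []) ∷ (0 , 1 ∷ []) ∷ (2 , 2 ∷ []) ∷ [])
    (mode ((1 , 1) ∷ (1 , 2) ∷ []) 2 (2 ∷ []))
    ("3X[2[4Z2Y_6[J120J120" ∷ []) ∷
  stage ((1 , 1 ∷ []) ∷ (3 , 0 ∷ []) ∷ [])
    (mode ((1 , 1) ∷ (1 , 2) ∷ []) 2 (2 ∷ []))
    ("112X[3X[2Y2Y3ZZ4]a5]a6]a3ZZ7]a4_``4_``8^9[5``J120J1205``J1215J12158J1215J1215J24215J1215J1215:^;"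
      ∷ "[J120J120J1215J1209^J120J120" ∷ []) ∷
  stage ((2 , 1 ∷ 2 ∷ []) ∷ (2 , 0 ∷ 2 ∷ []) ∷ (0 , 0 ∷ 1 ∷ []) ∷ [])
    (mode ((1 , 1) ∷ (1 , 2) ∷ (1 , 3) ∷ []) 2 (2 ∷ []))
    ("2J010233J0203344J230J230J020" ∷ []) ∷
  stage ((2 , 1 ∷ 2 ∷ []) ∷ (2 , 0 ∷ 3 ∷ []) ∷ (0 , 0 ∷ 3 ∷ []) ∷ (0 , 1 ∷ 2 ∷ []) ∷ [])
    (mode ((1 , 1) ∷ (1 , 2) ∷ (1 , 3) ∷ []) 2 (2 ∷ []))
    ("23J0103J01023J01034TJ01044J020J020J010" ∷ []) ∷
  stage ((2 , 1 ∷ 2 ∷ []) ∷ (2 , 0 ∷ []) ∷ (2 , 0 ∷ []) ∷ [])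
    (mode ((1 , 1) ∷ (1 , 2) ∷ (1 , 3) ∷ []) 2 (2 ∷ []))
    ("1c2d33QJ0103S3S44J020J020J0205656J130J130c6J1307dJ130J130J0106J010J010" ∷ []) ∷
  stage ((2 , 1 ∷ 2 ∷ []) ∷ (2 , 0 ∷ 3 ∷ []) ∷ (3 , 0 ∷ 4 ∷ 5 ∷ []) ∷ (3 , 1 ∷ 4 ∷ 5 ∷ []) ∷ (3 , 2 ∷ 3 ∷ 6 ∷ []) ∷ (3 , 2 ∷ 3 ∷ 6 ∷ []) ∷ (0 , 4 ∷ 5 ∷ []) ∷ [])
    (mode ((1 , 1) ∷ (1 , 2) ∷ (1 , 3) ∷ []) 2 (2 ∷ []))
    ("6J2406J240" ∷ []) ∷
  stage ((2 , 1 ∷ 2 ∷ []) ∷ (2 , 0 ∷ 3 ∷ []) ∷ (3 , 0 ∷ 4 ∷ 5 ∷ []) ∷ (3 , 1 ∷ 4 ∷ 5 ∷ []) ∷ (3 , 2 ∷ 3 ∷ 6 ∷ []) ∷ (3 , 2 ∷ 3 ∷ 7 ∷ []) ∷ (0 , 4 ∷ 7 ∷ []) ∷ (0 , 5 ∷ 6 ∷ []) ∷ [])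
    (mode ((1 , 1) ∷ (1 , 2) ∷ (1 , 3) ∷ []) 2 (2 ∷ []))
    ("67K24350J24067J25078J4612K24350K24350" ∷ []) ∷
  stage ((2 , 1 ∷ 2 ∷ []) ∷ (2 , 0 ∷ 3 ∷ []) ∷ (3 , 0 ∷ 4 ∷ 5 ∷ []) ∷ (3 , 1 ∷ 4 ∷ 5 ∷ []) ∷ (3 , 2 ∷ 3 ∷ 6 ∷ []) ∷ (3 , 2 ∷ 3 ∷ 7 ∷ []) ∷ (0 , 4 ∷ 8 ∷ []) ∷ (0 , 5 ∷ 8 ∷ []) ∷ (0 , 6 ∷ 7 ∷ []) ∷ [])
    (mode ((1 , 1) ∷ (1 , 2) ∷ (1 , 3) ∷ []) 2 (2 ∷ []))
    ("67K24350J24067g7J2508K0246079K024608J680:9J680:;L2435:;0J680J680K0246099J460K02460K02460::J570K0"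
      ∷ "2570K02570K24350" ∷ []) ∷
  stage ((2 , 1 ∷ 2 ∷ []) ∷ (2 , 0 ∷ 3 ∷ []) ∷ (3 , 0 ∷ 4 ∷ 5 ∷ []) ∷ (3 , 1 ∷ 4 ∷ 5 ∷ []) ∷ (3 , 2 ∷ 3 ∷ 6 ∷ []) ∷ (3 , 2 ∷ 3 ∷ 7 ∷ []) ∷ (2 , 4 ∷ []) ∷ (0 , 5 ∷ []) ∷ [])
    (mode ((1 , 1) ∷ (1 , 2) ∷ (1 , 3) ∷ []) 2 (2 ∷ []))
    ("6g77hK24350J240" ∷ []) ∷
  stage ((2 , 1 ∷ 2 ∷ []) ∷ (2 , 0 ∷ 3 ∷ []) ∷ (3 , 0 ∷ 4 ∷ 5 ∷ []) ∷ (3 , 1 ∷ 4 ∷ 5 ∷ []) ∷ (3 , 2 ∷ 3 ∷ 6 ∷ []) ∷ (0 , 2 ∷ 3 ∷ []) ∷ (0 , 4 ∷ []) ∷ [])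
    (mode ((1 , 1) ∷ (1 , 2) ∷ (1 , 3) ∷ []) 2 (2 ∷ []))
    ("5T5f6i6g6g7i7hh7hh898cK02460K02460K024608K02460K02460K02460K0246099K02460K02460K02460K02460::K02"
      ∷ "570K02570;cK24350K02570;;K24350K24350K24350K0257088K02460K024609K46020K46020K46020K460208K02460:"
      ∷ "9J680K46020J7:0K02570K024608K02460:9J680K46020J7:0K02570K0246089K46020K46020K46020K46020K02460K0"
      ∷ "2460<=<9J680J680J680J680=J680J680J680J680=J680J680J680J680c=J680J680J680>dJ680K68010K02460=K0246"
      ∷ "09K02460K02460K24350K243509K46020K46020K24350K24350K46020" ∷ []) ∷
  stage ((2 , 1 ∷ 2 ∷ []) ∷ (0 , 0 ∷ 2 ∷ []) ∷ (0 , 0 ∷ 1 ∷ []) ∷ [])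
    (mode ((1 , 1) ∷ (1 , 2) ∷ (1 , 3) ∷ []) 2 (2 ∷ []))
    ("1c2c123J0103J010334TJ01044J120J120J01044J020J0203345J130J120J120345J130J120J12055J1306cJ130J1306"
      ∷ "6J130J130J13044J120J1204J120J1204J120J12077J120J120J120J24088J120J120J120J240J120" ∷ []) ∷
  stage ((2 , 1 ∷ 2 ∷ []) ∷ (0 , 0 ∷ 3 ∷ []) ∷ (0 , 0 ∷ 3 ∷ []) ∷ (0 , 1 ∷ 2 ∷ []) ∷ [])
    (mode ((1 , 1) ∷ (1 , 2) ∷ (1 , 3) ∷ []) 2 (2 ∷ []))
    ("1d2d1k324J010J01044J010J010J01044J010k55Td326J130J010J14023J130J0103J0106kJ010J01023J01045J130J0"
      ∷ "10J010534J230J010k5J0206dJ020J02034J010J0105J020J02066J130J130J13044J010J0104J010J0104J010J01078"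
      ∷ "J0107J010J010k5J140J140J0105J020J140J010:J020J01088J010J010k5J140J140J0105J020J140J010:J020J010J"
      ∷ "010" ∷ []) ∷
  stage ((2 , 1 ∷ []) ∷ (3 , 0 ∷ 2 ∷ 3 ∷ []) ∷ (2 , 1 ∷ []) ∷ (2 , 1 ∷ []) ∷ [])
    (mode ((1 , 1) ∷ (1 , 2) ∷ (1 , 3) ∷ []) 2 (2 ∷ []))
    ("0cc2cl3ll44TTJ01055TTJ1206J010J010" ∷ []) ∷
  stage ((2 , 1 ∷ 4 ∷ []) ∷ (3 , 0 ∷ 2 ∷ 3 ∷ []) ∷ (2 , 1 ∷ 5 ∷ []) ∷ (0 , 1 ∷ []) ∷ (0 , 0 ∷ 5 ∷ []) ∷ (0 , 2 ∷ 4 ∷ []) ∷ [])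
    (mode ((1 , 1) ∷ (1 , 2) ∷ (1 , 3) ∷ []) 2 (2 ∷ []))
    ("3m4T5T4l65lk6J450lJ4503l3l77J130kJ130J0103l77J130kJ130J01077J130J130kJ1308J0105J010J010J0106J120"
      ∷ "J120J0106J120J120J0109J1209J010J010J010J0109J4516J4516J010J010:;<<J010J010K456:0K456;0k==J590J59"
      ∷ "0J590J590lJ590J450J450J4519J010" ∷ []) ∷
  stage ((2 , 1 ∷ 4 ∷ []) ∷ (3 , 0 ∷ 2 ∷ 3 ∷ []) ∷ (2 , 1 ∷ 5 ∷ []) ∷ (0 , 1 ∷ []) ∷ (0 , 0 ∷ 6 ∷ []) ∷ (0 , 2 ∷ 6 ∷ []) ∷ (0 , 4 ∷ 5 ∷ []) ∷ [])
    (mode ((1 , 1) ∷ (1 , 2) ∷ (1 , 3) ∷ []) 2 (2 ∷ []))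
    ("3m46e5J010J0104l5n56eJ12067m5ll8m33J010J1203J010J0103J120J01099J130J130kJ130:J0107J010J120J1207J"
      ∷ "010J040J0408J010J010J010J0108J010J010J010J010;;J120J120kJ470J470J470J01077nlk688J130J470J470J040"
      ∷ "l88J470J470J4716J4709J0405lJ040J040:J4603J460J460J0403J010J010J010;J120J0105l63J1316J010J04087J4"
      ∷ "60l8J460J460J4607J460J460J46088nk6J250lJ2506J560J250l::J560lJ560J5603J250J560J5603J010J560J120;J"
      ∷ "010J12033J010J010J0103J0107J010J130J130J0103J0107J010J130J130J1203J010J010J1209J010:J010J010" ∷ []) ∷
  stage ((2 , 1 ∷ 2 ∷ []) ∷ (2 , 0 ∷ 3 ∷ []) ∷ (0 , 0 ∷ 4 ∷ []) ∷ (0 , 1 ∷ 4 ∷ []) ∷ (0 , 2 ∷ 3 ∷ []) ∷ [])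
    (mode ((1 , 1) ∷ (1 , 2) ∷ (1 , 3) ∷ []) 2 (2 ∷ []))
    ("2S3S2d4T55Tk4lJ02034Pj66koJ13045J020J0206J130J13077ll88K34250K243609e55J2413K024705J2413K024705K"
      ∷ "02470K02470:;K02470J470J47055J2413J24135J241398K24360kK02470J24135J241398K24360kK02470J241399K24"
      ∷ "360K25340k::J250J250lJ250J2413:J2413J02055J020J0205J02086J2413J2506J2413J25099J470K02690k::J360J"
      ∷ "360lJ360J130J130J0205J02086J2413J2506J2413J25099J470K02690k::J360J360lJ360J130J130J0208966J250J2"
      ∷ "50:7J470J470k:J360J360lJ360J130J250J2506:7J470J470k:J360J360lJ360J130J250J250:;87lJ470J470K34250"
      ∷ "cK026:0K026;09J250J250J250lJ250J130;J1308J130cJ130J1309J250J250J250lJ250J0209J0206J020J020J0206J"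
      ∷ "020J020J020::J020J020J020k;;J360J360J360lJ360J1307J130J130J020J0207J130J130J020J020;J130<<J130J1"
      ∷ "30J020J020k==J470J470J470J470lJ470J020J020" ∷ []) ∷
  stage ((2 , 1 ∷ 2 ∷ []) ∷ (2 , 0 ∷ 3 ∷ []) ∷ (0 , 0 ∷ 4 ∷ []) ∷ (0 , 1 ∷ 5 ∷ []) ∷ (0 , 2 ∷ 5 ∷ []) ∷ (0 , 3 ∷ 4 ∷ []) ∷ [])
    (mode ((1 , 1) ∷ (1 , 2) ∷ (1 , 3) ∷ []) 2 (2 ∷ []))
    ("2e3e2d5p4o3pp5o66kloJ02077lkoJ13046J020J020J02056J240J020J13087J130l8J350J350J3507J130J130J13088"
      ∷ "kl5J240lJ24056J240J240J240J240l:9:J450lS;J450J4512J2407J240J240J2407J240J240J130;J130<J130J13056"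
      ∷ "J020J020J0207J130J130J1308J240J240J24099J350ll6J350J350J3506J350J020J350;J020<J020J02066J020J020"
      ∷ ":J020J0206J020J020J0206J020J020:J020J020:6J020J020J020J0206J020J020J020;J020J020" ∷ []) ∷
  stage ((2 , 1 ∷ []) ∷ (0 , 0 ∷ 2 ∷ []) ∷ (2 , 1 ∷ []) ∷ [])
    (mode ((1 , 1) ∷ (1 , 2) ∷ (1 , 3) ∷ []) 2 (2 ∷ []))
    ("0c1e2l1kk5m5ll5ll33Tpp8e4J0115J01044Tpp8eJ12066J150J150kJ15077J150J150kJ1503n3nJ0108J0106oJ010J0"
      ∷ "108oJ150J0108oJ150J0109J1509J010J010J010J0109J010J010J010J010:;:J150J150cJ380J380J380J010J0103nJ"
      ∷ "0108J0107oJ010J0108oJ150J0108oJ150J0109J1509J010J010J010J0109J010J010J010J010:;:J150J150cJ380J38"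
      ∷ "0J380J010J01083nJ010J0109m8oook::J380J380J380dJ3809o9o6J030J150J0107J150J150K15390K15390lJ0309o6"
      ∷ "J030J150J0107J150J150K15390K15390lJ030l9oJ030J030l;;J390J390J390J390kJ390<J03044J120J010J010J010"
      ∷ "J1204J120J010J010J010J120J010J010J0104J120J120J010J010J010=>mJ010J0103n6oJ010J0108oJ150J0108oJ15"
      ∷ "0J0109J1509J010J010J010J0109J010J010J010J010:;:J150J150cJ380J380J380J010J0107oJ010J0108oJ150J010"
      ∷ "8oJ150J0109J1509J010J010J010J0109J010J010J010J010:;:J150J150cJ380J380J380J010J01099oook::J390J39"
      ∷ "0J390dJ3908o8o6J030J150J0107J150J150K15380K15380lJ0308o6J030J150J0107J150J150K15380K15380lJ030l8"
      ∷ "oJ030J030l;;J380J380J380J380kJ380<J03044J120J010J010J010J1204J120J010J010J010J120J010J010J0104J1"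
      ∷ "20J120J010J010J010=>mJ010J010J010" ∷ []) ∷
  stage ((2 , 1 ∷ []) ∷ (2 , 0 ∷ []) ∷ [])
    (mode ((1 , 1) ∷ (1 , 2) ∷ (1 , 3) ∷ []) 2 (2 ∷ []))
    ("01c2e3e2d2d3pp6r4r5r3pp7r44qq5qq8kJ020J020qq45qq8kJ020J020qq89r5qql5qql:89lJ240kJ2409J240lkJ240k"
      ∷ "j9J240J240klJ240J0205qql:89lJ240kJ2409J240lkJ240kj9J240J240klJ240J020:;rJ020;J020667J020J020J020"
      ∷ "J130J020J020J0207J130J020J020J020<kJ130J13067J020J020J020J130lJ020J020<r7J020J020J0207J020J020J0"
      ∷ "20K023607J020J020J020K02360=K02360>J130K02360J020J020J020<67J130J020J020J020kJ130rJ020J020J020<l"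
      ∷ "K026<0J020J020J020k=r8K24360kJ020J020K026=0r>>pK026<0K026<0K026<0dr?K24360?K026<0lJ020J020K026<0"
      ∷ "K026<0ArK24360??K24360dqqK24360r@e@K24360pJ020J020K24360K24360@K24360pJ020J020K24360K24360=7J020"
      ∷ "J020J020J130K24360K24360K24360J020J020J020lK24360K24360=K24360J020J020J020lK24361=K24361=CDrK243"
      ∷ "60K24360K2436067J130J020J020J020J130J1307J020J020J0207J020J020J020K023607J020J020J020K02360=K023"
      ∷ "60>J130K02360J020J020J020==lK026=0J020J020J020k8K24360kJ020J020K026<0r>>pK026=0K026=0K026=0dr?K2"
      ∷ "4360?K026=0lJ020J020K026=0K026=0ArK24360??K24360dqqK24360r@e@K24360pJ020J020K24360K24360@K24360p"
      ∷ "J020J020K24360K24360<7J020J020J020J130K24360K24360K24360J020J020J020lK24360K24360<K24360J020J020"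
      ∷ "J020lK24361<K24361<CDrK24360K24360K243609J020k9J020k8J240llJ240J240J240J020J0208J240lJ240J240J24"
      ∷ "0l>J240J24159J020k8J240llJ240J240J240J020J0208J240J240lJ240J240l>J240J2415J020J020>9J020k8J240lJ"
      ∷ "240J240J240dJ2408J240J240lJ240J240dJ240J020J020?rJ020J02095qq5qql:89lJ240iJ2409J240liJ240kk9J240"
      ∷ "J240ilJ240J020l5qq:89lJ240iJ2409J240liJ240kk9J240J240ilJ240J020l:;rJ020;J02066J0207J020J020J020J"
      ∷ "130J020J0207J020J130J020J020<kJ130J130J02067J020J020J020J130lJ020J020<r7J020J020J0207J020J020J02"
      ∷ "0K023607J020J020J020K02360=K02360>J130K02360J020J020<67J020J130J020J020kJ130J020rJ020J020<lJ020K"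
      ∷ "026<0J020J020k=r9K24360kJ020J020K026=0r>>pK026<0K026<0K026<0dr?K24360?K026<0lJ020J020K026<0K026<"
      ∷ "0ArK24360??K24360dqqK24360r@e@K24360pJ020J020K24360K24360@K24360pJ020J020K24360K24360=7J020J020J"
      ∷ "020J130K24360K24360K24360J020J020J020lK24360K24360=K24360J020J020J020lK24361=K24361=CDrK24360K24"
      ∷ "360K2436067J020J130J020J020J130J130J0207J020J020J0207J020J020J020K023607J020J020J020K02360=K0236"
      ∷ "0>J130K02360J020J020==lJ020K026=0J020J020k9K24360kJ020J020K026<0r>>pK026=0K026=0K026=0dr?K24360?"
      ∷ "K026=0lJ020J020K026=0K026=0ArK24360??K24360dqqK24360r@e@K24360pJ020J020K24360K24360@K24360pJ020J"
      ∷ "020K24360K24360<7J020J020J020J130K24360K24360K24360J020J020J020lK24360K24360<K24360J020J020J020l"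
      ∷ "K24361<K24361<CDrK24360K24360K243608J020k8J020k9J240llJ240J240J240J020J0209J240lJ240J240J240l>J2"
      ∷ "40J24158J020k9J240llJ240J240J240J020J0209J240J240lJ240J240l>J240J2415J020J020>8J020k9J240lJ240J2"
      ∷ "40J240dJ2409J240J240lJ240J240dJ240J020J020?rJ020J0205qq5qqJ020J0205qqJ020J0205qqJ020J020:;r66J02"
      ∷ "0J0207J020J020J020J130J0207J020J020J130J020<kJ130J130J020J02067J020J020J020J130J020J020l<r7J020J"
      ∷ "020J0207J020J020J020K023607J020J020J020K02360=K02360>J130K02360J020<67J020J020J130J020kJ130J020J"
      ∷ "020rJ020<lJ020J020K026<0J020k=r:K25360J020J020kK026=0r>>pK026<0K026<0K026<0dr?K25360?K026<0J020J"
      ∷ "020lK026<0K026<0ArK25360??K25360qqdK25360r@e@K25360J020J020pK25360K25360@K25360J020J020pK25360K2"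
      ∷ "5360=7J020J020J020J130K25360K25360K25360J020J020J020lK25360K25360=K25360J020J020J020lK25361=K253"
      ∷ "61=CDrK25360K25360K2536067J020J020J130J020J130J130J020J0207J020J020J0207J020J020J020K023607J020J"
      ∷ "020J020K02360=K02360>J130K02360J020==lJ020J020K026=0J020k:K25360J020J020kK026<0r>>pK026=0K026=0K"
      ∷ "026=0dr?K25360?K026=0J020J020lK026=0K026=0ArK25360??K25360qqdK25360r@e@K25360J020J020pK25360K253"
      ∷ "60@K25360J020J020pK25360K25360<7J020J020J020J130K25360K25360K25360J020J020J020lK25360K25360<K253"
      ∷ "60J020J020J020lK25361<K25361<CDrK25360K25360K253608J0208J020J0209J240J2415UJ240J240J240J020J020>"
      ∷ "9J240J020J240J240J240kJ240J020J0208J0209J240J2415UJ240J240J240lJ020J020>>J020lpkJ020J020;J020K8;"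
      ∷ "010kJ020J020l:J250J250J250J250rl@J250J2514J020J020J020>>J020lq8J0209J240J020lJ240J240J240nkJ020J"
      ∷ "020?rJ020J020J020?8J0209J240J020J240J240J240dJ240r9J020J020K8;010J020J020p9J020J020J480J020J020p"
      ∷ "@ArJ020J020J020J020c@rJ020J020J020;66J020J020J0207J020J020J020J1307J020J020J020J130<kJ130J130J02"
      ∷ "0J020J02067J020J020J020J130J020J020l<r7J020J020J0207J020J020J020K023607J020J020J020K02360=K02360"
      ∷ ">J130K02360<67J020J020J020J130kJ130J020J020J020r<lJ020J020J020K026<0k=r;K25360J020J020kK026=0r>>"
      ∷ "pK026<0K026<0K026<0dr?K25360?K026<0J020J020lK026<0K026<0ArK25360??K25360qqdK25360r@e@K25360J020J"
      ∷ "020pK25360K25360@K25360J020J020pK25360K25360=7J020J020J020J130K25360K25360K25360J020J020J020lK25"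
      ∷ "360K25360=K25360J020J020J020lK25361=K25361=CDrK25360K25360K2536067J020J020J020J130J130J130J020J0"
      ∷ "20J0207J020J020J0207J020J020J020K023607J020J020J020K02360=K02360>J130K02360==lJ020J020J020K026=0"
      ∷ "k;K25360J020J020kK026<0r>>pK026=0K026=0K026=0dr?K25360?K026=0J020J020lK026=0K026=0ArK25360??K253"
      ∷ "60qqdK25360r@e@K25360J020J020pK25360K25360@K25360J020J020pK25360K25360<7J020J020J020J130K25360K2"
      ∷ "5360K25360J020J020J020lK25360K25360<K25360J020J020J020lK25361<K25361<CDrK25360K25360K253608J0208"
      ∷ "J0209J240UJ2415J240J240J240J020J020J020>9J240J240J020J240J240kJ240J0208J0209J240UJ2415J240J240J2"
      ∷ "40lJ020J020>>J020lkpJ020J020:J020K8:010kJ020J020l;J250J250J250J250rl@J250J2514J020J020J020J020>>"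
      ∷ "J020l8J0209J240lJ020J240J240J240knJ020J020?rJ020qJ020J020?8J0209J240J240J020J240J240dJ2409J020K8"
      ∷ ":010J020J020J020p9J020J480J020J020J020p@ArJ020J020rJ020J020c@rJ020J020J020J020" ∷ []) ∷
  stage ((2 , 1 ∷ 2 ∷ []) ∷ (0 , 0 ∷ 3 ∷ []) ∷ (0 , 0 ∷ 4 ∷ []) ∷ (0 , 1 ∷ 4 ∷ []) ∷ (0 , 2 ∷ 3 ∷ []) ∷ [])
    -- Two vertices of degree 2 on a 5-cycle are adjacent or have a common neighbour, and both
    -- situations are settled. So at least four vertices of a special component are next to X, and
    -- all five once this stage is done.
    (mode ((1 , 1) ∷ (1 , 2) ∷ (1 , 3) ∷ (2 , 2) ∷ []) 3 (2 ∷ []))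
    ("112k4l3n5r22ll4n6r35RJ010J01045J130J130R6J2407lJ24077J240J240J240J24077kl4J130lJ1304J130J130lJ13"
      ∷ "045J130J130J1306J020J020J0207J130J130J13088J240llJ240557J130J130J13067J7808K13240K13240J15099J26"
      ∷ "0lJ2608K15240K15240K1524099kJ150J150J15067K13260K13260K132608J240J240J2409J150J150J150::J260J260"
      ∷ "lJ260778J150K13240K13240J1308J240K13240;kJ130K1324078J150K13240K13240J1309J150K13560;kJ130K13560"
      ∷ "7J130J130J130;78J240K13240kK132409J150K13560kK13560J130;K26370K26370K136:0kK263707J130J130J130<J"
      ∷ "130J131457J130J130J1307J130J1314J1307J130J1309kJ130J130567J7808K13240K13240J15099J260lJ2608K1524"
      ∷ "0K15240K152407J130J1314J13099J150J150kJ15067K133406J240J2608J1509:J580K13670K13240:6J2408J150K13"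
      ∷ "480K13240k:K13480K13670lK13670J1306J240J240J24067K13240J2608J1509:J130K13260K13240J240::J260J260"
      ∷ "kJ2608J240J150J240J240:6:kJ260J260J260J240:J260J260kJ260:J260J260J260kJ26067J7808J150K13240K1324"
      ∷ "0J1308J240K13240;K13480J130K13240J2408J240J150J240J240;;J260J260J260kJ2608J240J240J240J240<J240J"
      ∷ "2413959kJ150J150J1507J130J130kJ1309J150J150kJ1509J150J150J150kJ150567K13260K13260K132608J240J240"
      ∷ "J2409J150J150J150::J260J260lJ260778J150K13240K13240J1308J240K13240;kJ130K1324078J150K13240K13240"
      ∷ "J1309J150K13560;kJ130K135607J130J130J130;78J240K13240kK132409J150K13560kK13560J130;K26370K26370K"
      ∷ "136:0kK263707J130J130J130<J130J13147J130J130J130J13067K133406J240J2608J1509:J580K13670K13240:6J2"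
      ∷ "408J150K13480K13240k:K13480K13670lK13670J1306J240J240J24067K13240J2608J1509:J130K13260K13240J240"
      ∷ "::J260J260kJ2608J240J150J240J240:6:kJ260J260J260J240:J260J260kJ260:J260J260J260kJ26067J7808J150K"
      ∷ "13240K13240J1308J240K13240;K13480J130K13240J2408J240J150J240J240;;J260J260J260kJ2608J240J240J240"
      ∷ "J240<J240J2413::J150J150J150kJ15067J130J130J130;J1306J130J130J130J1308J1314J1314J1314J13148J1314"
      ∷ "J1314J1314J1314<<J260J260lJ130J130J1314J131467J130J130J130J1308J240J240J240J2408J240J240J240J240"
      ∷ "8J240J240J240;kJ240J24067J130J130J130J1308J240J240J240J24097K13260J260K132608K24150J150K24150J15"
      ∷ "0:J260J150;lJ150K15260;;J260J260kJ260J26079K13260K24150J260J150<<J9<0J9<0llK13690J1507K13260J260"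
      ∷ "J130K1326079J480J150J1508J150K136;0:J150<J150K153419K245:0J260J130<<8J8914lK13480K13480K13690k9J"
      ∷ "150J150J260K136;0:K37010J150J370lK37010J1307J130J130J130J130<79K13480J260J150J9<0==J480llsK13690"
      ∷ "J150K13260<8J8914lK13480K13480K13690k9J150J150J260K136;0:K37010J150J370lK37010J130=rJ1307J130J13"
      ∷ "0J130J130=J130J131467J130J130J130J1308J240J240J240J24097K13260J260K132608K24150J150K24150J150:J2"
      ∷ "60J150;lJ150K15260;;J260J260J260kJ2607:K13260K24150J260J150<<J:<0J:<0llK136:0J1507:J480J150J1508"
      ∷ "J150K136;09J150<J150K15341:K24590J260J130<<8lJ8:14K13480K13480kK136:09K37010J150lK370109K37010J1"
      ∷ "50J370lK37010J1307K13260J260J130K132607J130J130J130J130<7:K13480J260J150J:<0==J480llsK136:0J150<"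
      ∷ "8lJ8:14K13480K13480kK136:09K37010J150lK370109K37010J150J370lK37010K13260J130=rJ1307J130J130J130J"
      ∷ "130=J130J1314;;6kJ260J260J260J2606J260kJ260J260J2606J260J260kJ260J2606J260J260J260kJ2606J260J260"
      ∷ "J260J260kJ26067J130J130J130J130<J130J13148J240J240J240J240J24079K13260K24150J260J150<<J9<0J9<0ll"
      ∷ "K13690J1507K13260J260J130K1326079J480J150J1508J150K136;0:J150<J150K153419K245:0J260J130<<8J8914l"
      ∷ "K13480K13480K13690k9J150J150J260K136;0:K37010J150J370lK37010J1307J130J130J130J130<79K13480J260J1"
      ∷ "50J9<0==J480llsK13690J150K13260<8J8914lK13480K13480K13690k9J150J150J260K136;0:K37010J150J370lK37"
      ∷ "010J130=rJ1307J130J130J130J130=J130J13147:K13260K24150J260J150<<J:<0J:<0llK136:0J1507:J480J150J1"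
      ∷ "508J150K136;09J150<J150K15341:K24590J260J130<<8lJ8:14K13480K13480kK136:09K37010J150lK370109K3701"
      ∷ "0J150J370lK37010J1307K13260J260J130K132607J130J130J130J130<7:K13480J260J150J:<0==J480llsK136:0J1"
      ∷ "50<8lJ8:14K13480K13480kK136:09K37010J150lK370109K37010J150J370lK37010K13260J130=rJ1307J130J130J1"
      ∷ "30J130=J130J1314<<J260J260J260J260kJ260778J240J2409J370J780J370K245909J370J370J780K245909K24590K"
      ∷ "24590K24590K24590K245908J240J240:J370J780J370K245:0:J370J370J780K245:0:K245:0K245:0K245:0K245:0K"
      ∷ "245:0J130J130=8J240J240;K136;0K136;0K136;0lK136;0<K136<0K136<0K136<0lK136<0k=J370J370J370J370lJ3"
      ∷ "70J13078J240J2409J370J780J370K245909J370J370J780K245909K24590K24590K24590K24590K2459098J240J240J"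
      ∷ "240J240U:K15340J590K15340K15340:K15340K15340J590K15340:K15340K15340K15340K02790K15340J130J130=98"
      ∷ "J240J240J240lJ240:J150J150J150lJ150;K136;0J260K136;0lK136;0<K136<0J260K136<0lK136<0k=K37010K3701"
      ∷ "0K37010K37010lK37010J13078J240J240:J370J780J370K245:0:J370J370J780K245:0:K245:0K245:0K245:0K245:"
      ∷ "0K245:098J240J240J240J240U:K15340J590K15340K15340:K15340K15340J590K15340:K15340K15340K15340K0279"
      ∷ "0K15340J130J130=:8J240J240J240lJ2409J150J150J150lJ150;K136;0J260K136;0lK136;0<K136<0J260K136<0lK"
      ∷ "136<0k=K37010K37010K37010K37010lK37010J1307J130J130J130J130=J130J13147J130J130J130J130=J130J1314"
      ∷ "=78J240J240;K136;0K136;0K136;0lK136;0<K136<0K136<0K136<0lK136<0k=J370J370J370J370lJ37098J240J240"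
      ∷ "J240lJ240:J150J150J150lJ150;K136;0J260K136;0lK136;0<K136<0J260K136<0lK136<0k=K37010K37010K37010K"
      ∷ "37010lK37010:8J240J240J240lJ2409J150J150J150lJ150;K136;0J260K136;0lK136;0<K136<0J260K136<0lK136<"
      ∷ "0k=K37010K37010K37010K37010lK37010J130J130>r;J130J130J130;J130J130J130K136;0J130<J130J130J130J26"
      ∷ "0J130=J130J130J130k?J260K26370J260;J130J130J130K136;0lK136;0J130;J130J130J130<J130J130J130J260J1"
      ∷ "30=J130J130J130k?J260K26370J260K136;0J130??J130J130J130lsJ130kK136;0=J130J130J130K136<0k@@J130J1"
      ∷ "30J130lJ130kK136;0J260J260@@J130J130J130lJ130krK136;0K263707J130J130J130J1314J1314>;J130J130J130"
      ∷ ";J130J130J130J130K136;0<J130J130J130J130J260>J130J130J130k?J260K26370J260J130;J130J130J130K136;0"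
      ∷ "lK136;0;J130J130J130<J130J130J130J130J260>J130J130J130k?J260K26370J260J130K136;0??J130J130J130lJ"
      ∷ "130skK136;0>J130J130J130K136<0k@@J130J130J130lJ130kK136;0J260J260@@J130J130J130lJ130krK136;0K263"
      ∷ "708J1314J13148J130J130;J130J130UJ130J130K136;0J130J130;J130J130K136;0J130J130?kJ240K136;08J130J1"
      ∷ "30;J130J130UJ130J130K136;0J130J130<J130J130K136<0J130J130?kJ240K136<0J1314J1314?8J1314J1314;J130"
      ∷ "J130K136;0J130J130kK136;0<J130J130K136<0J130J130kK136<0J1314J1314@rJ2408J130J130J240J240J130J130"
      ∷ "@J24099J130J130:J130J130J150J150J130J130J150:J130J130J150J150J130J130J150J130J130:J130J130J150J1"
      ∷ "50J130J130AkJ130J150J130J1309:J130J130J150J150J130J130J150J130J130=:J130J130J150J130J130J150J130"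
      ∷ "J130J370J130J130A>K027=0J130J130J130J130lK027=0J130J130J130AAlJ130J130kK24590J130J130J130J1309:J"
      ∷ "130J130J150J150J130J130J150J130J130=:J130J130J150J130J130J150J130J130J370J130J130A>K027=0J130J13"
      ∷ "0J130J130lK027=0J130J130J130AAlJ130J130K24590kJ130J130J130J130J130J130AAlJ130J1309K24590J130J130"
      ∷ "kK24590J130J130K245909K24590J130J130K24590kJ130J130K24590J130J130J130J130" ∷ []) ∷
  stage ((2 , 1 ∷ []) ∷ (3 , 0 ∷ 2 ∷ 4 ∷ []) ∷ (0 , 1 ∷ 3 ∷ []) ∷ (0 , 2 ∷ 4 ∷ []) ∷ (0 , 1 ∷ 3 ∷ []) ∷ [])
    (mode ((1 , 1) ∷ (1 , 2) ∷ (1 , 3) ∷ (2 , 2) ∷ []) 4 (2 ∷ []))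
    ("02k3l4k2l4l55l3tl5l3tl6r7r3l2J010tt84ttl8kJ120J120tJ1204tt3J120J120J120J1203J120J120J1209kJ120J1"
      ∷ "20" ∷ []) ∷
  stage ((2 , 1 ∷ 2 ∷ []) ∷ (0 , 0 ∷ 3 ∷ []) ∷ (0 , 0 ∷ 4 ∷ []) ∷ (0 , 1 ∷ 5 ∷ []) ∷ (0 , 2 ∷ 5 ∷ []) ∷ (0 , 3 ∷ 4 ∷ []) ∷ [])
    (mode ((1 , 1) ∷ (1 , 2) ∷ (1 , 3) ∷ (2 , 2) ∷ []) 4 (2 ∷ []))
    ("112k4l5t3o6r22l5tl4o7r3t6t5utJ010t6t5utu6t5utu58rJ13088lkJ130ttJ13099J160tJ160tkJ160::J160tJ160t"
      ∷ "kJ1605u8J130J130J130J130J13047J020J450J020J0208uJ3509J350J160J450;uJ130J240:u8J130J890K134:0J160"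
      ∷ "9J160K16450;lJ160K16450;;ltlJ240J240J01047J020J020J450J0208u9J380J160J480J350;uJ1309u8J130J8:0K1"
      ∷ "3490J160:J160K16450;lJ160K16450J240;;ltJ240lJ240J010;;ktl47J450tJ450J450ul9K015;0ttK015;09K015;0"
      ∷ "tK015;0tK015;047J450J450tJ450u9uJ450tJ450l:K015;0tK015;0tK015;047J450J450J450tJ450u9uJ450J450tJ4"
      ∷ "50:uJ450J450tJ450l==ltJ450J450rJ450J010J010" ∷ []) ∷
  stage ((2 , []) ∷ [])
    (mode ((1 , 1) ∷ (1 , 2) ∷ (1 , 3) ∷ (2 , 2) ∷ []) 4 (2 ∷ []))
    ("0011k1k3r4r22ll2ll5r6r33tt4ttuJ010tt34ttuJ010tt4ttuu4ttuu77vvktt8rJ13088vvkttJ13099vvttkJ140::vv"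
      ∷ "ttkJ14055vvvv6vvvvuJ020vvvv56vvvvuJ020vvvv6vvvvuu6vvvvuu;<r;J250J250J250J250kttJ250==J260J260J26"
      ∷ "0J260ttkJ010J010" ∷ []) ∷ []

-- None of these occurs in V. The first two let the mode of `cubicStages` exclude every pair of
-- degrees except (3 , 3).
cubicLib : List Pattern
cubicLib = ((1 , []) ∷ []) ∷ ((2 , []) ∷ []) ∷ petersen ∷ []

-- Lists and Booleans

true≢false : ∀ {b} → b ≡ true → b ≡ false → ⊥
true≢false refl ()

true⇒T : ∀ {b} → b ≡ true → T b
true⇒T = Equivalence.from T-≡

T⇒true : ∀ {b} → T b → b ≡ true
T⇒true = Equivalence.to T-≡

∧-true : ∀ {a b} → a ∧ b ≡ true → a ≡ true × b ≡ true
∧-true {true} {true} _ = refl , refl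

∨-true : ∀ {a b} → a ∨ b ≡ true → a ≡ true ⊎ b ≡ true
∨-true {true}  _ = inj₁ refl
∨-true {false} e = inj₂ e

not-true : ∀ {a} → not a ≡ true → a ≡ false
not-true {false} _ = refl

not-false : ∀ {a} → not a ≡ false → a ≡ true
not-false {true} _ = refl

≡ᵇ-true : ∀ {i j} → (i ≡ᵇ j) ≡ true → i ≡ j
≡ᵇ-true {i} {j} e = ≡ᵇ⇒≡ i j (true⇒T e)

<ᵇ-true : ∀ {i j} → (i <ᵇ j) ≡ true → i < j
<ᵇ-true {i} {j} e = <ᵇ⇒< i j (true⇒T e)

≤ᵇ-true : ∀ {i j} → (i ≤ᵇ j) ≡ true → i ≤ j
≤ᵇ-true {i} {j} e = ≤ᵇ⇒≤ i j (true⇒T e)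

true-≡ᵇ : ∀ i → (i ≡ᵇ i) ≡ true
true-≡ᵇ i = T⇒true (≡⇒≡ᵇ i i refl)

true-≤ᵇ : ∀ {i j} → i ≤ j → (i ≤ᵇ j) ≡ true
true-≤ᵇ = T⇒true ∘ ≤⇒≤ᵇ

module _ {A : Set} where

  all-true : ∀ (p : A → Bool) {xs x} → all p xs ≡ true → x ∈ xs → p x ≡ true
  all-true p {_ ∷ _} e (here refl) = proj₁ (∧-true e)
  all-true p {y ∷ _} e (there x∈)  = all-true p (proj₂ (∧-true {p y} e)) x∈

  any-true : ∀ (p : A → Bool) xs → any p xs ≡ true → ∃ λ x → x ∈ xs × p x ≡ true
  any-true p (x ∷ xs) e with ∨-true {p x} e
  ... | inj₁ px = x , here refl , px
  ... | inj₂ e′ with any-true p xs e′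
  ...   | y , y∈ , py = y , there y∈ , py

  true-any : ∀ (p : A → Bool) {xs x} → x ∈ xs → p x ≡ true → any p xs ≡ true
  true-any p (here refl) px rewrite px = refl
  true-any p {y ∷ _} (there x∈) px with p y
  ... | true  = refl
  ... | false = true-any p x∈ px

  ∈-filterᵇ⁺ : ∀ (p : A → Bool) {xs x} → x ∈ xs → p x ≡ true → x ∈ filterᵇ p xs
  ∈-filterᵇ⁺ p x∈ px = ∈-filter⁺ (T? ∘ p) x∈ (true⇒T px)

  ∈-filterᵇ⁻ : ∀ (p : A → Bool) {xs x} → x ∈ filterᵇ p xs → x ∈ xs × p x ≡ true
  ∈-filterᵇ⁻ p {xs} x∈ with ∈-filter⁻ (T? ∘ p) {xs = xs} x∈
  ... | x∈′ , t = x∈′ , T⇒true t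

  unique-filterᵇ : ∀ (p : A → Bool) {xs} → Unique xs → Unique (filterᵇ p xs)
  unique-filterᵇ p = Unique.filter⁺ (T? ∘ p)

  length-filterᵇ : ∀ (p : A → Bool) xs → length xs ≡ length (filterᵇ p xs) + length (filterᵇ (not ∘ p) xs)
  length-filterᵇ p [] = refl
  length-filterᵇ p (x ∷ xs) with p x
  ... | true  = cong suc (length-filterᵇ p xs)
  ... | false = trans (cong suc (length-filterᵇ p xs)) (sym (+-suc _ _))

  filterᵇ-cong-length : ∀ (p q : A → Bool) xs → (∀ {x} → x ∈ xs → p x ≡ q x) →
                        length (filterᵇ p xs) ≡ length (filterᵇ q xs)
  filterᵇ-cong-length p q []       h = refl
  filterᵇ-cong-length p q (x ∷ xs) h rewrite h (here refl) with q x
  ... | true  = cong suc (filterᵇ-cong-length p q xs (h ∘ there))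
  ... | false = filterᵇ-cong-length p q xs (h ∘ there)

  filterᵇ-mono-length : ∀ (p q : A → Bool) xs → (∀ {x} → x ∈ xs → p x ≡ true → q x ≡ true) →
                        length (filterᵇ p xs) ≤ length (filterᵇ q xs)
  filterᵇ-mono-length p q []       h = z≤n
  filterᵇ-mono-length p q (x ∷ xs) h with p x in ep | q x in eq
  ... | true  | true  = s≤s (filterᵇ-mono-length p q xs (h ∘ there))
  ... | true  | false = ⊥-elim (true≢false (h (here refl) ep) eq)
  ... | false | true  = m≤n⇒m≤1+n (filterᵇ-mono-length p q xs (h ∘ there))
  ... | false | false = filterᵇ-mono-length p q xs (h ∘ there)

  unique-↭ : ∀ {xs ys : List A} → Unique xs → Unique ys →
             (∀ {x} → x ∈ xs → x ∈ ys) → (∀ {x} → x ∈ ys → x ∈ xs) → xs ↭ ys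
  unique-↭ ux uy f g = ∼bag⇒↭ (unique∧set⇒bag ux uy (mk⇔ f g))

  sum-mono-∈ : ∀ (f g : A → ℕ) xs → (∀ {x} → x ∈ xs → f x ≤ g x) → sum (map f xs) ≤ sum (map g xs)
  sum-mono-∈ f g []       h = z≤n
  sum-mono-∈ f g (x ∷ xs) h = +-mono-≤ (h (here refl)) (sum-mono-∈ f g xs (h ∘ there))

  sum-+ : ∀ (f g : A → ℕ) xs → sum (map (λ x → f x + g x) xs) ≡ sum (map f xs) + sum (map g xs)
  sum-+ f g []       = refl
  sum-+ f g (x ∷ xs) = trans (cong (f x + g x +_) (sum-+ f g xs)) (interchange +-commutativeSemigroup (f x) (g x) _ _)

module _ {A : Set} (_≟_ : (x y : A) → Dec (x ≡ y)) where

  member : List A → A → Bool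
  member ys x = does (_∈?_ _≟_ x ys)

  member⁺ : ∀ {ys x} → x ∈ ys → member ys x ≡ true
  member⁺ {ys} {x} x∈ with _∈?_ _≟_ x ys
  ... | yes _  = refl
  ... | no x∉ = ⊥-elim (x∉ x∈)

  member⁻ : ∀ {ys x} → member ys x ≡ true → x ∈ ys
  member⁻ {ys} {x} e with _∈?_ _≟_ x ys
  ... | yes x∈ = x∈

  member-∉ : ∀ {ys x} → x ∉ ys → member ys x ≡ false
  member-∉ {ys} {x} x∉ with _∈?_ _≟_ x ys
  ... | yes x∈ = ⊥-elim (x∉ x∈)
  ... | no _   = refl

  ∉-member : ∀ {ys x} → member ys x ≡ false → x ∉ ys
  ∉-member {ys} {x} e x∈ = true≢false (member⁺ x∈) e

  length-⊆ : ∀ {xs ys : List A} → Unique xs → Unique ys → (∀ {x} → x ∈ xs → x ∈ ys) → length xs ≤ length ys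
  length-⊆ {xs} {ys} ux uy f =
    subst (_≤ length ys) (sym (↭-length xs↭)) (≤-trans (m≤m+n _ _) (≤-reflexive (sym (length-filterᵇ (member xs) ys))))
    where
    xs↭ : xs ↭ filterᵇ (member xs) ys
    xs↭ = unique-↭ ux (unique-filterᵇ _ uy) (λ x∈ → ∈-filterᵇ⁺ _ (f x∈) (member⁺ x∈))
                   (λ x∈ → member⁻ (proj₂ (∈-filterᵇ⁻ (member xs) {ys} x∈)))

  -- Outside `vs` the two sums have the same entries, so they differ by what happens on `vs`; the
  -- terms are arranged so that nothing is subtracted.
  sum-local : ∀ (f g : A → ℕ) {xs vs} → Unique xs → Unique vs → (∀ {x} → x ∈ vs → x ∈ xs) →
              (∀ {x} → x ∈ xs → x ∉ vs → f x ≡ g x) →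
              sum (map f xs) + sum (map g vs) ≡ sum (map g xs) + sum (map f vs)
  sum-local f g {xs} {vs} ux uv sub off = trans (cong (sum (map f xs) +_) (sum-↭ (map⁺ g vs↭)))
    (trans (go xs off) (cong (sum (map g xs) +_) (sym (sum-↭ (map⁺ f vs↭)))))
    where
    vs↭ : vs ↭ filterᵇ (member vs) xs
    vs↭ = unique-↭ uv (unique-filterᵇ _ ux) (λ x∈ → ∈-filterᵇ⁺ _ (sub x∈) (member⁺ x∈))
                   (λ x∈ → member⁻ (proj₂ (∈-filterᵇ⁻ (member vs) {xs} x∈)))
    swap : ∀ a b c d → a + b ≡ c + d → ∀ x y → (x + a) + (y + b) ≡ (y + c) + (x + d)
    swap a b c d e x y = begin
      (x + a) + (y + b) ≡⟨ interchange +-commutativeSemigroup x a y b ⟩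
      (x + y) + (a + b) ≡⟨ cong₂ _+_ (+-comm x y) e ⟩
      (y + x) + (c + d) ≡⟨ interchange +-commutativeSemigroup y x c d ⟩
      (y + c) + (x + d) ∎
      where open ≡-Reasoning
    go : ∀ zs → (∀ {x} → x ∈ zs → x ∉ vs → f x ≡ g x) →
         sum (map f zs) + sum (map g (filterᵇ (member vs) zs)) ≡ sum (map g zs) + sum (map f (filterᵇ (member vs) zs))
    go []       _ = refl
    go (z ∷ zs) h with _∈?_ _≟_ z vs
    ... | yes _   = swap _ _ _ _ (go zs (h ∘ there)) (f z) (g z)
    ... | no z∉ = trans (+-assoc (f z) _ _) (trans (cong₂ _+_ (h (here refl) z∉) (go zs (h ∘ there))) (sym (+-assoc (g z) _ _)))

∈ᵇ⇒∈ : ∀ {i} js → (i ∈ᵇ js) ≡ true → i ∈ js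
∈ᵇ⇒∈ {i} (j ∷ js) e with ∨-true {i ≡ᵇ j} e
... | inj₁ p = here (≡ᵇ-true p)
... | inj₂ q = there (∈ᵇ⇒∈ js q)

∈⇒∈ᵇ : ∀ {i js} → i ∈ js → (i ∈ᵇ js) ≡ true
∈⇒∈ᵇ {i} (here refl) rewrite true-≡ᵇ i = refl
∈⇒∈ᵇ {i} {j ∷ _} (there i∈) with i ≡ᵇ j
... | true  = refl
... | false = ∈⇒∈ᵇ i∈

∉ᵇ⇒∉ : ∀ {i js} → (i ∈ᵇ js) ≡ false → i ∉ js
∉ᵇ⇒∉ e i∈ = true≢false (∈⇒∈ᵇ i∈) e

∉⇒∉ᵇ : ∀ {i js} → i ∉ js → (i ∈ᵇ js) ≡ false
∉⇒∉ᵇ {i} {js} i∉ with i ∈ᵇ js in e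
... | true  = ⊥-elim (i∉ (∈ᵇ⇒∈ js e))
... | false = refl

distinct⇒Unique : ∀ js → distinct js ≡ true → Unique js
distinct⇒Unique []       _ = []
distinct⇒Unique (j ∷ js) e with ∧-true {not (j ∈ᵇ js)} e
... | p , q = All.tabulate (λ k∈ j≡k → ∉ᵇ⇒∉ (not-true p) (subst (_∈ js) (sym j≡k) k∈)) ∷ distinct⇒Unique js q

-- Degrees and weights inside a vertex set

unique-map : ∀ {A B : Set} (f : A → B) {xs} → Unique xs →
             (∀ {x y} → x ∈ xs → y ∈ xs → f x ≡ f y → x ≡ y) → Unique (map f xs)
unique-map f []         inj = []
unique-map f {x ∷ xs} (x∉ ∷ u) inj =
  All.tabulate (λ fy∈ fx≡ → let y , y∈ , e = ∈-map⁻ f fy∈ in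
                 All.lookup x∉ y∈ (inj (here refl) (there y∈) (trans fx≡ e)))
  ∷ unique-map f u (λ x∈ y∈ → inj (there x∈) (there y∈))

module _ {n : ℕ} (G : Graph n) where

  VSet : Set
  VSet = Fin n → Bool

  infixl 6 _∖_
  _∖_ : VSet → List (Fin n) → VSet
  (W ∖ xs) v = W v ∧ not (member _≟_ xs v)

  nb : VSet → Fin n → List (Fin n)
  nb W v = filterᵇ (λ u → Adj G v u ∧ W u) (allFin n)

  deg : VSet → Fin n → ℕ
  deg W v = length (nb W v)

  ∈-nb⁺ : ∀ W {v u} → Adj G v u ≡ true → W u ≡ true → u ∈ nb W v
  ∈-nb⁺ W {v} {u} a w = ∈-filterᵇ⁺ (λ u → Adj G v u ∧ W u) (∈-allFin u) (cong₂ _∧_ a w)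

  ∈-nb⁻ : ∀ W {v u} → u ∈ nb W v → Adj G v u ≡ true × W u ≡ true
  ∈-nb⁻ W {v} u∈ = ∧-true (proj₂ (∈-filterᵇ⁻ (λ u → Adj G v u ∧ W u) {allFin n} u∈))

  nb-unique : ∀ W v → Unique (nb W v)
  nb-unique W v = unique-filterᵇ _ (Unique.allFin⁺ n)

  ∖-true : ∀ W xs {v} → (W ∖ xs) v ≡ true → W v ≡ true × v ∉ xs
  ∖-true W xs {v} e with ∧-true {W v} e
  ... | w , m = w , ∉-member _≟_ {xs} {v} (not-true m)

  true-∖ : ∀ W xs {v} → W v ≡ true → v ∉ xs → (W ∖ xs) v ≡ true
  true-∖ W xs {v} w v∉ = cong₂ _∧_ w (cong not (member-∉ _≟_ {xs} {v} v∉))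

  adj-sym : ∀ {u v} → Adj G u v ≡ true → Adj G v u ≡ true
  adj-sym {u} {v} a = trans (symm G v u) a

  adj-irrefl : ∀ {u v} → Adj G u v ≡ true → u ≢ v
  adj-irrefl {u} a refl = true≢false a (irrefl G u)

  deg-∖ : ∀ W {xs} → Unique xs → (∀ {x} → x ∈ xs → W x ≡ true) → ∀ v →
          deg W v ≡ deg (W ∖ xs) v + length (filterᵇ (Adj G v) xs)
  deg-∖ W {xs} ux sub v = trans (length-filterᵇ (member _≟_ xs) (nb W v))
    (trans (+-comm (length (filterᵇ (member _≟_ xs) (nb W v))) _) (cong₂ _+_ (↭-length rest) (↭-length lost↭)))
    where
    rest = unique-↭ (unique-filterᵇ (not ∘ member _≟_ xs) (nb-unique W v)) (nb-unique (W ∖ xs) v)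
      (λ u∈ → let u∈′ , m = ∈-filterᵇ⁻ (not ∘ member _≟_ xs) {nb W v} u∈
                  a , w = ∈-nb⁻ W u∈′ in ∈-nb⁺ (W ∖ xs) a (cong₂ _∧_ w m))
      (λ u∈ → let a , w = ∈-nb⁻ (W ∖ xs) u∈
                  w′ , m = ∧-true w in ∈-filterᵇ⁺ (not ∘ member _≟_ xs) (∈-nb⁺ W a w′) m)
    lost↭ = unique-↭ (unique-filterᵇ (member _≟_ xs) (nb-unique W v)) (unique-filterᵇ (Adj G v) ux)
      (λ u∈ → let u∈′ , m = ∈-filterᵇ⁻ (member _≟_ xs) {nb W v} u∈
                  a , w = ∈-nb⁻ W u∈′ in ∈-filterᵇ⁺ (Adj G v) (member⁻ _≟_ {xs} m) a)
      (λ u∈ → let u∈′ , a = ∈-filterᵇ⁻ (Adj G v) {xs} u∈ in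
                  ∈-filterᵇ⁺ (member _≟_ xs) (∈-nb⁺ W a (sub u∈′)) (member⁺ _≟_ u∈′))

  term : VSet → Fin n → ℕ
  term W v = if W v then weight (deg W v) else 0

  Φ : VSet → ℕ
  Φ W = sum (map (term W) (allFin n))

  term-in : ∀ W {v} → W v ≡ true → term W v ≡ weight (deg W v)
  term-in W w rewrite w = refl

  term-out : ∀ W {v} → W v ≡ false → term W v ≡ 0
  term-out W w rewrite w = refl

  deg≤3 : Cubic G → ∀ W v → deg W v ≤ 3
  deg≤3 cubic W v = subst (deg W v ≤_) (cubic v)
    (filterᵇ-mono-length (λ u → Adj G v u ∧ W u) (Adj G v) (allFin n) (λ _ → proj₁ ∘ ∧-true))

  record Emb (W : VSet) (P : Pattern) (σ : ℕ → Fin n) : Set where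
    field
      inj : ∀ {i j} → i < length P → j < length P → σ i ≡ σ j → i ≡ j
      mem : ∀ {i} → i < length P → W (σ i) ≡ true
      bnd : ∀ {i} → i < length P → ∀ {j} → j ∈ nbrs P i → j < length P
      edg : ∀ {i} → i < length P → ∀ {j} → j ∈ nbrs P i → Adj G (σ i) (σ j) ≡ true
      dgr : ∀ {i} → i < length P → known P i ≡ 0 ⊎ deg W (σ i) ≡ known P i

  module _ {W P σ} (E : Emb W P σ) where
    open Emb E

    good-unique : ∀ {i} → i < length P → good P i ≡ true → Unique (map σ (nbrs P i))
    good-unique i< g = unique-map σ (distinct⇒Unique _ g) (λ x∈ y∈ → inj (bnd i< x∈) (bnd i< y∈))

    good-⊆ : ∀ {i} → i < length P → good P i ≡ true → ∀ {u} → u ∈ map σ (nbrs P i) → u ∈ nb W (σ i)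
    good-⊆ i< g u∈ with ∈-map⁻ σ u∈
    ... | j , j∈ , refl = ∈-nb⁺ W (edg i< j∈) (mem (bnd i< j∈))

    good-degree : ∀ {i} → i < length P → good P i ≡ true → length (nbrs P i) ≤ deg W (σ i)
    good-degree {i} i< g = subst (_≤ deg W (σ i)) (length-map σ (nbrs P i))
      (length-⊆ _≟_ (good-unique i< g) (nb-unique W (σ i)) (good-⊆ i< g))

    closed-good : ∀ {i} → closed P i ≡ true → good P i ≡ true
    closed-good {i} c = proj₂ (∧-true {length (nbrs P i) ≡ᵇ known P i} (proj₂ (∧-true {0 <ᵇ known P i} c)))

    closed-degree : ∀ {i} → i < length P → closed P i ≡ true → deg W (σ i) ≡ known P i
    closed-degree {i} i< c with dgr i<
    ... | inj₂ e = e
    ... | inj₁ e = ⊥-elim (n≮0 (subst (0 <_) e (<ᵇ-true (proj₁ (∧-true {0 <ᵇ known P i} c)))))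

    -- Pigeonhole: the listed neighbours of a closed vertex have distinct images, as many as its
    -- degree in W, which leaves no room for another one.
    closure : ∀ {i v} → i < length P → closed P i ≡ true → W v ≡ true → Adj G (σ i) v ≡ true →
              ∃ λ j → j ∈ nbrs P i × j < length P × v ≡ σ j
    closure {i} {v} i< c w a with _∈?_ _≟_ v (map σ (nbrs P i))
    ... | yes v∈ with ∈-map⁻ σ v∈
    ...   | j , j∈ , e = j , j∈ , bnd i< j∈ , e
    closure {i} {v} i< c w a | no v∉ = ⊥-elim (1+n≰n (begin
      suc (length (nbrs P i))           ≡⟨ cong suc (length-map σ (nbrs P i)) ⟨
      length (v ∷ map σ (nbrs P i))     ≤⟨ length-⊆ _≟_ (All.tabulate (λ u∈ v≡u → v∉ (subst (_∈ _) (sym v≡u) u∈)) ∷ good-unique i< g) (nb-unique W (σ i))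
                                             (λ { (here refl) → ∈-nb⁺ W a w ; (there u∈) → good-⊆ i< g u∈ }) ⟩
      deg W (σ i)                       ≡⟨ closed-degree i< c ⟩
      known P i                         ≡⟨ ≡ᵇ-true (proj₁ (∧-true {length (nbrs P i) ≡ᵇ known P i} (proj₂ (∧-true {0 <ᵇ known P i} c)))) ⟨
      length (nbrs P i)                 ∎))
      where
      open ≤-Reasoning
      g = closed-good {i} c

-- The effect of removing vertices

∈⇒≤-foldr-⊔ : ∀ (f : ℕ → ℕ) {x xs} → x ∈ xs → f x ≤ foldr _⊔_ 0 (map f xs)
∈⇒≤-foldr-⊔ f {xs = x ∷ xs} (here refl) = m≤m⊔n (f x) _
∈⇒≤-foldr-⊔ f {xs = y ∷ xs} (there x∈)  = ≤-trans (∈⇒≤-foldr-⊔ f x∈) (m≤n⊔m (f y) _)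

length-filterᵇ-map : ∀ {A B : Set} (p : B → Bool) (f : A → B) xs →
                     length (filterᵇ p (map f xs)) ≡ length (filterᵇ (p ∘ f) xs)
length-filterᵇ-map p f []       = refl
length-filterᵇ-map p f (x ∷ xs) with p (f x)
... | true  = cong suc (length-filterᵇ-map p f xs)
... | false = length-filterᵇ-map p f xs

length-filterᵇ-none : ∀ {A : Set} (p : A → Bool) xs → (∀ {x} → x ∈ xs → p x ≡ false) → length (filterᵇ p xs) ≡ 0
length-filterᵇ-none p []       h = refl
length-filterᵇ-none p (x ∷ xs) h rewrite h (here refl) = length-filterᵇ-none p xs (h ∘ there)

private
  -- In the application f and w are the weights of W and W′, a and b their parts on the pattern, c
  -- and g the sums of `cost` and `gain`, k the price of the edges and h the surcharge.
  exchange : ∀ {k f w a b c g h} → b + g ≤ a + c → k + c + h ≤ g → f + b ≡ w + a → k + w + h ≤ f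
  exchange {k} {f} {w} {a} {b} {c} {g} {h} p q e = +-cancelʳ-≤ (a + c) _ _ (begin
    k + w + h + (a + c)     ≡⟨ solve₁ k w h a c ⟩
    (k + c + h) + (w + a)   ≡⟨ cong (k + c + h +_) e ⟨
    (k + c + h) + (f + b)   ≤⟨ +-monoˡ-≤ (f + b) q ⟩
    g + (f + b)             ≡⟨ solve₂ g f b ⟩
    f + (b + g)             ≤⟨ +-monoʳ-≤ f p ⟩
    f + (a + c)             ∎)
    where
    open ≤-Reasoning
    solve₁ : ∀ k w h a c → k + w + h + (a + c) ≡ (k + c + h) + (w + a)
    solve₁ = solve-∀
    solve₂ : ∀ g f b → g + (f + b) ≡ f + (b + g)
    solve₂ = solve-∀

module Removal {n : ℕ} (G : Graph n) (M : Mode) {W : VSet G} {P : Pattern} {σ : ℕ → Fin n} (E : Emb G W P σ)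
               (X : List ℕ) (uX : Unique X) (X< : ∀ {x} → x ∈ X → x < length P)
               (Xc : ∀ {x} → x ∈ X → closed P x ≡ true)
               (degs : ∀ {i} → i < length P → deg G W (σ i) ∈ degrees M P i) where

  open Emb E
  open Mode M

  xs : List (Fin n)
  xs = map σ X

  W′ : VSet G
  W′ = _∖_ G W xs

  xs-unique : Unique xs
  xs-unique = unique-map σ uX (λ x∈ y∈ → inj (X< x∈) (X< y∈))

  xs-⊆ : ∀ {x} → x ∈ xs → W x ≡ true
  xs-⊆ x∈ with ∈-map⁻ σ x∈
  ... | i , i∈ , refl = mem (X< i∈)

  ∉X⇒∉xs : ∀ {i} → i < length P → i ∉ X → σ i ∉ xs
  ∉X⇒∉xs i< i∉ σi∈ with ∈-map⁻ σ σi∈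
  ... | j , j∈ , e = i∉ (subst (_∈ X) (sym (inj i< (X< j∈) e)) j∈)

  -- Because the vertices of X are closed, an edge between X and the pattern is always listed, so
  -- the count is exact. For the same reason a vertex outside the pattern loses no neighbour, as
  -- `lost-outside` shows.
  lost-correct : ∀ {i} → i < length P → length (filterᵇ (Adj G (σ i)) xs) ≡ lost P X i
  lost-correct {i} i< = trans (length-filterᵇ-map (Adj G (σ i)) σ X) (filterᵇ-cong-length _ _ X agree)
    where
    agree : ∀ {x} → x ∈ X → Adj G (σ i) (σ x) ≡ (i ∈ᵇ nbrs P x)
    agree {x} x∈ with i ∈ᵇ nbrs P x in e
    ... | true  = adj-sym G (edg (X< x∈) (∈ᵇ⇒∈ _ e))
    ... | false with Adj G (σ i) (σ x) in a
    ...   | false = refl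
    ...   | true with closure G E (X< x∈) (Xc x∈) (mem i<) (adj-sym G a)
    ...     | j , j∈ , j< , eq = ⊥-elim (∉ᵇ⇒∉ e (subst (_∈ nbrs P x) (sym (inj i< j< eq)) j∈))

  lost-outside : ∀ {v} → W v ≡ true → (∀ {i} → i < length P → v ≢ σ i) → length (filterᵇ (Adj G v) xs) ≡ 0
  lost-outside {v} w out = length-filterᵇ-none (Adj G v) xs none
    where
    none : ∀ {x} → x ∈ xs → Adj G v x ≡ false
    none x∈ with ∈-map⁻ σ x∈
    ... | i , i∈ , refl with Adj G v (σ i) in a
    ...   | false = refl
    ...   | true with closure G E (X< i∈) (Xc i∈) w (adj-sym G a)
    ...     | j , _ , j< , eq = ⊥-elim (out j< eq)

  deg-split : ∀ v → deg G W v ≡ deg G W′ v + length (filterᵇ (Adj G v) xs)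
  deg-split = deg-∖ G W xs-unique xs-⊆

  deg-inside : ∀ {i} → i < length P → deg G W′ (σ i) ≡ deg G W (σ i) ∸ lost P X i
  deg-inside {i} i< = sym (trans (cong (_∸ lost P X i) (trans (deg-split (σ i)) (cong (deg G W′ (σ i) +_) (lost-correct i<))))
                                 (m+n∸n≡m (deg G W′ (σ i)) (lost P X i)))

  deg-outside : ∀ {v} → W v ≡ true → (∀ {i} → i < length P → v ≢ σ i) → deg G W v ≡ deg G W′ v
  deg-outside {v} w out = trans (deg-split v) (trans (cong (deg G W′ v +_) (lost-outside w out)) (+-identityʳ _))

  -- A removed vertex gives up exactly its weight, its degree being known. A remaining one becomes
  -- heavier by an amount that is among those over which `cost` takes the maximum.
  balance : ∀ {i} → i < length P → term G W′ (σ i) + gain P X i ≤ term G W (σ i) + cost M P X i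
  balance {i} i< with i ∈ᵇ X in e
  ... | true = ≤-reflexive (trans (cong₂ _+_ (term-out G W′ out) refl)
                 (sym (trans (+-identityʳ _) (trans (term-in G W (mem i<)) (cong weight (closed-degree G E i< (Xc i∈)))))))
    where
    i∈ = ∈ᵇ⇒∈ X e
    out : W′ (σ i) ≡ false
    out rewrite mem i< | member⁺ _≟_ {xs} (∈-map⁺ σ i∈) = refl
  ... | false rewrite term-in G W (mem i<) | term-in G W′ (true-∖ G W xs (mem i<) (∉X⇒∉xs i< (∉ᵇ⇒∉ e)))
                    | deg-inside i< | +-identityʳ (weight (deg G W (σ i) ∸ lost P X i)) with lost P X i ≡ᵇ 0 in z
  ...   | true  rewrite ≡ᵇ-true {lost P X i} z = m≤m+n _ 0
  ...   | false = ≤-trans (m≤n+m∸n _ (weight (deg G W (σ i)))) (+-monoʳ-≤ (weight (deg G W (σ i)))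
                    (∈⇒≤-foldr-⊔ (increase (lost P X i)) (degs i<)))

  image : List (Fin n)
  image = map σ (upTo (length P))

  ∈-image⁻ : ∀ {v} → v ∈ image → ∃ λ i → i < length P × v ≡ σ i
  ∈-image⁻ v∈ with ∈-map⁻ σ v∈
  ... | i , i∈ , e = i , ∈-upTo⁻ i∈ , e

  term-off : ∀ {v} → v ∉ image → term G W v ≡ term G W′ v
  term-off {v} v∉ with W v in w
  ... | false = refl
  ... | true  rewrite member-∉ _≟_ {xs} {v} (λ v∈ → let i , i∈ , e = ∈-map⁻ σ v∈ in
                        v∉ (subst (_∈ image) (sym e) (∈-map⁺ σ (∈-upTo⁺ (X< i∈)))))
    = cong weight (deg-outside w (λ i< e → v∉ (subst (_∈ image) (sym e) (∈-map⁺ σ (∈-upTo⁺ i<)))))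

  drop-by : ∀ b h → b + sum (map (cost M P X) (upTo (length P))) + h ≤ sum (map (gain P X) (upTo (length P))) →
            b + Φ G W′ + h ≤ Φ G W
  drop-by b h ok = exchange {b} {Φ G W} {Φ G W′} {sum (map (term G W ∘ σ) (upTo (length P)))}
    {sum (map (term G W′ ∘ σ) (upTo (length P)))} {sum (map (cost M P X) (upTo (length P)))}
    (begin
      sum (map (term G W′ ∘ σ) is) + sum (map (gain P X) is)     ≡⟨ sum-+ (term G W′ ∘ σ) (gain P X) is ⟨
      sum (map (λ i → term G W′ (σ i) + gain P X i) is)          ≤⟨ sum-mono-∈ _ _ is (balance ∘ ∈-upTo⁻) ⟩
      sum (map (λ i → term G W (σ i) + cost M P X i) is)         ≡⟨ sum-+ (term G W ∘ σ) (cost M P X) is ⟩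
      sum (map (term G W ∘ σ) is) + sum (map (cost M P X) is)    ∎)
    ok
    (subst₂ _≡_ (cong (Φ G W +_) (cong sum (sym (map-∘ is)))) (cong (Φ G W′ +_) (cong sum (sym (map-∘ is))))
      (sum-local _≟_ (term G W) (term G W′) (Unique.allFin⁺ n)
        (unique-map σ (Unique.upTo⁺ (length P)) (λ x∈ y∈ → inj (∈-upTo⁻ x∈) (∈-upTo⁻ y∈)))
        (λ _ → ∈-allFin _) (λ _ → term-off)))
    where
    open ≤-Reasoning
    is = upTo (length P)

  drop : ∀ k → affordable M P X k ≡ true →
         105 * k + Φ G W′ + 15 * (length (exposed M P X) / suc attach-1) ≤ Φ G W
  drop k ok = drop-by (105 * k) _ (≤ᵇ-true ok)

  module _ (K : List (Fin n)) (K⊆ : ∀ {v} → v ∈ K → W′ v ≡ true)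
           (K-closed : ∀ {u v} → u ∈ K → W′ v ≡ true → Adj G u v ≡ true → v ∈ K)
           (K-allowed : ∀ {v} → v ∈ K → deg G W′ v ∈ allowed) where

    -- A walk that starts in K and avoids X stays in K, so K would contain the vertex whose degree
    -- is not allowed.
    safe-correct : ∀ k {i} → i < length P → safe M P X k i ≡ true → σ i ∉ K
    safe-correct zero {i} i< s σi∈ = true≢false
      (true-any (λ d → (d ∸ lost P X i) ∈ᵇ allowed) (degs i<)
        (∈⇒∈ᵇ (subst (_∈ allowed) (deg-inside i<) (K-allowed σi∈))))
      (not-true s)
    safe-correct (suc k) {i} i< s σi∈ with ∨-true {safe M P X zero i} s
    ... | inj₁ s₀ = safe-correct zero i< s₀ σi∈
    ... | inj₂ s₁ with any-true (λ t → not (t ∈ᵇ X) ∧ safe M P X k t) (nbrs P i) s₁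
    ...   | t , t∈ , q with ∧-true {not (t ∈ᵇ X)} q
    ...     | t∉ , sₜ = safe-correct k (bnd i< t∈) sₜ
                (K-closed σi∈ (true-∖ G W xs (mem (bnd i< t∈)) (∉X⇒∉xs (bnd i< t∈) (∉ᵇ⇒∉ (not-true t∉)))) (edg i< t∈))

    exposed-correct : ∀ {v} → v ∈ K → deg G W v ≢ deg G W′ v → v ∈ map σ (exposed M P X)
    exposed-correct {v} v∈ ne with _∈?_ _≟_ v image
    ... | no v∉ = ⊥-elim (ne (deg-outside (proj₁ (∖-true G W xs (K⊆ v∈)))
                     (λ i< e → v∉ (subst (_∈ image) (sym e) (∈-map⁺ σ (∈-upTo⁺ i<))))))
    ... | yes v∈′ with ∈-image⁻ v∈′
    ...   | i , i< , refl = ∈-map⁺ σ (∈-filterᵇ⁺ _ (∈-upTo⁺ i<) (cong₂ _∧_ (cong not i∉) (cong₂ _∧_ (cong not l≢) (cong not us))))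
      where
      i∉ : (i ∈ᵇ X) ≡ false
      i∉ = ∉⇒∉ᵇ (λ i∈ → proj₂ (∖-true G W xs (K⊆ v∈)) (∈-map⁺ σ i∈))
      l≢ : (lost P X i ≡ᵇ 0) ≡ false
      l≢ with lost P X i ≡ᵇ 0 in z
      ... | false = refl
      ... | true  = ⊥-elim (ne (sym (trans (deg-inside i<) (cong (deg G W (σ i) ∸_) (≡ᵇ-true {lost P X i} z)))))
      us : safe M P X 2 i ≡ false
      us with safe M P X 2 i in s
      ... | false = refl
      ... | true  = ⊥-elim (safe-correct 2 i< s v∈)

-- Embedded patterns

length-update : ∀ P i f → length (update P i f) ≡ length P
length-update []      i       f = refl
length-update (x ∷ P) zero    f = refl
length-update (x ∷ P) (suc i) f = cong suc (length-update P i f)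

vertex-update : ∀ P {i} f → i < length P → vertex (update P i f) i ≡ f (vertex P i)
vertex-update (x ∷ P) {zero}  f _        = refl
vertex-update (x ∷ P) {suc i} f (s≤s i<) = vertex-update P f i<

vertex-update-≢ : ∀ P {i j} f → j ≢ i → vertex (update P i f) j ≡ vertex P j
vertex-update-≢ []      f ne = refl
vertex-update-≢ (x ∷ P) {zero}  {zero}  f ne = ⊥-elim (ne refl)
vertex-update-≢ (x ∷ P) {zero}  {suc j} f ne = refl
vertex-update-≢ (x ∷ P) {suc i} {zero}  f ne = refl
vertex-update-≢ (x ∷ P) {suc i} {suc j} f ne = vertex-update-≢ P f (ne ∘ cong suc)

vertex-++ˡ : ∀ P Q {i} → i < length P → vertex (P ++ Q) i ≡ vertex P i
vertex-++ˡ (x ∷ P) Q {zero}  _        = refl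
vertex-++ˡ (x ∷ P) Q {suc i} (s≤s i<) = vertex-++ˡ P Q i<

vertex-++ʳ : ∀ P x → vertex (P ++ x ∷ []) (length P) ≡ x
vertex-++ʳ []      x = refl
vertex-++ʳ (y ∷ P) x = vertex-++ʳ P x

nth-∈ : ∀ xs {i} → i < length xs → nth xs i ∈ xs
nth-∈ (x ∷ xs) {zero}  _        = here refl
nth-∈ (x ∷ xs) {suc i} (s≤s i<) = there (nth-∈ xs i<)

nth-injective : ∀ xs → distinct xs ≡ true → ∀ {i j} → i < length xs → j < length xs → nth xs i ≡ nth xs j → i ≡ j
nth-injective (x ∷ xs) d {zero}  {zero}  _ _ _ = refl
nth-injective (x ∷ xs) d {zero}  {suc j} _ (s≤s j<) e =
  ⊥-elim (∉ᵇ⇒∉ (not-true (proj₁ (∧-true {not (x ∈ᵇ xs)} d))) (subst (_∈ xs) (sym e) (nth-∈ xs j<)))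
nth-injective (x ∷ xs) d {suc i} {zero}  (s≤s i<) _ e =
  ⊥-elim (∉ᵇ⇒∉ (not-true (proj₁ (∧-true {not (x ∈ᵇ xs)} d))) (subst (_∈ xs) e (nth-∈ xs i<)))
nth-injective (x ∷ xs) d {suc i} {suc j} (s≤s i<) (s≤s j<) e =
  cong suc (nth-injective xs (proj₂ (∧-true {not (x ∈ᵇ xs)} d)) i< j< e)

vertex-∈ : ∀ P {i} → i < length P → vertex P i ∈ P
vertex-∈ (x ∷ P) {zero}  _        = here refl
vertex-∈ (x ∷ P) {suc i} (s≤s i<) = there (vertex-∈ P i<)

record Image (P : Pattern) (mp : List ℕ) (v : Vertex) (c : ℕ) : Set where
  field
    fit  : proj₁ v ≡ 0 ⊎ known P c ≡ proj₁ v
    join : ∀ {s} → s ∈ proj₂ v → nth mp s ∈ nbrs P c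
    c<   : c < length P

mapOK-correct : ∀ P mp R cs → mapOK P mp R cs ≡ true →
                length cs ≡ length R × (∀ {i} → i < length R → Image P mp (vertex R i) (nth cs i))
mapOK-correct P mp [] [] _ = refl , λ ()
mapOK-correct P mp ((d , N) ∷ R) (c ∷ cs) e with ∧-true {(d ≡ᵇ 0) ∨ (known P c ≡ᵇ d)} e
... | f , e₁ with ∧-true {all (λ s → nth mp s ∈ᵇ nbrs P c) N} e₁
...   | j , e₂ with ∧-true {c <ᵇ length P} e₂
...     | b , e₃ with mapOK-correct P mp R cs e₃
...       | len , im = cong suc len , λ { {zero} _ → first ; {suc i} (s≤s i<) → im i< }
  where
  first : Image P mp (d , N) c
  first = record
    { fit  = [ inj₁ ∘ ≡ᵇ-true , inj₂ ∘ ≡ᵇ-true ]′ (∨-true {d ≡ᵇ 0} f)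
    ; join = λ s∈ → ∈ᵇ⇒∈ _ (all-true (λ s → nth mp s ∈ᵇ nbrs P c) j s∈)
    ; c<   = <ᵇ-true b }

-- δ marks the vertices of a special component that have a neighbour in X; such a vertex has degree
-- 3 in W. The result is the shape of the component inside W, one of the `variants`.
apply : (ℕ → Bool) → Pattern → Pattern
apply δ []            = []
apply δ ((d , N) ∷ Q) = ((if δ 0 then 3 else d) , N) ∷ apply (δ ∘ suc) Q

count : (ℕ → Bool) → ℕ → ℕ
count δ zero    = 0
count δ (suc m) = (if δ 0 then suc else id) (count (δ ∘ suc) m)

∈-extend : ∀ d N k R b → (b ≡ true → d ≡ 2) →
           ((if b then suc else id) k , ((if b then 3 else d) , N) ∷ R) ∈ extend (d , N) (k , R)
∈-extend d N k R false _ = here refl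
∈-extend d N k R true  h with h refl
... | refl = there (here refl)

apply∈variants : ∀ Q δ → (∀ {i} → i < length Q → δ i ≡ true → known Q i ≡ 2) →
                 (count δ (length Q) , apply δ Q) ∈ variants Q
apply∈variants [] δ h = here refl
apply∈variants ((d , N) ∷ Q) δ h =
  ∈-concatMap⁺ (extend (d , N)) (lose (apply∈variants Q (δ ∘ suc) (h ∘ s≤s)) (∈-extend d N _ _ (δ 0) (h (s≤s z≤n))))

length-apply : ∀ δ Q → length (apply δ Q) ≡ length Q
length-apply δ []      = refl
length-apply δ (_ ∷ Q) = cong suc (length-apply (δ ∘ suc) Q)

vertex-apply : ∀ δ Q {i} → i < length Q → vertex (apply δ Q) i ≡ ((if δ i then 3 else known Q i) , nbrs Q i)
vertex-apply δ (_ ∷ Q) {zero}  _        = refl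
vertex-apply δ (_ ∷ Q) {suc i} (s≤s i<) = vertex-apply (δ ∘ suc) Q i<

module _ {n : ℕ} (G : Graph n) where

  module _ {W : VSet G} {P : Pattern} {σ : ℕ → Fin n} (E : Emb G W P σ) where
    open Emb E

    emb-setDegree : ∀ {i} → i < length P → Emb G W (update P i (setDegree (deg G W (σ i)))) σ
    emb-setDegree {i} i< = record
      { inj = λ j< k< → inj (fit j<) (fit k<)
      ; mem = mem ∘ fit
      ; bnd = λ {j} j< k∈ → subst (_ <_) (sym len) (bnd (fit j<) (subst (_ ∈_) (nbrs-same j) k∈))
      ; edg = λ {j} j< k∈ → edg (fit j<) (subst (_ ∈_) (nbrs-same j) k∈)
      ; dgr = λ {j} j< → degree j (fit j<) }
      where
      f = setDegree (deg G W (σ i))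
      len = length-update P i f
      fit : ∀ {j} → j < length (update P i f) → j < length P
      fit = subst (_ <_) len
      nbrs-same : ∀ j → nbrs (update P i f) j ≡ nbrs P j
      nbrs-same j with j ℕ.≟ i
      ... | yes refl = cong proj₂ (vertex-update P f i<)
      ... | no ne    = cong proj₂ (vertex-update-≢ P f ne)
      degree : ∀ j → j < length P → known (update P i f) j ≡ 0 ⊎ deg G W (σ j) ≡ known (update P i f) j
      degree j j< with j ℕ.≟ i
      ... | yes refl = inj₂ (sym (cong proj₁ (vertex-update P f i<)))
      ... | no ne    = subst (λ v → proj₁ v ≡ 0 ⊎ deg G W (σ j) ≡ proj₁ v) (sym (vertex-update-≢ P f ne)) (dgr j<)

    emb-addNbr : ∀ {i j} → i < length P → j < length P → Adj G (σ i) (σ j) ≡ true → Emb G W (update P i (addNbr j)) σ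
    emb-addNbr {i} {j} i< j< a = record
      { inj = λ k< l< → inj (fit k<) (fit l<)
      ; mem = mem ∘ fit
      ; bnd = λ {k} k< l∈ → subst (_ <_) (sym len) ([ (λ { refl → j< }) , bnd (fit k<) ]′ (nbrs-new k l∈))
      ; edg = λ {k} k< l∈ → edge k (fit k<) l∈
      ; dgr = λ {k} k< → subst (λ d → d ≡ 0 ⊎ deg G W (σ k) ≡ d) (sym (known-same k)) (dgr (fit k<)) }
      where
      f = addNbr j
      len = length-update P i f
      fit : ∀ {k} → k < length (update P i f) → k < length P
      fit = subst (_ <_) len
      known-same : ∀ k → known (update P i f) k ≡ known P k
      known-same k with k ℕ.≟ i
      ... | yes refl = cong proj₁ (vertex-update P f i<)
      ... | no ne    = cong proj₁ (vertex-update-≢ P f ne)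
      nbrs-new : ∀ k {l} → l ∈ nbrs (update P i f) k → l ≡ j ⊎ l ∈ nbrs P k
      nbrs-new k {l} l∈ with k ℕ.≟ i
      ... | no ne = inj₂ (subst (l ∈_) (cong proj₂ (vertex-update-≢ P f ne)) l∈)
      ... | yes refl with subst (l ∈_) (cong proj₂ (vertex-update P f i<)) l∈
      ...   | here e   = inj₁ e
      ...   | there l∈ = inj₂ l∈
      edge : ∀ k → k < length P → ∀ {l} → l ∈ nbrs (update P i f) k → Adj G (σ k) (σ l) ≡ true
      edge k k< {l} l∈ with k ℕ.≟ i
      ... | no ne = edg k< (subst (l ∈_) (cong proj₂ (vertex-update-≢ P f ne)) l∈)
      ... | yes refl with subst (l ∈_) (cong proj₂ (vertex-update P f i<)) l∈
      ...   | here refl = a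
      ...   | there l∈  = edg k< l∈

  emb-oldNbr : ∀ {W P σ} → Emb G W P σ → ∀ {i j} → i < length P → j < length P → Adj G (σ i) (σ j) ≡ true →
               Emb G W (oldNbr P i j) σ
  emb-oldNbr {P = P} E {i} {j} i< j< a =
    emb-addNbr (emb-addNbr E i< j< a) (subst (j <_) (sym len) j<) (subst (i <_) (sym len) i<) (adj-sym G a)
    where len = length-update P i (addNbr j)

  override : (ℕ → Fin n) → ℕ → Fin n → ℕ → Fin n
  override σ m w k with k ℕ.≟ m
  ... | yes _ = w
  ... | no  _ = σ k

  override-≡ : ∀ σ m w → override σ m w m ≡ w
  override-≡ σ m w with m ℕ.≟ m
  ... | yes _ = refl
  ... | no ne = ⊥-elim (ne refl)

  override-< : ∀ σ m w {k} → k < m → override σ m w k ≡ σ k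
  override-< σ m w {k} k< with k ℕ.≟ m
  ... | yes e = ⊥-elim (<⇒≢ k< e)
  ... | no _  = refl

  update-++ : ∀ P Q {i} f → i < length P → update (P ++ Q) i f ≡ update P i f ++ Q
  update-++ (x ∷ P) Q {zero}  f _        = refl
  update-++ (x ∷ P) Q {suc i} f (s≤s i<) = cong (x ∷_) (update-++ P Q f i<)

  emb-newNbr : ∀ {W P σ} → Emb G W P σ → ∀ {i w} → i < length P → W w ≡ true → Adj G (σ i) w ≡ true →
               (∀ {j} → j < length P → w ≢ σ j) → Emb G W (newNbr P i) (override σ (length P) w)
  emb-newNbr {W} {P} {σ} E {i} {w} i< Ww a new =
    subst (λ R → Emb G W R τ) (update-++ P _ (addNbr m) i<)
      (emb-addNbr E₁ (subst (i <_) (sym len) (m≤n⇒m≤1+n i<)) (subst (m <_) (sym len) ≤-refl)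
        (subst₂ (λ x y → Adj G x y ≡ true) (sym (override-< σ m w i<)) (sym (override-≡ σ m w)) a))
    where
    open Emb E
    m = length P
    τ = override σ m w
    P₁ = P ++ (0 , i ∷ []) ∷ []
    len : length P₁ ≡ suc m
    len = trans (length-++ P) (+-comm m 1)
    split : ∀ {k} → k < length P₁ → k < m ⊎ k ≡ m
    split k< = m≤n⇒m<n∨m≡n (≤-pred (subst (_ <_) len k<))
    old : ∀ {k} → k < m → vertex P₁ k ≡ vertex P k
    old = vertex-++ˡ P _
    inj₁₁ : ∀ {j k} → j < m ⊎ j ≡ m → k < m ⊎ k ≡ m → τ j ≡ τ k → j ≡ k
    inj₁₁ (inj₁ j<)   (inj₁ k<)   e = inj j< k< (trans (sym (override-< σ m w j<)) (trans e (override-< σ m w k<)))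
    inj₁₁ (inj₁ j<)   (inj₂ refl) e = ⊥-elim (new j< (trans (sym (override-≡ σ m w)) (trans (sym e) (override-< σ m w j<))))
    inj₁₁ (inj₂ refl) (inj₁ k<)   e = ⊥-elim (new k< (trans (sym (override-≡ σ m w)) (trans e (override-< σ m w k<))))
    inj₁₁ (inj₂ refl) (inj₂ refl) e = refl
    mem₁ : ∀ {j} → j < m ⊎ j ≡ m → W (τ j) ≡ true
    mem₁ (inj₁ j<)   = trans (cong W (override-< σ m w j<)) (mem j<)
    mem₁ (inj₂ refl) = trans (cong W (override-≡ σ m w)) Ww
    bnd₁ : ∀ {j} → j < m ⊎ j ≡ m → ∀ {k} → k ∈ nbrs P₁ j → k < m
    bnd₁ {j} (inj₁ j<) {k} k∈ = bnd j< (subst (λ v → k ∈ proj₂ v) (old j<) k∈)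
    bnd₁ (inj₂ refl) {k} k∈ with subst (λ v → k ∈ proj₂ v) (vertex-++ʳ P _) k∈
    ... | here refl = i<
    edg₁ : ∀ {j} → j < m ⊎ j ≡ m → ∀ {k} → k ∈ nbrs P₁ j → Adj G (τ j) (σ k) ≡ true
    edg₁ {j} (inj₁ j<) {k} k∈ = subst (λ x → Adj G x (σ k) ≡ true) (sym (override-< σ m w j<))
      (edg j< (subst (λ v → k ∈ proj₂ v) (old j<) k∈))
    edg₁ (inj₂ refl) {k} k∈ with subst (λ v → k ∈ proj₂ v) (vertex-++ʳ P _) k∈
    ... | here refl = subst (λ x → Adj G x (σ i) ≡ true) (sym (override-≡ σ m w)) (adj-sym G a)
    dgr₁ : ∀ {j} → j < m ⊎ j ≡ m → known P₁ j ≡ 0 ⊎ deg G W (τ j) ≡ known P₁ j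
    dgr₁ {j} (inj₁ j<) = subst₂ (λ v x → proj₁ v ≡ 0 ⊎ deg G W x ≡ proj₁ v) (sym (old j<)) (sym (override-< σ m w j<)) (dgr j<)
    dgr₁ (inj₂ refl) = inj₁ (cong proj₁ (vertex-++ʳ P _))
    E₁ : Emb G W P₁ τ
    E₁ = record
      { inj = λ j< k< → inj₁₁ (split j<) (split k<)
      ; mem = mem₁ ∘ split
      ; bnd = λ j< k∈ → subst (_ <_) (sym len) (m≤n⇒m≤1+n (bnd₁ (split j<) k∈))
      ; edg = λ {j} j< {k} k∈ → subst (λ x → Adj G (τ j) x ≡ true) (sym (override-< σ m w (bnd₁ (split j<) k∈))) (edg₁ (split j<) k∈)
      ; dgr = dgr₁ ∘ split }

  emb-apply : ∀ {W W′ Q τ} → Emb G W′ Q τ → (∀ {v} → W′ v ≡ true → W v ≡ true) → ∀ δ →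
              (∀ {i} → i < length Q → deg G W (τ i) ≡ (if δ i then 3 else known Q i)) → Emb G W (apply δ Q) τ
  emb-apply {W} {Q = Q} {τ} E sub δ degrees = record
    { inj = λ i< j< → inj (fit i<) (fit j<)
    ; mem = sub ∘ mem ∘ fit
    ; bnd = λ i< j∈ → subst (_ <_) (sym len) (bnd (fit i<) (subst (_ ∈_) (cong proj₂ (vertex-apply δ Q (fit i<))) j∈))
    ; edg = λ i< j∈ → edg (fit i<) (subst (_ ∈_) (cong proj₂ (vertex-apply δ Q (fit i<))) j∈)
    ; dgr = λ i< → inj₂ (trans (degrees (fit i<)) (sym (cong proj₁ (vertex-apply δ Q (fit i<))))) }
    where
    open Emb E
    len = length-apply δ Q
    fit : ∀ {i} → i < length (apply δ Q) → i < length Q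
    fit = subst (_ <_) len

  contains-correct : ∀ {W P σ} → Emb G W P σ → ∀ R → contains P R ≡ true → ∃ λ τ → Emb G W R τ
  contains-correct {W} {P} {σ} E R c with findMap P 0 R []
  ... | just mp with ∧-true {bounded R} c
  ...   | b , c₁ with ∧-true {distinct mp} c₁
  ...     | d , ok with mapOK-correct P mp R mp ok
  ...       | len , im = σ ∘ nth mp , record
    { inj = λ i< j< e → nth-injective mp d (fit i<) (fit j<) (inj (Image.c< (im i<)) (Image.c< (im j<)) e)
    ; mem = λ i< → mem (Image.c< (im i<))
    ; bnd = λ i< j∈ → <ᵇ-true (all-true (_<ᵇ length R) (all-true (λ v → all (_<ᵇ length R) (proj₂ v)) b (vertex-∈ R i<)) j∈)
    ; edg = λ i< j∈ → edg (Image.c< (im i<)) (Image.join (im i<) j∈)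
    ; dgr = λ {i} i< → degree i i< }
    where
    open Emb E
    fit : ∀ {i} → i < length R → i < length mp
    fit = subst (_ <_) (sym len)
    degree : ∀ i → i < length R → known R i ≡ 0 ⊎ deg G W (σ (nth mp i)) ≡ known R i
    degree i i< with Image.fit (im i<)
    ... | inj₁ z = inj₁ z
    ... | inj₂ e with dgr (Image.c< (im i<))
    ...   | inj₁ z = inj₁ (trans (sym e) z)
    ...   | inj₂ q = inj₂ (trans q e)

  unmatched : ∀ {W P σ} → Emb G W P σ → ∀ {i} → i < length P → good P i ≡ true → length (nbrs P i) < deg G W (σ i) →
              ∃ λ w → W w ≡ true × Adj G (σ i) w ≡ true × w ∉ map σ (nbrs P i)
  unmatched {W} {P} {σ} E {i} i< g lt with All.all? (λ w → _∈?_ _≟_ w (map σ (nbrs P i))) (nb G W (σ i))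
  ... | yes all = ⊥-elim (<⇒≱ lt (subst (deg G W (σ i) ≤_) (length-map σ (nbrs P i))
                    (length-⊆ _≟_ (nb-unique G W (σ i)) (good-unique G E i< g) (All.lookup all))))
  ... | no ¬all with find (¬All⇒Any¬ (λ w → _∈?_ _≟_ w (map σ (nbrs P i))) _ ¬all)
  ...   | w , w∈ , w∉ with ∈-nb⁻ G W w∈
  ...     | a , Ww = w , Ww , a , w∉

  emb? : ∀ W Q τ → Dec (Emb G W Q τ)
  emb? W Q τ with allUpTo? (λ i → allUpTo? (λ j → inj? i j) m) m
                | allUpTo? (λ i → W (τ i) ≟ᵇ true) m
                | allUpTo? (λ i → All.all? (λ j → j <? m) (nbrs Q i)) m
                | allUpTo? (λ i → All.all? (λ j → Adj G (τ i) (τ j) ≟ᵇ true) (nbrs Q i)) m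
                | allUpTo? (λ i → known-or i) m
    where
    m = length Q
    inj? : ∀ i j → Dec (τ i ≡ τ j → i ≡ j)
    inj? i j with τ i ≟ τ j | i ℕ.≟ j
    ... | _     | yes e = yes (λ _ → e)
    ... | no ne | no _  = yes (λ e → ⊥-elim (ne e))
    ... | yes e | no ne = no (λ f → ne (f e))
    known-or : ∀ i → Dec (known Q i ≡ 0 ⊎ deg G W (τ i) ≡ known Q i)
    known-or i with known Q i ℕ.≟ 0 | deg G W (τ i) ℕ.≟ known Q i
    ... | yes z | _     = yes (inj₁ z)
    ... | no _  | yes e = yes (inj₂ e)
    ... | no a  | no b  = no [ a , b ]′
  ... | yes a | yes b | yes c | yes d | yes e = yes (record
    { inj = λ i< j< → a i< j< ; mem = b ; bnd = λ i< → All.lookup (c i<) ; edg = λ i< → All.lookup (d i<) ; dgr = e })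
  ... | no a | _ | _ | _ | _ = no (λ E → a (λ i< j< → Emb.inj E i< j<))
  ... | _ | no b | _ | _ | _ = no (λ E → b (Emb.mem E))
  ... | _ | _ | no c | _ | _ = no (λ E → c (λ i< → All.tabulate (Emb.bnd E i<)))
  ... | _ | _ | _ | no d | _ = no (λ E → d (λ i< → All.tabulate (Emb.edg E i<)))
  ... | _ | _ | _ | _ | no e = no (λ E → e (Emb.dgr E))

  -- Whether a special component with a given property exists has to be decided constructively. As
  -- `emb?` decides whether a given list of vertices is one, trying all lists of the right length is
  -- enough.
  searchList : ∀ k {Q : List (Fin n) → Set} → (∀ vs → Dec (Q vs)) → Dec (∃ λ vs → length vs ≡ k × Q vs)
  searchList zero Q? with Q? []
  ... | yes q = yes ([] , refl , q)
  ... | no ¬q = no λ { ([] , _ , q) → ¬q q }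
  searchList (suc k) Q? with any? (λ v → searchList k (λ vs → Q? (v ∷ vs)))
  ... | yes (v , vs , l , q) = yes (v ∷ vs , cong suc l , q)
  ... | no ¬q = no λ { (v ∷ vs , l , q) → ¬q (v , vs , suc-injective l , q) }

-- Soundness of the checker

-- In the use made of it, a failing test is no contradiction: it points to a configuration from
-- which the goal follows.
all-or : ∀ {A : Set} {Goal : Set} (p : A → Bool) xs → (∀ {x} → x ∈ xs → p x ≡ false → Goal) → Goal ⊎ all p xs ≡ true
all-or p []       h = inj₂ refl
all-or p (x ∷ xs) h with p x in e
... | false = inj₁ (h (here refl) e)
... | true  = all-or p xs (h ∘ there)

below-or : ∀ {Goal : Set} {Q : ℕ → Set} m → (∀ {i} → i < m → Goal ⊎ Q i) → Goal ⊎ (∀ {i} → i < m → Q i)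
below-or zero    h = inj₂ λ ()
below-or (suc m) h with h ≤-refl | below-or m (h ∘ m≤n⇒m≤1+n)
... | inj₁ g | _      = inj₁ g
... | inj₂ _ | inj₁ g = inj₁ g
... | inj₂ q | inj₂ f = inj₂ λ i< → [ f , (λ { refl → q }) ]′ (m≤n⇒m<n∨m≡n (≤-pred i<))

count-mono : ∀ {δ ε} m → (∀ {i} → i < m → δ i ≡ true → ε i ≡ true) → count δ m ≤ count ε m
count-mono zero h = z≤n
count-mono {δ} {ε} (suc m) h with δ 0 in d | ε 0 in e
... | false | false = count-mono m (h ∘ s≤s)
... | false | true  = m≤n⇒m≤1+n (count-mono m (h ∘ s≤s))
... | true  | true  = s≤s (count-mono m (h ∘ s≤s))
... | true  | false = ⊥-elim (true≢false (h (s≤s z≤n) d) e)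

positive-≤3 : ∀ d → d ≤ 3 → d ≡ 0 ⊎ d ∈ (1 ∷ 2 ∷ 3 ∷ [])
positive-≤3 0 _ = inj₁ refl
positive-≤3 1 _ = inj₂ (here refl)
positive-≤3 2 _ = inj₂ (there (here refl))
positive-≤3 3 _ = inj₂ (there (there (here refl)))
positive-≤3 (suc (suc (suc (suc d)))) (s≤s (s≤s (s≤s ())))

if-just : ∀ {A : Set} b {x y : Maybe A} {z} → (if b then x else y) ≡ just z →
          (b ≡ true × x ≡ just z) ⊎ (b ≡ false × y ≡ just z)
if-just true  e = inj₁ (refl , e)
if-just false e = inj₂ (refl , e)

guard-true : ∀ {b ts ts′} → guard b ts ≡ just ts′ → b ≡ true
guard-true {true} _ = refl

special : List Pattern
special = C5 ∷ D6 ∷ []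

special-closed : ∀ {Q} → Q ∈ special → all (closed Q) (upTo (length Q)) ≡ true
special-closed (here refl)         = refl
special-closed (there (here refl)) = refl

special-known : ∀ {Q} → Q ∈ special → all (λ v → (proj₁ v ≡ᵇ 2) ∨ (proj₁ v ≡ᵇ 3)) Q ≡ true
special-known (here refl)         = refl
special-known (there (here refl)) = refl

module _ {n : ℕ} (G : Graph n) (v₀ : Fin n) where

  -- The default `v₀` only makes `at` total; it is never read below the length of the list.
  at : List (Fin n) → ℕ → Fin n
  at []       _       = v₀
  at (v ∷ _)  zero    = v
  at (_ ∷ vs) (suc i) = at vs i

  at-∈ : ∀ vs {i} → i < length vs → at vs i ∈ vs
  at-∈ (v ∷ vs) {zero}  _        = here refl
  at-∈ (v ∷ vs) {suc i} (s≤s i<) = there (at-∈ vs i<)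

  ∈-at : ∀ {vs v} → v ∈ vs → ∃ λ i → i < length vs × v ≡ at vs i
  ∈-at (here refl) = 0 , s≤s z≤n , refl
  ∈-at (there v∈) with ∈-at v∈
  ... | i , i< , e = suc i , s≤s i< , e

  length-filterᵇ-at : ∀ (p : Fin n → Bool) vs → length (filterᵇ p vs) ≡ count (p ∘ at vs) (length vs)
  length-filterᵇ-at p []       = refl
  length-filterᵇ-at p (v ∷ vs) with p v
  ... | true  = cong suc (length-filterᵇ-at p vs)
  ... | false = length-filterᵇ-at p vs

  -- All vertices of C5 and D6 are closed, so an occurrence of them in W is a whole component of
  -- G[W]; this is `special-closure`. A component is represented by the list of its vertices in the
  -- order of the pattern.
  Special : VSet G → Pattern → List (Fin n) → Set
  Special W Q K = length K ≡ length Q × Emb G W Q (at K)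

  special-closure : ∀ {W Q K} → Q ∈ special → Special W Q K → ∀ {u v} → u ∈ K → W v ≡ true → Adj G u v ≡ true → v ∈ K
  special-closure {W} {Q} {K} q∈ (len , E) u∈ w a with ∈-at u∈
  ... | i , i< , refl with closure G E (subst (i <_) len i<) (all-true (closed Q) (special-closed q∈) (∈-upTo⁺ (subst (i <_) len i<))) w a
  ...   | j , _ , j< , refl = at-∈ K (subst (j <_) (sym len) j<)

  special-⊆ : ∀ {W Q K} → Special W Q K → ∀ {u} → u ∈ K → W u ≡ true
  special-⊆ (len , E) u∈ with ∈-at u∈
  ... | i , i< , refl = Emb.mem E (subst (i <_) len i<)

  Dominates : Fin n × Fin n → Fin n → Set
  Dominates (a , b) x = x ≡ a ⊎ x ≡ b ⊎ Adj G a x ≡ true ⊎ Adj G b x ≡ true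

  module _ {W P σ} (E : Emb G W P σ) where
    open Emb E

    isEdge-true : ∀ {F e} → all (isEdge P) F ≡ true → e ∈ F → proj₁ e < length P × proj₂ e ∈ nbrs P (proj₁ e)
    isEdge-true {e = (a , b)} ok e∈ with ∧-true {a <ᵇ length P} (all-true (isEdge P) ok e∈)
    ... | p , q = <ᵇ-true p , ∈ᵇ⇒∈ _ q

    covers-dominates : ∀ {F} → all (isEdge P) F ≡ true → ∀ {e x} → e ∈ F → covers P x e ≡ true →
                       Dominates (σ (proj₁ e) , σ (proj₂ e)) (σ x)
    covers-dominates {F} ok {a , b} {x} e∈ c with isEdge-true {F} ok e∈
    ... | a< , b∈ with ∨-true {x ≡ᵇ a} c
    ...   | inj₁ e = inj₁ (cong σ (≡ᵇ-true e))
    ...   | inj₂ c₁ with ∨-true {x ≡ᵇ b} c₁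
    ...     | inj₁ e = inj₂ (inj₁ (cong σ (≡ᵇ-true e)))
    ...     | inj₂ c₂ with ∨-true {x ∈ᵇ nbrs P a} c₂
    ...       | inj₁ m = inj₂ (inj₂ (inj₁ (edg a< (∈ᵇ⇒∈ _ m))))
    ...       | inj₂ m = inj₂ (inj₂ (inj₂ (edg (bnd a< b∈) (∈ᵇ⇒∈ _ m))))

  -- What the rest of the proof needs to know about a reduction, free of patterns. Special
  -- components are disjoint, so by `attached` there are at most |U| / (a + 1) of them, and `budget`
  -- reserves 15 for each.
  record Reduction (W : VSet G) : Set where
    field
      xs U     : List (Fin n)
      F        : List (Fin n × Fin n)
      a        : ℕ
      xs-uniq  : Unique xs
      U-uniq   : Unique U
      xs-sub   : ∀ {x} → x ∈ xs → W x ≡ true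
      F-edges  : ∀ {e} → e ∈ F → Adj G (proj₁ e) (proj₂ e) ≡ true
      F-some   : 0 < length F
      covered  : ∀ {x} → x ∈ xs → ∃ λ e → e ∈ F × Dominates e x
      attached : ∀ {Q K} → Q ∈ special → Special (_∖_ G W xs) Q K → suc a ≤ length (filterᵇ (member _≟_ U) K)
      budget   : 105 * length F + Φ G (_∖_ G W xs) + 15 * (length U / suc a) ≤ Φ G W

  module Soundness (cubic : Cubic G) (W : VSet G) (Goal : Set)
                   (isolated : ∀ v → W v ≡ true → deg G W v ≡ 0 → Goal)
                   (reduce : Reduction W → Goal) where

    -- This is the precise meaning of a settled pattern: later stages may assume that it does not
    -- occur, because otherwise `Goal` holds. Leaving `Goal` abstract allows the same soundness
    -- proof for W = V and for W ≠ V.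
    Reducible : Pattern → Set
    Reducible P = ∀ σ → Emb G W P σ → Goal

    resolved-goal : ∀ lib → (∀ {R} → R ∈ lib → Reducible R) → ∀ {P σ} → Emb G W P σ → resolved lib P ≡ true → Goal
    resolved-goal lib reducible {P} E ok with any-true (contains P) lib ok
    ... | R , R∈ , c with contains-correct G E R c
    ...   | τ , ER = reducible R∈ τ ER

    pair : Fin n → Fin n → ℕ → Fin n
    pair u v zero    = u
    pair u v (suc _) = v

    emb-pair : ∀ {u v} → W u ≡ true → W v ≡ true → Adj G u v ≡ true →
               Emb G W ((deg G W u , 1 ∷ []) ∷ (deg G W v , 0 ∷ []) ∷ []) (pair u v)
    emb-pair {u} {v} wu wv a = record { inj = inj ; mem = mem ; bnd = bnd ; edg = edg ; dgr = dgr }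
      where
      P = (deg G W u , 1 ∷ []) ∷ (deg G W v , 0 ∷ []) ∷ []
      inj : ∀ {i j} → i < 2 → j < 2 → pair u v i ≡ pair u v j → i ≡ j
      inj {0} {0} _ _ _ = refl
      inj {0} {1} _ _ e = ⊥-elim (adj-irrefl G a e)
      inj {1} {0} _ _ e = ⊥-elim (adj-irrefl G a (sym e))
      inj {1} {1} _ _ _ = refl
      inj {suc (suc _)} (s≤s (s≤s ())) _ _
      inj {_} {suc (suc _)} _ (s≤s (s≤s ())) _
      mem : ∀ {i} → i < 2 → W (pair u v i) ≡ true
      mem {0} _ = wu
      mem {1} _ = wv
      mem {suc (suc _)} (s≤s (s≤s ()))
      bnd : ∀ {i} → i < 2 → ∀ {j} → j ∈ nbrs P i → j < 2
      bnd {0} _ (here refl) = s≤s (s≤s z≤n)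
      bnd {1} _ (here refl) = s≤s z≤n
      bnd {suc (suc _)} (s≤s (s≤s ()))
      edg : ∀ {i} → i < 2 → ∀ {j} → j ∈ nbrs P i → Adj G (pair u v i) (pair u v j) ≡ true
      edg {0} _ (here refl) = a
      edg {1} _ (here refl) = adj-sym G a
      edg {suc (suc _)} (s≤s (s≤s ()))
      dgr : ∀ {i} → i < 2 → known P i ≡ 0 ⊎ deg G W (pair u v i) ≡ known P i
      dgr {0} _ = inj₂ refl
      dgr {1} _ = inj₂ refl
      dgr {suc (suc _)} (s≤s (s≤s ()))

    module Step (M : Mode)
                (pairs : ∀ {u v} → W u ≡ true → W v ≡ true → Adj G u v ≡ true →
                         compatible M (deg G W u) (deg G W v) ≡ false → Goal) where

      open Mode M

      module _ {P σ} (E : Emb G W P σ) where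
        open Emb E

        atLeast-true : ∀ {i} → i < length P → atLeast M P i (deg G W (σ i)) ≡ true
        atLeast-true {i} i< with good P i in g
        ... | true rewrite true-≤ᵇ (good-degree G E i< g) = refl
        ... | false with length (nbrs P i) ≤ᵇ deg G W (σ i)
        ...   | true  = refl
        ...   | false = refl

        -- Two adjacent vertices can fail to fit in two ways only: their degrees form an excluded
        -- pair, which `pairs` settles, or the neighbour is isolated in W.
        fits-or : ∀ {i t} → i < length P → t ∈ nbrs P i → fits M P (deg G W (σ i)) t ≡ false → Goal
        fits-or {i} {t} i< t∈ f with known P t ≡ᵇ 0 in z
        ... | false with dgr (bnd i< t∈)
        ...   | inj₁ k≡0 rewrite k≡0 = ⊥-elim (true≢false refl z)
        ...   | inj₂ e = pairs (mem i<) (mem (bnd i< t∈)) (edg i< t∈) (trans (cong (compatible M (deg G W (σ i))) e) f)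
        fits-or {i} {t} i< t∈ f | true with compatible M (deg G W (σ i)) (deg G W (σ t)) in c
        ... | false = pairs (mem i<) (mem (bnd i< t∈)) (edg i< t∈) c
        ... | true with positive-≤3 (deg G W (σ t)) (deg≤3 G cubic W (σ t))
        ...   | inj₁ z₀ = isolated (σ t) (mem (bnd i< t∈)) z₀
        ...   | inj₂ e∈ = ⊥-elim (true≢false (true-any (λ e → atLeast M P t e ∧ compatible M (deg G W (σ i)) e) e∈
                                   (cong₂ _∧_ (atLeast-true (bnd i< t∈)) c)) f)

        degree-or : ∀ {i} → i < length P → Goal ⊎ deg G W (σ i) ∈ degrees M P i
        degree-or {i} i< with known P i ≡ᵇ 0 in z
        ... | false with dgr i<
        ...   | inj₁ k≡0 rewrite k≡0 = ⊥-elim (true≢false refl z)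
        ...   | inj₂ e = inj₂ (here e)
        degree-or {i} i< | true with positive-≤3 (deg G W (σ i)) (deg≤3 G cubic W (σ i))
        ... | inj₁ z₀ = inj₁ (isolated (σ i) (mem i<) z₀)
        ... | inj₂ d∈ with all-or (fits M P (deg G W (σ i))) (nbrs P i) (fits-or i<)
        ...   | inj₁ g = inj₁ g
        ...   | inj₂ a = inj₂ (∈-filterᵇ⁺ (λ d → atLeast M P i d ∧ all (fits M P d) (nbrs P i)) d∈ (cong₂ _∧_ (atLeast-true i<) a))

        degrees-or : Goal ⊎ (∀ {i} → i < length P → deg G W (σ i) ∈ degrees M P i)
        degrees-or = below-or (length P) degree-or

      module Leaf (lib : List Pattern) (reducible : ∀ {R} → R ∈ lib → Reducible R)
                  (tamed : ∀ {Q} → Q ∈ special → specialOK lib M Q ≡ true)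
                  {P σ} (E : Emb G W P σ) (F : List (ℕ × ℕ)) (keep : List ℕ)
                  (edges : all (isEdge P) F ≡ true) (some : (0 <ᵇ length F) ≡ true)
                  (aff : affordable M P (removed P F keep) (length F) ≡ true)
                  (degs : ∀ {i} → i < length P → deg G W (σ i) ∈ degrees M P i) where

        X : List ℕ
        X = removed P F keep

        X-spec : ∀ {x} → x ∈ X → x ∈ upTo (length P) × any (covers P x) F ∧ closed P x ∧ not (x ∈ᵇ keep) ≡ true
        X-spec = ∈-filterᵇ⁻ (λ i → any (covers P i) F ∧ closed P i ∧ not (i ∈ᵇ keep)) {upTo (length P)}

        X-unique : Unique X
        X-unique = unique-filterᵇ _ (Unique.upTo⁺ (length P))

        X-below : ∀ {x} → x ∈ X → x < length P
        X-below x∈ = ∈-upTo⁻ (proj₁ (X-spec x∈))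

        X-closed : ∀ {x} → x ∈ X → closed P x ≡ true
        X-closed {x} x∈ = proj₁ (∧-true {closed P x} (proj₂ (∧-true {any (covers P x) F} (proj₂ (X-spec x∈)))))

        open Removal G M E X X-unique X-below X-closed degs

        U : List (Fin n)
        U = map σ (exposed M P X)

        U-unique : Unique U
        U-unique = unique-map σ (unique-filterᵇ _ (Unique.upTo⁺ (length P)))
          (λ x∈ y∈ → Emb.inj E (below x∈) (below y∈))
          where
          below : ∀ {x} → x ∈ exposed M P X → x < length P
          below x∈ = ∈-upTo⁻ (proj₁ (∈-filterᵇ⁻ (λ v → not (v ∈ᵇ X) ∧ not (lost P X v ≡ᵇ 0) ∧ not (safe M P X 2 v)) {upTo (length P)} x∈))

        hits : List (Fin n) → ℕ
        hits vs = length (filterᵇ (member _≟_ U) vs)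

        module _ {Q} (q∈ : Q ∈ special) {vs} (S : Special W′ Q vs) where

          private
            E′ = proj₂ S

          attachedTo : ℕ → Bool
          attachedTo i = not (deg G W (at vs i) ≡ᵇ deg G W′ (at vs i))

          deg′ : ∀ {i} → i < length Q → deg G W′ (at vs i) ≡ known Q i
          deg′ i< = closed-degree G E′ i< (all-true (closed Q) (special-closed q∈) (∈-upTo⁺ i<))

          deg-mono : ∀ v → deg G W′ v ≤ deg G W v
          deg-mono v = subst (deg G W′ v ≤_) (sym (deg-split v)) (m≤m+n _ _)

          attachedTo-≢ : ∀ {i} → attachedTo i ≡ true → deg G W (at vs i) ≢ deg G W′ (at vs i)
          attachedTo-≢ {i} d e = true≢false (trans (cong (deg G W (at vs i) ≡ᵇ_) (sym e)) (true-≡ᵇ (deg G W (at vs i)))) (not-true d)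

          -- Degrees in W are at most 3 and those in a special component are 2 or 3, so a vertex
          -- that has lost a neighbour went from 3 to 2.
          attachedTo-known : ∀ {i} → i < length Q → attachedTo i ≡ true → known Q i ≡ 2 × deg G W (at vs i) ≡ 3
          attachedTo-known {i} i< d
            with ∨-true {known Q i ≡ᵇ 2} (all-true (λ v → (proj₁ v ≡ᵇ 2) ∨ (proj₁ v ≡ᵇ 3)) (special-known q∈) (vertex-∈ Q i<))
          ... | inj₁ two   = ≡ᵇ-true two , ≤-antisym (deg≤3 G cubic W _)
                (subst (_< deg G W (at vs i)) (trans (deg′ i<) (≡ᵇ-true two)) (≤∧≢⇒< (deg-mono _) (attachedTo-≢ d ∘ sym)))
          ... | inj₂ three = ⊥-elim (attachedTo-≢ d (≤-antisym
                (subst (deg G W (at vs i) ≤_) (sym (trans (deg′ i<) (≡ᵇ-true three))) (deg≤3 G cubic W _)) (deg-mono _)))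

          deg-apply : ∀ {i} → i < length Q → deg G W (at vs i) ≡ (if attachedTo i then 3 else known Q i)
          deg-apply {i} i< = go (attachedTo i) refl
            where
            go : ∀ b → attachedTo i ≡ b → deg G W (at vs i) ≡ (if b then 3 else known Q i)
            go true  d = proj₂ (attachedTo-known i< d)
            go false d = trans (≡ᵇ-true (not-false d)) (deg′ i<)

          special-allowed : all (λ v → proj₁ v ∈ᵇ allowed) Q ≡ true → ∀ {v} → v ∈ vs → deg G W′ v ∈ allowed
          special-allowed al v∈ with ∈-at v∈
          ... | i , i< , refl = subst (_∈ allowed) (sym (deg′ i<Q)) (∈ᵇ⇒∈ _ (all-true (λ v → proj₁ v ∈ᵇ allowed) al (vertex-∈ Q i<Q)))
            where i<Q = subst (i <_) (proj₁ S) i<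

          attachedTo-hits : all (λ v → proj₁ v ∈ᵇ allowed) Q ≡ true → ∀ {i} → i < length vs → attachedTo i ≡ true →
                            member _≟_ U (at vs i) ≡ true
          attachedTo-hits al {i} i< d = member⁺ _≟_ {U} {at vs i}
            (exposed-correct vs (special-⊆ {W′} {Q} {vs} S) (special-closure {W′} {Q} {vs} q∈ S) (special-allowed al) {at vs i}
              (at-∈ vs i<) (attachedTo-≢ {i} d))

          attachments : all (λ v → proj₁ v ∈ᵇ allowed) Q ≡ true → count attachedTo (length Q) ≤ hits vs
          attachments al = begin
            count attachedTo (length Q)                      ≡⟨ cong (count attachedTo) (proj₁ S) ⟨
            count attachedTo (length vs)                     ≤⟨ count-mono {attachedTo} {λ i → member _≟_ U (at vs i)} (length vs) (attachedTo-hits al) ⟩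
            count (λ i → member _≟_ U (at vs i)) (length vs) ≡⟨ length-filterᵇ-at (member _≟_ U) vs ⟨
            hits vs                                          ∎
            where open ≤-Reasoning

          chosen : tame lib M Q (count attachedTo (length Q) , apply attachedTo Q) ≡ true
          chosen = all-true (tame lib M Q) {variants Q} (tamed q∈)
            (apply∈variants Q attachedTo (λ i< d → proj₁ (attachedTo-known i< d)))

          embedded : Emb G W (apply attachedTo Q) (at vs)
          embedded = emb-apply G {W} {W′} {Q} {at vs} E′ (λ {v} w → proj₁ (∖-true G W xs {v} w)) attachedTo deg-apply

          -- The shape of the component inside W is one of the `variants`, and `specialOK` has
          -- checked each of them: it has enough attached vertices, all of which are exposed as its
          -- degrees are allowed, or it contains a settled pattern.
          attached-or : Goal ⊎ suc attach-1 ≤ hits vs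
          attached-or = [ inj₂ ∘ many , inj₁ ∘ resolved-goal lib reducible embedded ]′
            (∨-true {(attach-1 <ᵇ count attachedTo (length Q)) ∧ all (λ v → proj₁ v ∈ᵇ allowed) Q}
                    {resolved lib (apply attachedTo Q)} chosen)
            where
            many : (attach-1 <ᵇ count attachedTo (length Q)) ∧ all (λ v → proj₁ v ∈ᵇ allowed) Q ≡ true → suc attach-1 ≤ hits vs
            many p = ≤-trans (<ᵇ-true {attach-1} {count attachedTo (length Q)} (proj₁ q)) (attachments (proj₂ q))
              where q = ∧-true {attach-1 <ᵇ count attachedTo (length Q)} {all (λ v → proj₁ v ∈ᵇ allowed) Q} p

        few : Pattern → List (Fin n) → Set
        few Q vs = Emb G W′ Q (at vs) × hits vs < suc attach-1

        few? : ∀ Q vs → Dec (few Q vs)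
        few? Q vs = emb? G W′ Q (at vs) ×-dec (hits vs <? suc attach-1)

        Attached : Pattern → Set
        Attached Q = ∀ K → Special W′ Q K → suc attach-1 ≤ hits K

        -- The search looks for a special component with too few exposed vertices; if there is one,
        -- then `attached-or` turns it into the goal.
        attached-all : ∀ {Q} → Q ∈ special → Goal ⊎ Attached Q
        attached-all {Q} q∈ = decide (searchList G (length Q) (few? Q))
          where
          decide : Dec (∃ λ vs → length vs ≡ length Q × few Q vs) → Goal ⊎ Attached Q
          decide (no none) = inj₂ λ K S → ≮⇒≥ (λ lt → none (K , proj₁ S , proj₂ S , lt))
          decide (yes (K , len , E′ , lt)) = [ inj₁ , (λ ge → ⊥-elim (<⇒≱ lt ge)) ]′ (attached-or {Q} q∈ {K} (len , E′))

        translate : ℕ × ℕ → Fin n × Fin n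
        translate e = σ (proj₁ e) , σ (proj₂ e)

        reduction : (∀ {Q K} → Q ∈ special → Special W′ Q K → suc attach-1 ≤ hits K) → Reduction W
        reduction att = record
          { xs = xs ; U = U ; F = map translate F ; a = attach-1 ; xs-uniq = xs-unique ; U-uniq = U-unique ; xs-sub = xs-⊆
          ; F-edges = λ e∈ → edge (∈-map⁻ translate e∈)
          ; F-some = subst (0 <_) (sym (length-map translate F)) (<ᵇ-true some)
          ; covered = λ x∈ → cover (∈-map⁻ σ x∈)
          ; attached = λ {Q} {K} → att {Q} {K}
          ; budget = subst₂ (λ k u → 105 * k + Φ G W′ + 15 * (u / suc attach-1) ≤ Φ G W)
                       (sym (length-map translate F)) (sym (length-map σ (exposed M P X))) (drop (length F) aff) }
          where
          edge : ∀ {e} → (∃ λ f → f ∈ F × e ≡ translate f) → Adj G (proj₁ e) (proj₂ e) ≡ true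
          edge (f , f∈ , refl) = Emb.edg E (proj₁ ends) (proj₂ ends)
            where ends = isEdge-true E {F} edges f∈
          cover : ∀ {y} → (∃ λ x → x ∈ X × y ≡ σ x) → ∃ λ e → e ∈ map translate F × Dominates e y
          cover (x , x∈ , refl) with any-true (covers P x) F (proj₁ (∧-true {any (covers P x) F} (proj₂ (X-spec x∈))))
          ... | e , e∈ , c = translate e , ∈-map⁺ translate e∈ , covers-dominates E edges e∈ c

        leaf-goal : Goal
        leaf-goal = [ id , (λ c → [ id , finish c ]′ (attached-all (there (here refl)))) ]′ (attached-all (here refl))
          where
          finish : Attached C5 → Attached D6 → Goal
          finish c d = reduce (reduction λ { {K = K} (here refl) → c K ; {K = K} (there (here refl)) → d K })

    module _ (M : Mode)
             (pairs : ∀ {u v} → W u ≡ true → W v ≡ true → Adj G u v ≡ true →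
                      compatible M (deg G W u) (deg G W v) ≡ false → Goal)
             (lib : List Pattern) (reducible : ∀ {R} → R ∈ lib → Reducible R)
             (tamed : ∀ {Q} → Q ∈ special → specialOK lib M Q ≡ true) where

      open Step M pairs

      leafOK-sound : ∀ {P} F keep → leafOK M P F (removed P F keep) ≡ true → Reducible P
      leafOK-sound {P} F keep ok σ E = [ id , Leaf.leaf-goal lib reducible tamed E F keep (proj₁ q) (proj₁ p) (proj₂ q) ]′ (degrees-or E)
        where
        p = ∧-true {0 <ᵇ length F} {all (isEdge P) F ∧ affordable M P (removed P F keep) (length F)} ok
        q = ∧-true {all (isEdge P) F} {affordable M P (removed P F keep) (length F)} (proj₂ p)

      leafWith-sound : ∀ {P} F ts {ts′} → leafWith M lib P F ts ≡ just ts′ → Reducible P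
      leafWith-sound F (r ∷ ts) e = leafOK-sound F (proj₁ (takeList r ts)) (guard-true e)

      leaf-sound : ∀ {P} k ts {ts′} → leaf M lib P k ts ≡ just ts′ → Reducible P
      leaf-sound k ts = leafWith-sound (proj₁ (takeEdges k ts)) (proj₂ (takeEdges k ts))

      ∈-pick : ∀ {R} rs i → R ∈ pick rs i → R ∈ rs
      ∈-pick (r ∷ rs) zero    (here refl) = here refl
      ∈-pick (r ∷ rs) (suc i) R∈          = there (∈-pick rs i R∈)

      known-sound : ∀ {P} rs → (∀ {R} → R ∈ rs → Reducible R) → any (contains P) rs ≡ true → Reducible P
      known-sound {P} rs red ok σ E with any-true (contains P) rs ok
      ... | R , R∈ , c with contains-correct G E R c
      ...   | τ , ER = red R∈ τ ER

      degree-sound : ∀ {P i} → i < length P → (∀ {R} → R ∈ degreeChildren M P i → Reducible R) → Reducible P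
      degree-sound {P} {i} i< red σ E with degree-or E i<
      ... | inj₁ g  = g
      ... | inj₂ d∈ = red (∈-map⁺ (λ d → update P i (setDegree d)) d∈) σ (emb-setDegree G E i<)

      -- The degree of `i` exceeds the number of its listed neighbours, so W contains a neighbour
      -- that is not listed. It lies outside the occurrence, or it is an old vertex; in the latter
      -- case `joinable` holds, as it rejects only what a closed vertex, a loop or a repetition
      -- rules out.
      nbr-sound : ∀ {P i} → i < length P → (known P i ≡ᵇ 0) ≡ false → (length (nbrs P i) <ᵇ known P i) ∧ good P i ≡ true →
                  (∀ {R} → R ∈ nbrChildren P i → Reducible R) → Reducible P
      nbr-sound {P} {i} i< k≢0 c red σ E with ∧-true {length (nbrs P i) <ᵇ known P i} c
      ... | lt , g with Emb.dgr E i<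
      ...   | inj₁ z rewrite z = ⊥-elim (true≢false refl k≢0)
      ...   | inj₂ d with unmatched G E i< g (subst (length (nbrs P i) <_) (sym d) (<ᵇ-true lt))
      ...     | w , Ww , a , w∉ with _∈?_ _≟_ w (map σ (upTo (length P)))
      ...       | no new = red (∈-++⁺ʳ _ (here refl)) _
                    (emb-newNbr G E i< Ww a (λ j< e → new (subst (_∈ map σ (upTo (length P))) (sym e) (∈-map⁺ σ (∈-upTo⁺ j<)))))
      ...       | yes old with ∈-map⁻ σ old
      ...         | j , j∈ , refl = red (∈-++⁺ˡ (∈-map⁺ (oldNbr P i) (∈-filterᵇ⁺ (joinable P i) j∈ joins))) σ (emb-oldNbr G E i< j< a)
        where
        j< = ∈-upTo⁻ j∈
        not-both : closed P j ∧ not (i ∈ᵇ nbrs P j) ≡ false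
        not-both with closed P j in cl
        ... | false = refl
        ... | true with closure G E j< cl (Emb.mem E i<) (adj-sym G a)
        ...   | k , k∈ , k< , eq rewrite ∈⇒∈ᵇ (subst (_∈ nbrs P j) (sym (Emb.inj E i< k< eq)) k∈) = refl
        not-self : (j ≡ᵇ i) ≡ false
        not-self with j ≡ᵇ i in ji
        ... | false = refl
        ... | true  = ⊥-elim (adj-irrefl G a (cong σ (sym (≡ᵇ-true ji))))
        joins : joinable P i j ≡ true
        joins rewrite not-self | ∉⇒∉ᵇ {j} {nbrs P i} (λ j∈N → w∉ (∈-map⁺ σ j∈N)) | not-both = refl

      mutual
        check-sound : ∀ f P ts {ts′} → check M lib f P ts ≡ just ts′ → Reducible P
        check-sound (suc f) P (t ∷ ts) e = [ query , conclude ]′ (if-just (t <ᵇ 25) e)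
          where
          conclude : _ → Reducible P
          conclude (_ , e₁) = [ (λ p → leaf-sound (t ∸ 25) ts (proj₂ p))
                              , (λ p → known-sound (pick lib (t ∸ 31)) (reducible ∘ ∈-pick lib (t ∸ 31)) (guard-true (proj₂ p))) ]′
                              (if-just (t <ᵇ 31) e₁)
          expand : t < length P → _ → Reducible P
          expand t< (k , e₃) = [ (λ p → nbr-sound t< k (proj₁ p) (checkAll-sound f _ ts (proj₂ p))) , (λ { (_ , ()) }) ]′
                               (if-just ((length (nbrs P t) <ᵇ known P t) ∧ good P t) e₃)
          visit : _ → Reducible P
          visit (t< , e₂) = [ (λ p → degree-sound (<ᵇ-true t<) (checkAll-sound f _ ts (proj₂ p))) , expand (<ᵇ-true t<) ]′
                             (if-just (known P t ≡ᵇ 0) e₂)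
          query : _ → Reducible P
          query (_ , e₁) = [ visit , (λ { (_ , ()) }) ]′ (if-just (t <ᵇ length P) e₁)

        checkAll-sound : ∀ f Ps ts {ts′} → checkAll M lib f Ps ts ≡ just ts′ → ∀ {P} → P ∈ Ps → Reducible P
        checkAll-sound f (P ∷ Ps) ts e R∈ with check M lib f P ts in eq
        checkAll-sound f (P ∷ Ps) ts e (here refl) | just us = check-sound f P ts eq
        checkAll-sound f (P ∷ Ps) ts e (there R∈)  | just us = checkAll-sound f Ps us e R∈

    module _ (lib : List Pattern) (reducible : ∀ {R} → R ∈ lib → Reducible R) where

      pairs-sound : ∀ M → pairsOK lib M ≡ true → ∀ {u v} → W u ≡ true → W v ≡ true → Adj G u v ≡ true →
                    compatible M (deg G W u) (deg G W v) ≡ false → Goal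
      pairs-sound M ok {u} {v} wu wv a c
        with any-true (matches M (deg G W u) (deg G W v)) (Mode.excluded M) (not-false c)
      ... | (x , y) , xy∈ , m with any-true (contains _) lib (all-true (λ (d , e) → resolved lib ((d , 1 ∷ []) ∷ (e , 0 ∷ []) ∷ [])) ok xy∈)
      ...   | R , R∈ , cR with ∨-true {(deg G W u ≡ᵇ x) ∧ (deg G W v ≡ᵇ y)} m
      ...     | inj₁ p with ∧-true {deg G W u ≡ᵇ x} p
      ...       | p₁ , p₂ with contains-correct G (subst₂ (λ x y → Emb G W ((x , 1 ∷ []) ∷ (y , 0 ∷ []) ∷ []) (pair u v))
                                 (≡ᵇ-true p₁) (≡ᵇ-true p₂) (emb-pair wu wv a)) R cR
      ...         | τ , ER = reducible R∈ τ ER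
      pairs-sound M ok {u} {v} wu wv a c | (x , y) , xy∈ , m | R , R∈ , cR | inj₂ p with ∧-true {deg G W u ≡ᵇ y} p
      ... | p₁ , p₂ with contains-correct G (subst₂ (λ x y → Emb G W ((x , 1 ∷ []) ∷ (y , 0 ∷ []) ∷ []) (pair v u))
                           (≡ᵇ-true p₂) (≡ᵇ-true p₁) (emb-pair wv wu (adj-sym G a))) R cR
      ...   | τ , ER = reducible R∈ τ ER

      stage-sound : ∀ S → stageOK lib S ≡ true → Reducible (Stage.root S)
      stage-sound S ok with ∧-true {pairsOK lib (Stage.how S)} ok
      ... | p , ok₁ with ∧-true {specialOK lib (Stage.how S) C5} ok₁
      ...   | c , ok₂ with ∧-true {specialOK lib (Stage.how S) D6} ok₂
      ...     | d , ok₃ with check (Stage.how S) lib 64 (Stage.root S) (concatMap decode (Stage.cert S)) in e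
      ...       | just [] = check-sound (Stage.how S) (pairs-sound (Stage.how S) p) lib reducible
                              (λ { (here refl) → c ; (there (here refl)) → d }) 64 (Stage.root S) (concatMap decode (Stage.cert S)) e

    stages-sound : ∀ lib → (∀ {R} → R ∈ lib → Reducible R) → ∀ Ss → runStages lib Ss ≡ true →
                   ∀ {R} → R ∈ lib ++ map Stage.root Ss → Reducible R
    stages-sound lib red [] ok R∈ with ∈-++⁻ lib R∈
    ... | inj₁ R∈lib = red R∈lib
    stages-sound lib red (S ∷ Ss) ok {R} R∈ with ∧-true {stageOK lib S} ok
    ... | here-ok , rest = stages-sound (lib ++ Stage.root S ∷ []) red′ Ss rest (subst (R ∈_) (sym (++-assoc lib _ _)) R∈)
      where
      red′ : ∀ {R} → R ∈ lib ++ Stage.root S ∷ [] → Reducible R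
      red′ R∈ with ∈-++⁻ lib R∈
      ... | inj₁ R∈lib       = red R∈lib
      ... | inj₂ (here refl) = stage-sound lib red S here-ok

-- Special components and hitting sets

reach : Pattern → ℕ → ℕ → List ℕ
reach Q zero    i = i ∷ []
reach Q (suc k) i = i ∷ concatMap (reach Q k) (nbrs Q i)

special-connected : ∀ {Q} → Q ∈ special → all (λ i → all (_∈ᵇ reach Q 3 i) (upTo (length Q))) (upTo (length Q)) ≡ true
special-connected (here refl)         = refl
special-connected (there (here refl)) = refl

module _ {n : ℕ} (G : Graph n) (v₀ : Fin n) where

  map-at : ∀ vs → map (at G v₀ vs) (upTo (length vs)) ≡ vs
  map-at vs = trans (map-upTo (at G v₀ vs) (length vs)) (at-all vs)
    where
    at-all : ∀ vs → applyUpTo (at G v₀ vs) (length vs) ≡ vs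
    at-all []       = refl
    at-all (v ∷ vs) = cong (v ∷_) (at-all vs)

  module _ {W : VSet G} where

    at-unique : ∀ {Q K} → Special G v₀ W Q K → Unique K
    at-unique {K = K} (len , E) = subst Unique (map-at K)
      (unique-map (at G v₀ K) (Unique.upTo⁺ (length K)) (λ x∈ y∈ → Emb.inj E (fit x∈) (fit y∈)))
      where
      fit : ∀ {i} → i ∈ upTo (length K) → i < _
      fit i∈ = subst (_ <_) len (∈-upTo⁻ i∈)

    -- K₀ is connected and K is closed under adjacency in W, so K follows every walk of K₀ that
    -- starts in a common vertex.
    special-merge : ∀ {Q Q₀ K K₀} → Q ∈ special → Special G v₀ W Q K → Q₀ ∈ special → Special G v₀ W Q₀ K₀ →
                    ∀ {v} → v ∈ K₀ → v ∈ K → ∀ {u} → u ∈ K₀ → u ∈ K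
    special-merge {Q} {Q₀} {K} {K₀} q∈ S q₀∈ S₀@(len , E) v∈₀ v∈ u∈₀ with ∈-at G v₀ v∈₀ | ∈-at G v₀ u∈₀
    ... | i , i< , refl | j , j< , refl =
      follow 3 (subst (i <_) len i<) v∈ (∈ᵇ⇒∈ (reach Q₀ 3 i) (all-true (_∈ᵇ reach Q₀ 3 i)
        (all-true (λ i → all (_∈ᵇ reach Q₀ 3 i) (upTo (length Q₀))) (special-connected q₀∈) (∈-upTo⁺ (subst (i <_) len i<)))
        (∈-upTo⁺ (subst (j <_) len j<))))
      where
      follow : ∀ k {i j} → i < length Q₀ → at G v₀ K₀ i ∈ K → j ∈ reach Q₀ k i → at G v₀ K₀ j ∈ K
      follow zero    i< p (here refl) = p
      follow (suc k) i< p (here refl) = p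
      follow (suc k) {i} i< p (there j∈) with find (∈-concatMap⁻ (reach Q₀ k) {xs = nbrs Q₀ i} j∈)
      ... | l , l∈ , j∈′ = follow k (Emb.bnd E i< l∈)
              (special-closure G v₀ {W} {Q} {K} q∈ S p (Emb.mem E (Emb.bnd E i< l∈)) (Emb.edg E i< l∈)) j∈′

    findSpecial : {R : List (Fin n) → Set} → (∀ vs → Dec (R vs)) →
                  Dec (∃ λ Q → Q ∈ special × ∃ λ K → Special G v₀ W Q K × R K)
    findSpecial {R} R? = combine (search C5) (search D6)
      where
      search : ∀ Q → Dec (∃ λ K → length K ≡ length Q × Emb G W Q (at G v₀ K) × R K)
      search Q = searchList G (length Q) (λ vs → emb? G W Q (at G v₀ vs) ×-dec R? vs)
      combine : Dec (∃ λ K → length K ≡ length C5 × Emb G W C5 (at G v₀ K) × R K) →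
                Dec (∃ λ K → length K ≡ length D6 × Emb G W D6 (at G v₀ K) × R K) →
                Dec (∃ λ Q → Q ∈ special × ∃ λ K → Special G v₀ W Q K × R K)
      combine (yes (K , l , E , r)) _ = yes (C5 , here refl , K , (l , E) , r)
      combine (no _) (yes (K , l , E , r)) = yes (D6 , there (here refl) , K , (l , E) , r)
      combine (no a) (no b) = no λ { (_ , here refl , K , (l , E) , r) → a (K , l , E , r)
                                   ; (_ , there (here refl) , K , (l , E) , r) → b (K , l , E , r) }

    count-in : List (Fin n) → List (Fin n) → ℕ
    count-in U K = length (filterᵇ (member _≟_ U) K)

    Hit : ℕ → List (Fin n) → List (Fin n) → Set
    Hit a U H = ∀ {Q K} → Q ∈ special → Special G v₀ W Q K → suc a ≤ count-in U K → ∃ λ h → h ∈ H × h ∈ K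

    -- Greedy choice: a special component that meets U often is hit by its first vertex in U, which accounts for a + 1 elements of U.
    hit : ∀ a k U → Unique U → length U ≤ k → ∃ λ H → suc a * length H ≤ length U × Hit a U H
    hit a k [] uU len = [] , ≤-reflexive (*-zeroʳ (suc a)) ,
      λ {Q} {K} q∈ S le → ⊥-elim (1+n≰n (≤-trans (s≤s z≤n) (subst (suc a ≤_) (length-filterᵇ-none (member _≟_ []) K (λ _ → refl)) le)))
    hit a (suc k) (u ∷ U) (u∉ ∷ uU) (s≤s len) = decide (findSpecial (λ K → _∈?_ _≟_ u K ×-dec (suc a ≤? count-in (u ∷ U) K)))
      where
      decide : Dec (∃ λ Q → Q ∈ special × ∃ λ K → Special G v₀ W Q K × u ∈ K × suc a ≤ count-in (u ∷ U) K) →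
               ∃ λ H → suc a * length H ≤ suc (length U) × Hit a (u ∷ U) H
      decide (no none) with hit a k U uU len
      ... | H , le , hits = H , m≤n⇒m≤1+n le , λ {Q} {K} q∈ S ge → hits q∈ S (subst (suc a ≤_)
              (filterᵇ-cong-length (member _≟_ (u ∷ U)) (member _≟_ U) K (λ {x} x∈ → drop-u {x} (λ { refl → none (Q , q∈ , K , S , x∈ , ge) }))) ge)
        where
        drop-u : ∀ {x} → x ≢ u → member _≟_ (u ∷ U) x ≡ member _≟_ U x
        drop-u {x} ne with x ≟ u
        ... | yes x≡u = ⊥-elim (ne x≡u)
        ... | no _    = refl
      decide (yes (Q₀ , q₀∈ , K₀ , S₀ , u∈ , ge₀)) with hit a k rest rest-unique rest-len
        where
        rest = filterᵇ (not ∘ member _≟_ K₀) (u ∷ U)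
        rest-unique = unique-filterᵇ (not ∘ member _≟_ K₀) (u∉ ∷ uU)
        rest-len : length rest ≤ k
        rest-len = ≤-trans (drop-head (member⁺ _≟_ {K₀} u∈)) len
          where
          drop-head : member _≟_ K₀ u ≡ true → length rest ≤ length U
          drop-head m rewrite m = ≤-trans (m≤n+m _ _) (≤-reflexive (sym (length-filterᵇ (member _≟_ K₀) U)))
      ... | H , le , hits = u ∷ H , total , hits′
        where
        rest = filterᵇ (not ∘ member _≟_ K₀) (u ∷ U)
        many : suc a ≤ length (filterᵇ (member _≟_ K₀) (u ∷ U))
        many = ≤-trans ge₀ (length-⊆ _≟_ {filterᵇ (member _≟_ (u ∷ U)) K₀} {filterᵇ (member _≟_ K₀) (u ∷ U)}
          (unique-filterᵇ (member _≟_ (u ∷ U)) {K₀} (at-unique {Q₀} {K₀} S₀)) (unique-filterᵇ (member _≟_ K₀) {u ∷ U} (u∉ ∷ uU))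
          (λ x∈ → let x∈K , x∈U = ∈-filterᵇ⁻ (member _≟_ (u ∷ U)) {K₀} x∈ in
                  ∈-filterᵇ⁺ (member _≟_ K₀) (member⁻ _≟_ {u ∷ U} x∈U) (member⁺ _≟_ {K₀} x∈K)))
        total : suc a * suc (length H) ≤ suc (length U)
        total = begin
          suc a * suc (length H)                                       ≡⟨ *-suc (suc a) (length H) ⟩
          suc a + suc a * length H                                     ≤⟨ +-mono-≤ many le ⟩
          length (filterᵇ (member _≟_ K₀) (u ∷ U)) + length rest       ≡⟨ length-filterᵇ (member _≟_ K₀) (u ∷ U) ⟨
          suc (length U)                                               ∎
          where open ≤-Reasoning
        hits′ : Hit a (u ∷ U) (u ∷ H)
        hits′ {Q} {K} q∈ S ge with Any.any? (λ v → _∈?_ _≟_ v K₀) K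
        ... | yes meets with find meets
        ...   | v , v∈K , v∈K₀ = u , here refl , special-merge q∈ S q₀∈ S₀ v∈K₀ v∈K u∈
        hits′ {Q} {K} q∈ S ge | no apart with hits q∈ S (subst (suc a ≤_)
              (filterᵇ-cong-length (member _≟_ (u ∷ U)) (member _≟_ rest) K agree) ge)
          where
          agree : ∀ {x} → x ∈ K → member _≟_ (u ∷ U) x ≡ member _≟_ rest x
          agree {x} x∈ with member _≟_ (u ∷ U) x in e
          ... | true  = sym (member⁺ _≟_ {rest} (∈-filterᵇ⁺ (not ∘ member _≟_ K₀) (member⁻ _≟_ {u ∷ U} e)
                          (cong not (member-∉ _≟_ {K₀} (λ x∈₀ → apart (Any.map (λ { refl → x∈₀ }) x∈))))))
          ... | false = sym (member-∉ _≟_ {rest} (λ x∈r → ∉-member _≟_ {u ∷ U} e (proj₁ (∈-filterᵇ⁻ (not ∘ member _≟_ K₀) {u ∷ U} x∈r))))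
        ... | h , h∈ , h∈K = h , there h∈ , h∈K

-- Evaluation of the exploration trees

deficientLib : List Pattern
deficientLib = special ++ map Stage.root deficientStages

fullLib : List Pattern
fullLib = cubicLib ++ map Stage.root cubicStages

abstract
  -- All trees are verified here, by evaluation; `abstract` prevents these proofs from being
  -- unfolded again where they are used.
  deficient-checked : runStages special deficientStages ≡ true
  deficient-checked = refl

  cubic-checked : runStages cubicLib cubicStages ≡ true
  cubic-checked = refl

  end-vertex-resolved : ∀ {e} → e ∈ 1 ∷ 2 ∷ 3 ∷ [] → resolved deficientLib ((1 , 1 ∷ []) ∷ (e , 0 ∷ []) ∷ []) ≡ true
  end-vertex-resolved (here refl)                 = refl
  end-vertex-resolved (there (here refl))         = refl
  end-vertex-resolved (there (there (here refl))) = refl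

  degree-two-resolved : resolved deficientLib ((2 , []) ∷ []) ≡ true
  degree-two-resolved = refl

  degree-three-resolved : resolved fullLib ((3 , []) ∷ []) ≡ true
  degree-three-resolved = refl

-- Dominating the vertex set

module _ {n : ℕ} (G : Graph n) (v₀ : Fin n) (cubic : Cubic G) where

  -- Each element of H is worth 15, which makes up for the gap between cost and weight of one special component.
  Hits : VSet G → List (Fin n) → Set
  Hits W H = ∀ {Q K} → Q ∈ special → Special G v₀ W Q K → ∃ λ h → h ∈ H × h ∈ K

  record Cover (W : VSet G) (B : ℕ) : Set where
    field
      F      : List (Fin n × Fin n)
      edges  : ∀ {e} → e ∈ F → Adj G (proj₁ e) (proj₂ e) ≡ true
      covering : ∀ {v} → W v ≡ true → ∃ λ e → e ∈ F × Dominates G v₀ e v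
      cheap  : 105 * length F ≤ B

  extendCover : ∀ {W B} xs F → (∀ {e} → e ∈ F → Adj G (proj₁ e) (proj₂ e) ≡ true) →
                (∀ {x} → x ∈ xs → ∃ λ e → e ∈ F × Dominates G v₀ e x) →
                Cover (_∖_ G W xs) B → ∀ {C} → 105 * length F + B ≤ C → Cover W C
  extendCover {W} xs F F-edges F-covers c {C} le = record
    { F = F ++ Cover.F c
    ; edges = λ e∈ → [ F-edges , Cover.edges c ]′ (∈-++⁻ F e∈)
    ; covering = λ {v} → cov v
    ; cheap = subst (λ k → 105 * k ≤ C) (sym (length-++ F)) (≤-trans
        (≤-trans (≤-reflexive (*-distribˡ-+ 105 (length F) _)) (+-monoʳ-≤ (105 * length F) (Cover.cheap c))) le) }
    where
    cov : ∀ v → W v ≡ true → ∃ λ e → e ∈ F ++ Cover.F c × Dominates G v₀ e v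
    cov v w with _∈?_ _≟_ v xs
    ... | yes v∈ = let e , e∈ , d = F-covers v∈ in e , ∈-++⁺ˡ e∈ , d
    ... | no v∉  = let e , e∈ , d = Cover.covering c (true-∖ G W xs w v∉) in e , ∈-++⁺ʳ F e∈ , d

  -- If no edge joins `xs` to the rest, then its removal changes no degree and creates no special
  -- component. This is applied to an isolated vertex and to a whole special component.
  special-unremove : ∀ {W xs} → Unique xs → (∀ {x} → x ∈ xs → W x ≡ true) →
                     (∀ {u x} → (_∖_ G W xs) u ≡ true → x ∈ xs → Adj G u x ≡ false) →
                     ∀ {Q K} → Special G v₀ (_∖_ G W xs) Q K → Special G v₀ W Q K
  special-unremove {W} {xs} u sub none (len , E) = len , record
    { inj = inj ; mem = proj₁ ∘ ∖-true G W xs ∘ mem ; bnd = bnd ; edg = edg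
    ; dgr = λ i< → [ inj₁ , (λ e → inj₂ (trans (same (mem i<)) e)) ]′ (dgr i<) }
    where
    open Emb E
    same : ∀ {v} → (_∖_ G W xs) v ≡ true → deg G W v ≡ deg G (_∖_ G W xs) v
    same {v} w = trans (deg-∖ G W u sub v) (trans (cong (deg G (_∖_ G W xs) v +_)
      (length-filterᵇ-none (Adj G v) xs (none w))) (+-identityʳ _))

  -- `hit` selects a list H that meets all special components of what remains and is short enough
  -- for the reserve in `budget`. The summand 105 in the induction hypothesis records that the
  -- measure drops strictly, as a reduction uses at least one edge.
  reduction-cover : ∀ {W} (r : Reduction G v₀ W) →
    (∀ H → Φ G (_∖_ G W (Reduction.xs r)) + 15 * length H + 105 ≤ Φ G W → Hits (_∖_ G W (Reduction.xs r)) H →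
       Cover (_∖_ G W (Reduction.xs r)) (Φ G (_∖_ G W (Reduction.xs r)) + 15 * length H)) → Cover W (Φ G W)
  reduction-cover {W} r IH = extendCover xs F F-edges covered
      (IH H (≤-trans (small (Φ G W′) (15 * length H)) total) (λ {Q} {K} q∈ S → hits {Q} {K} q∈ S (attached {Q} {K} q∈ S)))
      total
    where
    open Reduction r
    W′ = _∖_ G W xs
    found = hit G v₀ {W′} a (length U) U U-uniq ≤-refl
    H = proj₁ found
    hits = proj₂ (proj₂ found)
    H-few : length H ≤ length U / suc a
    H-few = subst (_≤ length U / suc a) (m*n/n≡m (length H) (suc a))
      (/-monoˡ-≤ (suc a) (≤-trans (≤-reflexive (*-comm (length H) (suc a))) (proj₁ (proj₂ found))))
    total : 105 * length F + (Φ G W′ + 15 * length H) ≤ Φ G W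
    total = ≤-trans (≤-trans (≤-reflexive (sym (+-assoc (105 * length F) (Φ G W′) _)))
      (+-monoʳ-≤ (105 * length F + Φ G W′) (*-monoʳ-≤ 15 H-few))) budget
    small : ∀ a b → a + b + 105 ≤ 105 * length F + (a + b)
    small a b = ≤-trans (≤-reflexive (+-comm (a + b) 105)) (+-monoˡ-≤ (a + b) (*-monoʳ-≤ 105 F-some))

  emb-single : ∀ {W u} → W u ≡ true → Emb G W ((deg G W u , []) ∷ []) (λ _ → u)
  emb-single w = record
    { inj = λ { (s≤s z≤n) (s≤s z≤n) _ → refl } ; mem = λ _ → w ; bnd = λ { (s≤s z≤n) () }
    ; edg = λ { (s≤s z≤n) () } ; dgr = λ { (s≤s z≤n) → inj₂ refl } }

  -- A vertex isolated in G[W] weighs 105, which is exactly the price of an edge. Being of degree 3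
  -- in G, it has a neighbour `c`, necessarily outside W, and the edge between them dominates it. No
  -- special component is created, so `U` may be empty.
  isolated-reduction : ∀ {W} → (∀ {Q K} → Q ∈ special → ¬ Special G v₀ W Q K) →
                       ∀ v → W v ≡ true → deg G W v ≡ 0 → Reduction G v₀ W
  isolated-reduction {W} none v w d≡0 = record
    { xs = v ∷ [] ; U = [] ; F = (v , c) ∷ [] ; a = 0 ; xs-uniq = [] ∷ [] ; U-uniq = []
    ; xs-sub = λ { (here refl) → w } ; F-edges = λ { (here refl) → proj₂ (∈-filterᵇ⁻ (Adj G v) {allFin n} c∈) } ; F-some = s≤s z≤n
    ; covered = λ { (here refl) → (v , c) , here refl , inj₁ refl }
    ; attached = λ {Q} {K} q∈ S → ⊥-elim (none {Q} {K} q∈ (special-unremove {W} {v ∷ []} ([] ∷ []) (λ { (here refl) → w }) apart {Q} {K} S))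
    ; budget = ≤-reflexive (trans (+-identityʳ (105 + Φ G W′)) (sym Φ-split)) }
    where
    W′ : VSet G
    W′ = _∖_ G W (v ∷ [])
    neighbour : ∃ λ c → c ∈ filterᵇ (Adj G v) (allFin n)
    neighbour with filterᵇ (Adj G v) (allFin n) | cubic v
    ... | c ∷ _ | _ = c , here refl
    c = proj₁ neighbour
    c∈ = proj₂ neighbour
    lonely : ∀ {u} → W u ≡ true → Adj G v u ≡ false
    lonely {u} wu with Adj G v u in a
    ... | false = refl
    ... | true  = ⊥-elim (n≮0 (subst (0 <_) d≡0 (∈-length (∈-nb⁺ G W a wu))))
    apart : ∀ {u x} → W′ u ≡ true → x ∈ v ∷ [] → Adj G u x ≡ false
    apart {u} wu (here refl) = trans (symm G u v) (lonely (proj₁ (∖-true G W (v ∷ []) wu)))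
    same : ∀ {u} → u ∉ v ∷ [] → term G W u ≡ term G W′ u
    same {u} u∉ with W u in wu
    ... | false = refl
    ... | true rewrite member-∉ _≟_ {v ∷ []} {u} u∉ = cong weight (trans (deg-∖ G W ([] ∷ []) (λ { (here refl) → w }) u)
            (trans (cong (deg G W′ u +_) (length-filterᵇ-none (Adj G u) (v ∷ [])
              (λ { (here refl) → trans (symm G u v) (lonely wu) }))) (+-identityʳ _)))
    gone : W′ v ≡ false
    gone rewrite w | member⁺ _≟_ {v ∷ []} {v} (here refl) = refl
    Φ-split : Φ G W ≡ 105 + Φ G W′
    Φ-split = begin
      Φ G W                           ≡⟨ +-identityʳ _ ⟨
      Φ G W + 0                       ≡⟨ cong (Φ G W +_) (trans (+-identityʳ _) (term-out G W′ gone)) ⟨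
      Φ G W + (term G W′ v + 0)       ≡⟨ sum-local _≟_ (term G W) (term G W′) (Unique.allFin⁺ n) ([] ∷ []) (λ _ → ∈-allFin _) (λ _ → same) ⟩
      Φ G W′ + (term G W v + 0)       ≡⟨ cong (Φ G W′ +_) (trans (+-identityʳ _) (trans (term-in G W w) (cong weight d≡0))) ⟩
      Φ G W′ + 105                    ≡⟨ +-comm _ 105 ⟩
      105 + Φ G W′                    ∎
      where open ≡-Reasoning

  specialEdges : ∀ {Q} → Q ∈ special → List (ℕ × ℕ)
  specialEdges (here refl)         = (0 , 1) ∷ (2 , 3) ∷ []
  specialEdges (there (here refl)) = (0 , 2) ∷ (1 , 3) ∷ []

  special-edges : ∀ {Q} (q∈ : Q ∈ special) → all (isEdge Q) (specialEdges q∈) ≡ true ×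
                  all (λ i → any (covers Q i) (specialEdges q∈)) (upTo (length Q)) ≡ true × length (specialEdges q∈) ≡ 2
  special-edges (here refl)         = refl , refl , refl
  special-edges (there (here refl)) = refl , refl , refl

  -- Excludes nothing; it serves to apply `Removal` to a whole special component, where all degrees
  -- are known.
  plain : Mode
  plain = mode [] 0 []

  -- All vertices are removed, so nothing becomes heavier. The value 195 is exact for C5; for D6 a
  -- surplus of 3 is given away.
  special-gain : ∀ {Q} → Q ∈ special →
    195 + sum (map (cost plain Q (upTo (length Q))) (upTo (length Q))) + 0 ≤ sum (map (gain Q (upTo (length Q))) (upTo (length Q)))
  special-gain (here refl)         = ≤ᵇ-true refl
  special-gain (there (here refl)) = ≤ᵇ-true refl

  known-positive : ∀ {Q i} → Q ∈ special → i < length Q → 0 < known Q i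
  known-positive {Q} {i} q∈ i< = <ᵇ-true (proj₁ (∧-true (all-true (closed Q) (special-closed q∈) (∈-upTo⁺ i<))))

  special-cover : ∀ {W Q K} → Q ∈ special → Special G v₀ W Q K → ∀ {B} →
                  Cover (_∖_ G W K) B → ∀ {C} → B + 210 ≤ C → Cover W C
  special-cover {W} {Q} {K} q∈ (len , E) c le = extendCover K F
      (λ e∈ → edge (∈-map⁻ translate e∈)) cover c
      (≤-trans (≤-reflexive (trans (cong (λ k → 105 * k + _) (trans (length-map translate (specialEdges q∈)) (proj₂ (proj₂ (special-edges q∈))))) (+-comm 210 _))) le)
    where
    translate : ℕ × ℕ → Fin n × Fin n
    translate e = at G v₀ K (proj₁ e) , at G v₀ K (proj₂ e)
    F = map translate (specialEdges q∈)
    edge : ∀ {e} → (∃ λ f → f ∈ specialEdges q∈ × e ≡ translate f) → Adj G (proj₁ e) (proj₂ e) ≡ true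
    edge (f , f∈ , refl) = Emb.edg E (proj₁ ends) (proj₂ ends)
      where ends = isEdge-true G v₀ E {specialEdges q∈} (proj₁ (special-edges q∈)) f∈
    cover : ∀ {x} → x ∈ K → ∃ λ e → e ∈ F × Dominates G v₀ e x
    cover x∈ with ∈-at G v₀ x∈
    ... | i , i< , refl with any-true (covers Q i) (specialEdges q∈)
                               (all-true (λ i → any (covers Q i) (specialEdges q∈)) (proj₁ (proj₂ (special-edges q∈))) (∈-upTo⁺ (subst (i <_) len i<)))
    ...   | e , e∈ , cv = translate e , ∈-map⁺ translate e∈ , covers-dominates G v₀ E {specialEdges q∈} (proj₁ (special-edges q∈)) e∈ cv

  special-drop : ∀ {W Q K} → Q ∈ special → Special G v₀ W Q K → Φ G (_∖_ G W K) + 195 ≤ Φ G W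
  special-drop {W} {Q} {K} q∈ S@(len , E) =
    subst (λ L → Φ G (_∖_ G W L) + 195 ≤ Φ G W) K≡
      (≤-trans (≤-reflexive (trans (+-comm _ 195) (sym (+-identityʳ _)))) (Whole.drop-by 195 0 (special-gain {Q} q∈)))
    where
    K≡ : map (at G v₀ K) (upTo (length Q)) ≡ K
    K≡ = trans (cong (map (at G v₀ K) ∘ upTo) (sym len)) (map-at G v₀ K)
    known-degree : ∀ {i} → i < length Q → deg G W (at G v₀ K i) ∈ degrees plain Q i
    known-degree {i} i< = go (known Q i) (known-positive {Q} q∈ i<) refl
      where
      go : ∀ k → 0 < k → k ≡ known Q i → deg G W (at G v₀ K i) ∈ degrees plain Q i
      go (suc k) _ e rewrite sym e = here (trans (closed-degree G E i< (all-true (closed Q) (special-closed q∈) (∈-upTo⁺ i<))) (sym e))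
    module Whole = Removal G plain E (upTo (length Q)) (Unique.upTo⁺ _) ∈-upTo⁻ (all-true (closed Q) (special-closed q∈)) known-degree

  crossing : ∀ {W : VSet G} {v z} → Reachable G v z → W v ≡ true → W z ≡ false → ∃ λ u → ∃ λ w → W u ≡ true × W w ≡ false × Adj G u w ≡ true
  crossing Defs.here w z = ⊥-elim (true≢false w z)
  crossing {W} (Defs.step {w = x} a r) w z with W x in e
  ... | false = _ , x , w , e , a
  ... | true  = crossing r e z

  crossing-degree : ∀ {W : VSet G} {u w} → W w ≡ false → Adj G u w ≡ true → deg G W u < 3
  crossing-degree {W} {u} {w} out a = subst (deg G W u <_) (cubic u)
    (length-⊆ _≟_ (All.tabulate (λ x∈ w≡x → true≢false (proj₂ (∈-nb⁻ G W x∈)) (subst (λ x → W x ≡ false) w≡x out)) ∷ nb-unique G W u)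
      (unique-filterᵇ (Adj G u) (Unique.allFin⁺ n))
      (λ { (here refl) → ∈-filterᵇ⁺ (Adj G u) (∈-allFin w) a
         ; (there x∈) → ∈-filterᵇ⁺ (Adj G u) (∈-allFin _) (proj₁ (∈-nb⁻ G W x∈)) }))

-- Induction for proper subsets of the vertex set

module _ {n : ℕ} (G : Graph n) (v₀ : Fin n) (cubic : Cubic G) (connected : Connected G) where

  special-of-emb : ∀ {W Q σ} → Emb G W Q σ → Special G v₀ W Q (map σ (upTo (length Q)))
  special-of-emb {W} {Q} {σ} E = trans (length-map σ (upTo (length Q))) (length-upTo (length Q)) , record
    { inj = λ i< j< e → inj i< j< (trans (sym (agree i<)) (trans e (agree j<)))
    ; mem = λ i< → trans (cong W (agree i<)) (mem i<)
    ; bnd = bnd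
    ; edg = λ i< j∈ → trans (cong₂ (Adj G) (agree i<) (agree (bnd i< j∈))) (edg i< j∈)
    ; dgr = λ i< → [ inj₁ , (λ e → inj₂ (trans (cong (deg G W) (agree i<)) e)) ]′ (dgr i<) }
    where
    open Emb E
    at-applyUpTo : ∀ f m {i} → i < m → at G v₀ (applyUpTo f m) i ≡ f i
    at-applyUpTo f (suc m) {zero}  _        = refl
    at-applyUpTo f (suc m) {suc i} (s≤s i<) = at-applyUpTo (f ∘ suc) m i<
    agree : ∀ {i} → i < length Q → at G v₀ (map σ (upTo (length Q))) i ≡ σ i
    agree i< = trans (cong (λ vs → at G v₀ vs _) (map-upTo σ (length Q))) (at-applyUpTo σ (length Q) i<)

  module Deficiency (W : VSet G) (missed : ∃ λ z → W z ≡ false)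
              (none : ∀ {Q K} → Q ∈ special → ¬ Special G v₀ W Q K)
              (reduce : Reduction G v₀ W → Cover G v₀ cubic W (Φ G W)) where

    Goal : Set
    Goal = Cover G v₀ cubic W (Φ G W)

    isolated : ∀ v → W v ≡ true → deg G W v ≡ 0 → Goal
    isolated v w d = reduce (isolated-reduction G v₀ cubic (λ {Q} {K} → none {Q} {K}) v w d)

    open Soundness G v₀ cubic W Goal isolated reduce

    reducible : ∀ {R} → R ∈ deficientLib → Reducible R
    reducible = stages-sound special (λ {Q} q∈ σ E → ⊥-elim (none {Q} {map σ (upTo (length Q))} q∈ (special-of-emb E))) deficientStages deficient-checked

    end-vertex : ∀ {u w} → W u ≡ true → W w ≡ true → Adj G u w ≡ true → deg G W u ≡ 1 → Goal
    end-vertex {u} {w} wu ww a d = [ isolated w ww , (λ e∈ → resolved-goal deficientLib reducible (emb-pair wu ww a)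
      (subst (λ x → resolved deficientLib ((x , 1 ∷ []) ∷ (deg G W w , 0 ∷ []) ∷ []) ≡ true) (sym d) (end-vertex-resolved e∈))) ]′
      (positive-≤3 (deg G W w) (deg≤3 G cubic W w))

    low-degree : ∀ {u} d → W u ≡ true → deg G W u ≡ d → d < 3 → Goal
    low-degree {u} 0 wu d _ = isolated u wu d
    -- No root is a single vertex of degree 1. Instead there is one for such a vertex together with
    -- its neighbour, for each degree that the neighbour may have.
    low-degree {u} 1 wu d _ = go (nb G W u) refl
      where
      go : ∀ N → nb G W u ≡ N → Goal
      go []      e = ⊥-elim (0≢1+n (trans (sym (cong length e)) d))
      go (w ∷ N) e = end-vertex wu (proj₂ a) (proj₁ a) d
        where a = ∈-nb⁻ G W (subst (w ∈_) (sym e) (here refl))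
    low-degree {u} 2 wu d _ = resolved-goal deficientLib reducible (emb-single G v₀ cubic wu)
      (subst (λ x → resolved deficientLib ((x , []) ∷ []) ≡ true) (sym d) degree-two-resolved)
    low-degree (suc (suc (suc _))) _ _ (s≤s (s≤s (s≤s ())))

    goal : ∀ {v} → W v ≡ true → Goal
    goal {v} w = let u , x , wu , wx , a = crossing G v₀ cubic (connected v (proj₁ missed)) w (proj₂ missed) in
                 low-degree (deg G W u) wu refl (crossing-degree G v₀ cubic wx a)

  -- Induction on the bound `k` for the measure. If `h` lies in a special component K, then the 15
  -- for `h` and the 195 by which the weight drops pay for the two edges that dominate K. Once H is
  -- used up, G[W] has no special component, which is what `Deficiency` requires; a reduction then
  -- supplies a new list.
  deficient : ∀ k W H → Φ G W + 15 * length H < k → (∃ λ z → W z ≡ false) → Hits G v₀ cubic W H →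
              Cover G v₀ cubic W (Φ G W + 15 * length H)
  deficient (suc k) W (h ∷ H) (s≤s lt) (z , wz) hits = decide (findSpecial G v₀ {W} (λ K → _∈?_ _≟_ h K))
    where
    less : 15 + (Φ G W + 15 * length H) ≤ k
    less = ≤-trans (≤-reflexive (trans (sym (+-assoc 15 (Φ G W) _)) (trans (cong (_+ 15 * length H) (+-comm 15 (Φ G W)))
             (trans (+-assoc (Φ G W) 15 _) (cong (Φ G W +_) (sym (*-suc 15 (length H)))))))) lt
    decide : Dec (∃ λ Q → Q ∈ special × ∃ λ K → Special G v₀ W Q K × h ∈ K) → Cover G v₀ cubic W (Φ G W + 15 * suc (length H))
    -- `h` lies in no special component and is dropped; its 15 are wasted.
    decide (no none) = record { F = F c ; edges = edges c ; covering = covering c ; cheap = ≤-trans (cheap c) (+-monoʳ-≤ (Φ G W) (*-monoʳ-≤ 15 (n≤1+n (length H)))) }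
      where
      open Cover
      c = deficient k W H (≤-trans (s≤s (m≤n+m _ 14)) less) (z , wz) hits′
        where
        hits′ : Hits G v₀ cubic W H
        hits′ {Q} {K} q∈ S with hits {Q} {K} q∈ S
        ... | _ , here refl , h∈K = ⊥-elim (none (Q , q∈ , K , S , h∈K))
        ... | x , there x∈  , x∈K = x , x∈ , x∈K
    decide (yes (Q , q∈ , K , S , h∈)) = special-cover G v₀ cubic {W} {Q} {K} q∈ S
        (deficient k W₁ H (≤-trans (s≤s (+-monoˡ-≤ _ smaller)) (≤-trans (s≤s (m≤n+m _ 14)) less)) (z , missed) hits′)
        (begin
          Φ G W₁ + 15 * length H + 210        ≡⟨ +-assoc (Φ G W₁) _ 210 ⟩
          Φ G W₁ + (15 * length H + 210)      ≡⟨ cong (Φ G W₁ +_) (+-comm _ 210) ⟩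
          Φ G W₁ + (195 + (15 + 15 * length H)) ≡⟨ +-assoc (Φ G W₁) 195 _ ⟨
          Φ G W₁ + 195 + (15 + 15 * length H) ≤⟨ +-monoˡ-≤ _ dropped ⟩
          Φ G W + (15 + 15 * length H)        ≡⟨ cong (Φ G W +_) (*-suc 15 (length H)) ⟨
          Φ G W + 15 * suc (length H)         ∎)
      where
      open ≤-Reasoning
      W₁ : VSet G
      W₁ = _∖_ G W K
      dropped : Φ G W₁ + 195 ≤ Φ G W
      dropped = special-drop G v₀ cubic {W} {Q} {K} q∈ S
      smaller : Φ G W₁ ≤ Φ G W
      smaller = ≤-trans (m≤m+n _ 195) dropped
      missed : W₁ z ≡ false
      missed rewrite wz = refl
      -- K is a whole component, so the special components of W₁ are special in W too, and those hit
      -- by `h` are gone with K.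
      hits′ : Hits G v₀ cubic W₁ H
      hits′ {Q′} {K′} q′∈ S′ with hits {Q′} {K′} q′∈ (special-unremove G v₀ cubic {W} {K} (at-unique G v₀ {W} {Q} {K} S) (special-⊆ G v₀ {W} {Q} {K} S) apart {Q′} {K′} S′)
        where
        apart : ∀ {u x} → W₁ u ≡ true → x ∈ K → Adj G u x ≡ false
        apart {u} {x} wu x∈ with Adj G u x in a
        ... | false = refl
        ... | true  = ⊥-elim (proj₂ (∖-true G W K wu) (special-closure G v₀ {W} {Q} {K} q∈ S x∈ (proj₁ (∖-true G W K wu)) (adj-sym G a)))
      ... | _ , here refl , h∈K′ = ⊥-elim (proj₂ (∖-true G W K (special-⊆ G v₀ {W₁} {Q′} {K′} S′ h∈K′)) h∈)
      ... | x , there x∈  , x∈K′ = x , x∈ , x∈K′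
  deficient (suc k) W [] (s≤s lt) (z , wz) hits = record
      { F = F c ; edges = edges c ; covering = covering c ; cheap = ≤-trans (cheap c) (m≤m+n _ _) }
    where
    open Cover
    none : ∀ {Q K} → Q ∈ special → ¬ Special G v₀ W Q K
    none {Q} {K} q∈ S with hits {Q} {K} q∈ S
    ... | _ , () , _
    reduce : Reduction G v₀ W → Cover G v₀ cubic W (Φ G W)
    reduce r = reduction-cover G v₀ cubic r λ H le hits′ → deficient k (_∖_ G W (Reduction.xs r)) H
      (≤-trans (≤-trans (≤-reflexive (+-comm 1 _)) (≤-trans (+-monoʳ-≤ _ (s≤s z≤n)) le)) (≤-trans (m≤m+n _ _) lt))
      (z , cong (_∧ not (member _≟_ (Reduction.xs r) z)) wz) hits′
    c : Cover G v₀ cubic W (Φ G W)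
    c with any? (λ v → W v ≟ᵇ true)
    ... | yes (v , w) = Deficiency.goal W (z , wz) (λ {Q} {K} → none {Q} {K}) reduce w
    ... | no empty = record { F = [] ; edges = λ () ; covering = λ {v} w → ⊥-elim (empty (v , w)) ; cheap = z≤n }

  -- The case W = V and the Petersen graph

  full : VSet G
  full _ = true

  deg-full : ∀ v → deg G full v ≡ 3
  deg-full v = trans (filterᵇ-cong-length (λ u → Adj G v u ∧ true) (Adj G v) (allFin n) (λ _ → ∧-identityʳ _)) (cubic v)

  full-reduce : Reduction G v₀ full → Cover G v₀ cubic full (Φ G full)
  full-reduce r = reduction-cover G v₀ cubic r λ H le hits → deficient _ (_∖_ G full (Reduction.xs r)) H ≤-refl (missing (Reduction.xs r) refl) hits
    where
    open Reduction r
    missing : ∀ ys → ys ≡ xs → ∃ λ z → (_∖_ G full xs) z ≡ false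
    missing (y ∷ ys) refl = y , cong not (member⁺ _≟_ {y ∷ ys} (here refl))
    -- A reduction that removes nothing is impossible: it would leave the weight unchanged, but its
    -- edges have to be paid.
    missing []       refl = ⊥-elim (<⇒≱ (≤-trans (+-monoˡ-≤ (Φ G full) (≤-trans (s≤s z≤n) (*-monoʳ-≤ 105 F-some)))
                              (m≤m+n _ (15 * (length U / suc a)))) budget)

  module _ (not-petersen : ¬ Isomorphic G Petersen) where

    -- All ten vertices of the pattern are closed, so an occurrence is closed under adjacency; as G
    -- is connected it is all of G. Closedness also gives the absence of further edges, so the
    -- numbering is an isomorphism.
    no-petersen : ∀ σ → ¬ Emb G full petersen σ
    no-petersen σ E = not-petersen (mk⤖ (index-injective , index-surjective) , adjacency)
      where
      open Emb E
      τ : Fin 10 → Fin n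
      τ i = σ (toℕ i)
      petersen-closed : ∀ {i} → i < 10 → closed petersen i ≡ true
      petersen-closed i< = all-true (closed petersen) {upTo 10} refl (∈-upTo⁺ i<)
      pre : ∀ {u v} → Reachable G u v → (∃ λ i → i < 10 × u ≡ σ i) → ∃ λ i → i < 10 × v ≡ σ i
      pre Defs.here p = p
      pre (Defs.step a r) (i , i< , refl) with closure G E i< (petersen-closed i<) refl a
      ... | j , _ , j< , e = pre r (j , j< , e)
      preimage : ∀ v → ∃ λ i → i < 10 × v ≡ σ i
      preimage v = pre (connected (σ 0) v) (0 , s≤s z≤n , refl)
      index : Fin n → Fin 10
      index v = fromℕ< (proj₁ (proj₂ (preimage v)))
      τ-index : ∀ v → τ (index v) ≡ v
      τ-index v = trans (cong σ (toℕ-fromℕ< (proj₁ (proj₂ (preimage v))))) (sym (proj₂ (proj₂ (preimage v))))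
      index-τ : ∀ i → index (τ i) ≡ i
      index-τ i = toℕ-injective (inj (toℕ<n (index (τ i))) (toℕ<n i) (τ-index (τ i)))
      index-injective : ∀ {u v} → index u ≡ index v → u ≡ v
      index-injective {u} {v} e = trans (sym (τ-index u)) (trans (cong τ e) (τ-index v))
      index-surjective : ∀ i → ∃ λ v → ∀ {w} → w ≡ v → index w ≡ i
      index-surjective i = τ i , λ { refl → index-τ i }
      table : ∀ i j → (toℕ j ∈ᵇ nbrs petersen (toℕ i)) ≡ Adj Petersen i j
      table = toWitness {a? = all? (λ i → all? (λ j → (toℕ j ∈ᵇ nbrs petersen (toℕ i)) ≟ᵇ Adj Petersen i j))} _
      adj-τ : ∀ i j → Adj G (τ i) (τ j) ≡ (toℕ j ∈ᵇ nbrs petersen (toℕ i))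
      adj-τ i j with toℕ j ∈ᵇ nbrs petersen (toℕ i) in m
      ... | true = edg (toℕ<n i) (∈ᵇ⇒∈ _ m)
      ... | false with Adj G (τ i) (τ j) in a
      ...   | false = refl
      ...   | true with closure G E (toℕ<n i) (petersen-closed (toℕ<n i)) refl a
      ...     | k , k∈ , k< , e = ⊥-elim (∉ᵇ⇒∉ m (subst (_∈ _) (sym (inj (toℕ<n j) k< e)) k∈))
      adjacency : ∀ u v → Adj G u v ≡ Adj Petersen (index u) (index v)
      adjacency u v = trans (cong₂ (Adj G) (sym (τ-index u)) (sym (τ-index v))) (trans (adj-τ (index u) (index v)) (table (index u) (index v)))

    full-isolated : ∀ v → full v ≡ true → deg G full v ≡ 0 → Cover G v₀ cubic full (Φ G full)
    full-isolated v _ d = ⊥-elim (0≢1+n (trans (sym d) (deg-full v)))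

    open Soundness G v₀ cubic full (Cover G v₀ cubic full (Φ G full)) full-isolated full-reduce

    wrong-degree : ∀ d → 0 < d → d < 3 → Reducible ((d , []) ∷ [])
    wrong-degree d pos lt σ E = [ (λ e → ⊥-elim (<⇒≢ pos (sym e))) , (λ e → ⊥-elim (<⇒≢ lt (trans (sym e) (deg-full (σ 0))))) ]′ (Emb.dgr E {0} (s≤s z≤n))

    full-cover : Cover G v₀ cubic full (Φ G full)
    full-cover = resolved-goal fullLib (stages-sound cubicLib start cubicStages cubic-checked) (emb-single G v₀ cubic {full} {v₀} refl)
      (subst (λ x → resolved fullLib ((x , []) ∷ []) ≡ true) (sym (deg-full v₀)) degree-three-resolved)
      where
      start : ∀ {R} → R ∈ cubicLib → Reducible R
      start (here refl)                 = wrong-degree 1 (s≤s z≤n) (s≤s (s≤s z≤n))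
      start (there (here refl))         = wrong-degree 2 (s≤s z≤n) (s≤s (s≤s (s≤s z≤n)))
      start (there (there (here refl))) = λ σ E → ⊥-elim (no-petersen σ E)

    Φ-full : Φ G full ≡ 30 * n
    Φ-full = trans (constant (allFin n)) (cong (30 *_) (length-tabulate {n = n} id))
      where
      constant : ∀ vs → sum (map (term G full) vs) ≡ 30 * length vs
      constant []       = refl
      constant (v ∷ vs) = trans (cong₂ _+_ (cong weight (deg-full v)) (constant vs)) (sym (*-suc 30 (length vs)))

-- From edges to a paired dominating set

∣∪∣≤ : ∀ {n} (p q : Subset n) → ∣ p ∪ q ∣ ≤ ∣ p ∣ + ∣ q ∣
∣∪∣≤ []             []             = z≤n
∣∪∣≤ (inside  ∷ p) (inside  ∷ q) = s≤s (≤-trans (∣∪∣≤ p q) (+-monoʳ-≤ ∣ p ∣ (n≤1+n ∣ q ∣)))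
∣∪∣≤ (inside  ∷ p) (outside ∷ q) = s≤s (∣∪∣≤ p q)
∣∪∣≤ (outside ∷ p) (inside  ∷ q) = ≤-trans (s≤s (∣∪∣≤ p q)) (≤-reflexive (sym (+-suc ∣ p ∣ ∣ q ∣)))
∣∪∣≤ (outside ∷ p) (outside ∷ q) = ∣∪∣≤ p q

module _ {n : ℕ} (G : Graph n) (v₀ : Fin n) where

  Dominated : Subset n → Fin n → Set
  Dominated S v = v ∈ₛ S ⊎ ∃ λ u → u ∈ₛ S × Adj G v u ≡ true

  -- Edges of F may share ends, so S cannot simply be the set of all ends, and S need not even
  -- contain every end. What is kept is that everything F dominates is dominated by S.
  record Paired (F : List (Fin n × Fin n)) : Set where
    field
      S        : Subset n
      matching : HasPerfectMatching G S
      size     : ∣ S ∣ ≤ 2 * length F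
      spans    : ∀ {e v} → e ∈ F → Dominates G v₀ e v → Dominated S v

  addPair : ∀ (S : Subset n) → HasPerfectMatching G S → ∀ {x y} → x ∉ₛ S → y ∉ₛ S → Adj G x y ≡ true →
            HasPerfectMatching G (S ∪ (⁅ x ⁆ ∪ ⁅ y ⁆))
  addPair S (M , matched) {x} {y} x∉ y∉ a = M′ , matched′
    where
    x≢y : x ≢ y
    x≢y = adj-irrefl G a
    M′ : Fin n → Fin n
    M′ v with v ≟ x | v ≟ y
    ... | yes _ | _     = y
    ... | no _  | yes _ = x
    ... | no _  | no _  = M v
    M′-x : M′ x ≡ y
    M′-x with x ≟ x
    ... | yes _ = refl
    ... | no ne = ⊥-elim (ne refl)
    M′-y : M′ y ≡ x
    M′-y with y ≟ x | y ≟ y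
    ... | yes e | _     = ⊥-elim (x≢y (sym e))
    ... | no _  | yes _ = refl
    ... | no _  | no ne = ⊥-elim (ne refl)
    M′-S : ∀ {v} → v ∈ₛ S → M′ v ≡ M v
    M′-S {v} v∈ with v ≟ x | v ≟ y
    ... | yes refl | _        = ⊥-elim (x∉ v∈)
    ... | no _     | yes refl = ⊥-elim (y∉ v∈)
    ... | no _     | no _     = refl
    S′ = S ∪ (⁅ x ⁆ ∪ ⁅ y ⁆)
    x∈ : x ∈ₛ S′
    x∈ = x∈p∪q⁺ (inj₂ (x∈p∪q⁺ (inj₁ (x∈⁅x⁆ x))))
    y∈ : y ∈ₛ S′
    y∈ = x∈p∪q⁺ {p = S} (inj₂ (x∈p∪q⁺ {p = ⁅ x ⁆} (inj₂ (x∈⁅x⁆ y))))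
    OK : Fin n → Set
    OK v = (M′ v ∈ₛ S′) × (Adj G v (M′ v) ≡ true) × (M′ (M′ v) ≡ v)
    matched′ : ∀ v → v ∈ₛ S′ → OK v
    matched′ v v∈ with x∈p∪q⁻ S _ v∈
    ... | inj₁ v∈S with matched v v∈S
    ...   | m∈ , am , mm = subst (_∈ₛ S′) (sym (M′-S v∈S)) (x∈p∪q⁺ (inj₁ m∈))
                         , trans (cong (Adj G v) (M′-S v∈S)) am
                         , trans (cong M′ (M′-S v∈S)) (trans (M′-S m∈) mm)
    matched′ v v∈ | inj₂ v∈xy with x∈p∪q⁻ ⁅ x ⁆ ⁅ y ⁆ v∈xy
    ... | inj₁ v∈x with x∈⁅y⁆⇒x≡y x v∈x
    ...   | refl = subst (_∈ₛ S′) (sym M′-x) y∈ , trans (cong (Adj G x) M′-x) a , trans (cong M′ M′-x) M′-y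
    matched′ v v∈ | inj₂ v∈xy | inj₂ v∈y with x∈⁅y⁆⇒x≡y y v∈y
    ... | refl = subst (_∈ₛ S′) (sym M′-y) x∈ , trans (cong (Adj G y) M′-y) (adj-sym G a) , trans (cong M′ M′-y) M′-x

  record Extension (S : Subset n) (a b : Fin n) : Set where
    field
      S′       : Subset n
      matching : HasPerfectMatching G S′
      grows    : ∣ S′ ∣ ≤ 2 + ∣ S ∣
      keeps    : ∀ {v} → v ∈ₛ S → v ∈ₛ S′
      spans    : ∀ {v} → Dominates G v₀ (a , b) v → Dominated S′ v

  keep : ∀ {S a b} → HasPerfectMatching G S → (∀ {v} → Dominates G v₀ (a , b) v → Dominated S v) → Extension S a b
  keep m c = record { matching = m ; grows = m≤n+m _ 2 ; keeps = id ; spans = c }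

  -- The new pair need not be the edge ab: it may match one end with a third vertex, the other end
  -- being in S already.
  grow : ∀ {S a b x y} → HasPerfectMatching G S → x ∉ₛ S → y ∉ₛ S → Adj G x y ≡ true →
         (∀ {S′} → (∀ {v} → v ∈ₛ S → v ∈ₛ S′) → x ∈ₛ S′ → y ∈ₛ S′ → a ∈ₛ S′ × b ∈ₛ S′) → Extension S a b
  grow {S} {a} {b} {x} {y} m x∉ y∉ adj ends = record
    { matching = addPair S m x∉ y∉ adj
    ; grows = ≤-trans (∣∪∣≤ S (⁅ x ⁆ ∪ ⁅ y ⁆)) (≤-trans (+-monoʳ-≤ ∣ S ∣ (≤-trans (∣∪∣≤ ⁅ x ⁆ ⁅ y ⁆)
                (≤-reflexive (cong₂ _+_ (∣⁅x⁆∣≡1 x) (∣⁅x⁆∣≡1 y))))) (≤-reflexive (+-comm ∣ S ∣ 2)))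
    ; keeps = x∈p∪q⁺ ∘ inj₁
    ; spans = both (proj₁ ab) (proj₂ ab) }
    where
    S′ = S ∪ (⁅ x ⁆ ∪ ⁅ y ⁆)
    ab : a ∈ₛ S′ × b ∈ₛ S′
    ab = ends {S′} (x∈p∪q⁺ ∘ inj₁) (x∈p∪q⁺ (inj₂ (x∈p∪q⁺ (inj₁ (x∈⁅x⁆ x))))) (x∈p∪q⁺ {p = S} (inj₂ (x∈p∪q⁺ {p = ⁅ x ⁆} (inj₂ (x∈⁅x⁆ y)))))
    both : ∀ {T} → a ∈ₛ T → b ∈ₛ T → ∀ {v} → Dominates G v₀ (a , b) v → Dominated T v
    both a∈ b∈ (inj₁ refl)               = inj₁ a∈
    both a∈ b∈ (inj₂ (inj₁ refl))        = inj₁ b∈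
    both a∈ b∈ (inj₂ (inj₂ (inj₁ av)))   = inj₂ (a , a∈ , adj-sym G av)
    both a∈ b∈ (inj₂ (inj₂ (inj₂ bv)))   = inj₂ (b , b∈ , adj-sym G bv)

  swap-ends : ∀ {a b v} → Dominates G v₀ (a , b) v → Dominates G v₀ (b , a) v
  swap-ends (inj₁ e)               = inj₂ (inj₁ e)
  swap-ends (inj₂ (inj₁ e))        = inj₁ e
  swap-ends (inj₂ (inj₂ (inj₁ a))) = inj₂ (inj₂ (inj₂ a))
  swap-ends (inj₂ (inj₂ (inj₂ b))) = inj₂ (inj₂ (inj₁ b))

  flip : ∀ {S a b} → Extension S a b → Extension S b a
  flip e = record { S′ = S′ ; matching = matching ; grows = grows ; keeps = keeps ; spans = spans ∘ swap-ends }
    where open Extension e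

  -- If a already lies in S but b does not, pair b with a neighbour outside S; if there is none then all neighbours of b lie in S.
  half : ∀ {S a b} → HasPerfectMatching G S → Adj G a b ≡ true → a ∈ₛ S → b ∉ₛ S → Extension S a b
  half {S} {a} {b} m adj a∈ b∉ with any? (λ c → (Adj G b c ≟ᵇ true) ×-dec ¬? (c ∈ₛ? S))
  ... | yes (c , bc , c∉) = grow m b∉ c∉ bc (λ sub b∈ _ → sub a∈ , b∈)
  ... | no none = keep m cov
    where
    cov : ∀ {v} → Dominates G v₀ (a , b) v → Dominated S v
    cov (inj₁ refl)             = inj₁ a∈
    cov (inj₂ (inj₁ refl))      = inj₂ (a , a∈ , adj-sym G adj)
    cov (inj₂ (inj₂ (inj₁ av))) = inj₂ (a , a∈ , adj-sym G av)
    cov {v} (inj₂ (inj₂ (inj₂ bv))) with v ∈ₛ? S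
    ... | yes v∈ = inj₁ v∈
    ... | no v∉  = ⊥-elim (none (v , bv , v∉))

  addEdge : ∀ {S a b} → HasPerfectMatching G S → Adj G a b ≡ true → Extension S a b
  addEdge {S} {a} {b} m adj with a ∈ₛ? S | b ∈ₛ? S
  ... | yes a∈ | no b∉  = half m adj a∈ b∉
  ... | no a∉  | yes b∈ = flip (half m (adj-sym G adj) b∈ a∉)
  ... | no a∉  | no b∉  = grow m a∉ b∉ adj (λ _ a∈ b∈ → a∈ , b∈)
  ... | yes a∈ | yes b∈ = keep m cov
    where
    cov : ∀ {v} → Dominates G v₀ (a , b) v → Dominated S v
    cov (inj₁ refl)             = inj₁ a∈
    cov (inj₂ (inj₁ refl))      = inj₁ b∈
    cov (inj₂ (inj₂ (inj₁ av))) = inj₂ (a , a∈ , adj-sym G av)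
    cov (inj₂ (inj₂ (inj₂ bv))) = inj₂ (b , b∈ , adj-sym G bv)

  pairUp : ∀ F → (∀ {e} → e ∈ F → Adj G (proj₁ e) (proj₂ e) ≡ true) → Paired F
  pairUp [] _ = record
    { S = ∅ ; matching = id , (λ v v∈ → ⊥-elim (∉⊥ v∈)) ; size = ≤-reflexive (∣⊥∣≡0 n) ; spans = λ () }
  pairUp ((a , b) ∷ F) edges = record
    { S = S′ ; matching = matching
    ; size = ≤-trans grows (≤-trans (+-monoʳ-≤ 2 (Paired.size rest)) (≤-reflexive (sym (*-suc 2 (length F)))))
    ; spans = cov }
    where
    rest : Paired F
    rest = pairUp F (edges ∘ there)
    open Extension (addEdge (Paired.matching rest) (edges (here refl)))
    cov : ∀ {e v} → e ∈ (a , b) ∷ F → Dominates G v₀ e v → Dominated S′ v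
    cov (here refl) d = spans d
    cov (there e∈)  d = [ inj₁ ∘ keeps , (λ { (u , u∈ , uv) → inj₂ (u , keeps u∈ , uv) }) ]′ (Paired.spans rest e∈ d)

-- From |S| ≤ 2|F| and 105|F| ≤ 30n one gets 105|S| ≤ 60n; the common factor 15 is cancelled.
cover⇒γpr : ∀ {n} (G : Graph n) (v₀ : Fin n) (cubic : Cubic G) → Cover G v₀ cubic (λ _ → true) (30 * n) → γpr≤4n/7 G
cover⇒γpr {n} G v₀ cubic c = S , (dominating , matching) , *-cancelˡ-≤ 15 bound
  where
  open Cover c using (F; edges; covering; cheap)
  open Paired (pairUp G v₀ F edges)
  dominating : Dominating G S
  dominating v v∉ = [ (λ v∈ → ⊥-elim (v∉ v∈)) , id ]′ (spans (proj₁ (proj₂ dom)) (proj₂ (proj₂ dom)))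
    where dom = covering {v} refl
  bound : 15 * (7 * ∣ S ∣) ≤ 15 * (4 * n)
  bound = begin
    15 * (7 * ∣ S ∣)        ≡⟨ *-assoc 15 7 ∣ S ∣ ⟨
    105 * ∣ S ∣             ≤⟨ *-monoʳ-≤ 105 size ⟩
    105 * (2 * length F)    ≡⟨ *-assoc 105 2 (length F) ⟨
    (2 * 105) * length F    ≡⟨ *-assoc 2 105 (length F) ⟩
    2 * (105 * length F)    ≤⟨ *-monoʳ-≤ 2 cheap ⟩
    2 * (30 * n)            ≡⟨ *-assoc 2 30 n ⟨
    60 * n                  ≡⟨ *-assoc 15 4 n ⟩
    15 * (4 * n)            ∎
    where open ≤-Reasoning

theorem7 : ∀ (n : ℕ) (G : Graph n) → Connected G → Cubic G →
    ¬ Isomorphic G Petersen → γpr≤4n/7 G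
-- Without vertices there is no `v₀`; the empty set is paired dominating.
theorem7 zero    G _ _ _ = [] , ((λ ()) , id , λ ()) , z≤n
theorem7 (suc n) G connected cubic not-petersen =
  cover⇒γpr G zero cubic (subst (Cover G zero cubic (full G zero cubic connected))
    (Φ-full G zero cubic connected not-petersen) (full-cover G zero cubic connected not-petersen))
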